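{- In general, the maximum of $|\det A|$ over $n\times n$ circulant matrices $A$ with real entries in $[-1,1]$ is not attained at an extreme point of the cube $[-1,1]^n$ of first rows. Specifically: (1) For $n=9$, let $A(\varepsilon) := \mathrm{circ}(1-\varepsilon,1,-1,1,-1,-1,1,1,1)$. Then $\det A(\varepsilon) = 6912 + 4608\,\varepsilon + O(\varepsilon^2)$ as $\varepsilon \to 0$, $D_{\pm1}(9) = 6912$, and $\det A(1) = 8582 > 6912$. (2) For $n=10$, $D_{\pm 1}(10) = 22528$, and as $\varepsilon\to 0$, $$\det\mathrm{circ}(1-\varepsilon,-1,1,1,-1,-1,-1,-1,-1,-1) = -(22528 + 2560\,\varepsilon + O(\varepsilon^2)),$$ $$\det\mathrm{circ}(-1+\varepsilon,-1,-1,1,-1,1,1,-1,-1,-1) = 22528 + 7680\,\varepsilon + O(\varepsilon^2).$$ Moreover, for $A(x) := \mathrm{circ}(x,-1,1,-1,1,1,-1,-1,-1,-1)$, $\det A(x)$ is an even polynomial in $x$ and $-\det A(0) = 33489 > -\det A(\pm1) = 22528 = D_{\pm1}(10)$. (3) For $n=22$, let $A(x) := \mathrm{circ}(x,-1,1,1,-1,-1,-1,-1,-1,-1,-1,1,1,-1,1,-1,1,-1,1,1,-1,-1)$. Then $-\det A(0) = 216409254831025 > -\det A(\pm1) = 215055782117376 = D_{\pm1}(22)$. Hence $\max\{|\det\mathrm{circ}(a)| : a\in[-1,1]^n\} > D_{\pm1}(n)$ for $n\in\{9,10,22\}$.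
   Context: For a positive integer $n$, $\mathrm{circ}(a_0,\ldots,a_{n-1})$ denotes the $n\times n$ circulant matrix $(a_{(k-j)\bmod n})_{0\le j,k<n}$, whose first row is $a=(a_0,\ldots,a_{n-1})$. $D_{\pm1}(n)$ denotes the maximum of $|\det B|$ over all $n \times n$ circulant matrices $B$ with entries in $\{ -1,1\}$, i.e. the maximum of $|\det\mathrm{circ}(a)|$ over the extreme points $a \in \{ -1,1\}^n$ of the cube $[-1,1]^n$. -}

module Defs where

open import Algebra.Bundles.Raw using (RawRing)
import Algebra.Definitions.RawSemiring as RawSemiringDefs
open import Data.Fin.Base using (Fin; zero; suc; toℕ; punchIn)
open import Data.Fin.Properties using (nonZeroIndex)
open import Data.Integer.Base as ℤ using (ℤ; +_; 1ℤ; -1ℤ)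
open import Data.List.Base as List using (List; map; foldr; cartesianProductWith)
open import Data.List.Extrema.Nat using (max)
open import Data.Nat.Base as ℕ using (ℕ; zero; suc)
open import Data.Nat.DivMod using (_mod_)
import Data.Nat.Properties as ℕ
open import Data.Product.Base using (Σ; ∃-syntax; _×_; _,_)
open import Data.Rational.Base as ℚ using (ℚ; 0ℚ; 1ℚ; ½)
import Data.Rational.Properties as ℚ
open import Data.Rational.Solver using (module +-*-Solver)
open import Data.Sum.Base using (_⊎_; inj₁; inj₂)
open import Data.Vec.Functional using (Vector; []; _∷_)
open import Level using (0ℓ)
open import Relation.Binary.PropositionalEquality

Matrix : ∀ {a} → Set a → ℕ → Set a
Matrix A n = Vector (Vector A n) n

module _ {c ℓ} (R : RawRing c ℓ) where
  open RawRing R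
  open RawSemiringDefs rawSemiring using (_^_; sum)

  -- Laplace expansion along the first row:
  -- det M = Σⱼ (-1)ʲ M₀ⱼ det(M with row 0 and column j deleted).
  determinant : ∀ {n} → Matrix Carrier n → Carrier
  determinant {zero}  M = 1#
  determinant {suc n} M = sum λ j →
    (- 1#) ^ toℕ j * (M zero j * determinant (λ i k → M (suc i) (punchIn j k)))

-- The index is (k - j) mod n, computed as (k + (n ∸ j)) mod n, which is
-- the same because j < n.
circ : ∀ {a} {A : Set a} {n} → Vector A n → Matrix A n
circ {n = n} a j k = a (_mod_ (toℕ k ℕ.+ (n ℕ.∸ toℕ j)) n {{nonZeroIndex j}})

signVectors : ∀ n → List (Vector ℤ n)
signVectors zero    = List.[ [] ]
signVectors (suc n) =
  cartesianProductWith _∷_ (1ℤ List.∷ -1ℤ List.∷ List.[]) (signVectors n)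

-- The default value 0 in `max` is harmless: the list is nonempty and
-- consists of absolute values.
D±1 : ℕ → ℕ
D±1 n = max 0 (map (λ a → ℤ.∣ determinant ℤ.+-*-rawRing (circ a) ∣) (signVectors n))

private
  half : ℚ → ℚ
  half p = p ℚ.* ½

  half>0 : ∀ {p} → 0ℚ ℚ.< p → 0ℚ ℚ.< half p
  half>0 {p} 0<p = subst (ℚ._< half p) (ℚ.*-zeroˡ ½) (ℚ.*-monoˡ-<-pos ½ 0<p)

  half+half : ∀ p → half p ℚ.+ half p ≡ p
  half+half p = trans (sym (ℚ.*-distribˡ-+ p ½ ½)) (ℚ.*-identityʳ p)

  ∣p∣-∣q∣≤∣p-q∣ : ∀ p q → ℚ.∣ p ∣ ℚ.- ℚ.∣ q ∣ ℚ.≤ ℚ.∣ p ℚ.- q ∣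
  ∣p∣-∣q∣≤∣p-q∣ p q = begin
    ℚ.∣ p ∣ ℚ.- ℚ.∣ q ∣
      ≡⟨ cong (λ r → ℚ.∣ r ∣ ℚ.- ℚ.∣ q ∣) (p≡p-q+q p q) ⟩
    ℚ.∣ (p ℚ.- q) ℚ.+ q ∣ ℚ.- ℚ.∣ q ∣
      ≤⟨ ℚ.+-monoˡ-≤ (ℚ.- ℚ.∣ q ∣) (ℚ.∣p+q∣≤∣p∣+∣q∣ (p ℚ.- q) q) ⟩
    ℚ.∣ p ℚ.- q ∣ ℚ.+ ℚ.∣ q ∣ ℚ.- ℚ.∣ q ∣
      ≡⟨ p+q-q≡p ℚ.∣ p ℚ.- q ∣ ℚ.∣ q ∣ ⟩
    ℚ.∣ p ℚ.- q ∣ ∎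
    where
    open ℚ.≤-Reasoning
    open +-*-Solver
    p≡p-q+q : ∀ p q → p ≡ (p ℚ.- q) ℚ.+ q
    p≡p-q+q = solve 2 (λ p q → p := (p :- q) :+ q) refl
    p+q-q≡p : ∀ p q → p ℚ.+ q ℚ.- q ≡ p
    p+q-q≡p = solve 2 (λ p q → p :+ q :- q := p) refl

  ∣p-q∣≡∣q-p∣ : ∀ p q → ℚ.∣ p ℚ.- q ∣ ≡ ℚ.∣ q ℚ.- p ∣
  ∣p-q∣≡∣q-p∣ p q = trans (sym (ℚ.∣-p∣≡∣p∣ (p ℚ.- q))) (cong ℚ.∣_∣ (lemma p q))
    where
    open +-*-Solver
    lemma : ∀ p q → ℚ.- (p ℚ.- q) ≡ q ℚ.- p
    lemma = solve 2 (λ p q → :- (p :- q) := q :- p) refl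

  ∣∣p∣-∣q∣∣≤∣p-q∣ : ∀ p q → ℚ.∣ ℚ.∣ p ∣ ℚ.- ℚ.∣ q ∣ ∣ ℚ.≤ ℚ.∣ p ℚ.- q ∣
  ∣∣p∣-∣q∣∣≤∣p-q∣ p q with ℚ.∣p∣≡p∨∣p∣≡-p (ℚ.∣ p ∣ ℚ.- ℚ.∣ q ∣)
  ... | inj₁ eq = subst (ℚ._≤ ℚ.∣ p ℚ.- q ∣) (sym eq) (∣p∣-∣q∣≤∣p-q∣ p q)
  ... | inj₂ eq = subst₂ ℚ._≤_ (sym (trans eq (lemma ℚ.∣ p ∣ ℚ.∣ q ∣))) (∣p-q∣≡∣q-p∣ q p)
                    (∣p∣-∣q∣≤∣p-q∣ q p)
    where
    open +-*-Solver
    lemma : ∀ p q → ℚ.- (p ℚ.- q) ≡ q ℚ.- p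
    lemma = solve 2 (λ p q → :- (p :- q) := q :- p) refl

  quotient : ∀ b ε → 0ℚ ℚ.< b → 0ℚ ℚ.< ε →
             ∃[ δ ] 0ℚ ℚ.< δ × b ℚ.* δ ≡ ε
  quotient b ε 0<b 0<ε = ε ℚ.* b⁻¹ , 0<δ , bδ≡ε
    where
    instance
      _ = ℚ.positive 0<b
      _ = ℚ.pos⇒nonZero b
    b⁻¹ : ℚ
    b⁻¹ = ℚ.1/ b
    instance
      _ = ℚ.1/pos⇒pos b
    0<δ : 0ℚ ℚ.< ε ℚ.* b⁻¹
    0<δ = subst (ℚ._< ε ℚ.* b⁻¹) (ℚ.*-zeroˡ b⁻¹) (ℚ.*-monoˡ-<-pos b⁻¹ 0<ε)
    bδ≡ε : b ℚ.* (ε ℚ.* b⁻¹) ≡ ε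
    bδ≡ε = begin
      b ℚ.* (ε ℚ.* b⁻¹)  ≡⟨ cong (b ℚ.*_) (ℚ.*-comm ε b⁻¹) ⟩
      b ℚ.* (b⁻¹ ℚ.* ε)  ≡⟨ ℚ.*-assoc b b⁻¹ ε ⟨
      b ℚ.* b⁻¹ ℚ.* ε    ≡⟨ cong (ℚ._* ε) (ℚ.*-inverseʳ b) ⟩
      1ℚ ℚ.* ε           ≡⟨ ℚ.*-identityˡ ε ⟩
      ε                  ∎
      where open ≡-Reasoning

IsCauchy : (ℕ → ℚ) → Set
IsCauchy s = ∀ ε → 0ℚ ℚ.< ε →
  ∃[ N ] ∀ m n → N ℕ.≤ m → N ℕ.≤ n → ℚ.∣ s m ℚ.- s n ∣ ℚ.< ε

-- Reals are Cauchy sequences of rationals; equality of reals is _≃_ below.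
record ℝ : Set where
  constructor mkℝ
  field
    seq    : ℕ → ℚ
    cauchy : IsCauchy seq

open ℝ public

private
  const-cauchy : ∀ p → IsCauchy (λ _ → p)
  const-cauchy p ε 0<ε =
    0 , λ _ _ _ _ → subst (λ d → ℚ.∣ d ∣ ℚ.< ε) (sym (ℚ.+-inverseʳ p)) 0<ε

  +-cauchy : ∀ s t → IsCauchy s → IsCauchy t → IsCauchy (λ n → s n ℚ.+ t n)
  +-cauchy s t sc tc ε 0<ε with sc (half ε) (half>0 0<ε) | tc (half ε) (half>0 0<ε)
  ... | M , sM | N , tN = M ℕ.⊔ N , λ m n m≥ n≥ → begin-strict
    ℚ.∣ (s m ℚ.+ t m) ℚ.- (s n ℚ.+ t n) ∣
      ≡⟨ cong ℚ.∣_∣ (lemma (s m) (t m) (s n) (t n)) ⟩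
    ℚ.∣ (s m ℚ.- s n) ℚ.+ (t m ℚ.- t n) ∣
      ≤⟨ ℚ.∣p+q∣≤∣p∣+∣q∣ (s m ℚ.- s n) (t m ℚ.- t n) ⟩
    ℚ.∣ s m ℚ.- s n ∣ ℚ.+ ℚ.∣ t m ℚ.- t n ∣
      <⟨ ℚ.+-mono-< (sM m n (ℕ.m⊔n≤o⇒m≤o M N m≥) (ℕ.m⊔n≤o⇒m≤o M N n≥))
                    (tN m n (ℕ.m⊔n≤o⇒n≤o M N m≥) (ℕ.m⊔n≤o⇒n≤o M N n≥)) ⟩
    half ε ℚ.+ half ε
      ≡⟨ half+half ε ⟩
    ε ∎
    where
    open ℚ.≤-Reasoning
    open +-*-Solver
    lemma : ∀ a b c d → (a ℚ.+ b) ℚ.- (c ℚ.+ d) ≡ (a ℚ.- c) ℚ.+ (b ℚ.- d)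
    lemma = solve 4 (λ a b c d → (a :+ b) :- (c :+ d) := (a :- c) :+ (b :- d)) refl

  neg-cauchy : ∀ s → IsCauchy s → IsCauchy (λ n → ℚ.- s n)
  neg-cauchy s sc ε 0<ε with sc ε 0<ε
  ... | N , sN = N , λ m n m≥ n≥ →
    subst (ℚ._< ε) (trans (∣p-q∣≡∣q-p∣ (s m) (s n)) (cong ℚ.∣_∣ (lemma (s m) (s n))))
      (sN m n m≥ n≥)
    where
    open +-*-Solver
    lemma : ∀ a b → b ℚ.- a ≡ ℚ.- a ℚ.- (ℚ.- b)
    lemma = solve 2 (λ a b → b :- a := :- a :- (:- b)) refl

  abs-cauchy : ∀ s → IsCauchy s → IsCauchy (λ n → ℚ.∣ s n ∣)
  abs-cauchy s sc ε 0<ε with sc ε 0<ε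
  ... | N , sN = N , λ m n m≥ n≥ →
    ℚ.≤-<-trans (∣∣p∣-∣q∣∣≤∣p-q∣ (s m) (s n)) (sN m n m≥ n≥)

  eventually-bounded : ∀ s → IsCauchy s →
    ∃[ b ] 0ℚ ℚ.< b × ∃[ N ] ∀ n → N ℕ.≤ n → ℚ.∣ s n ∣ ℚ.≤ b
  eventually-bounded s sc with sc 1ℚ (ℚ.positive⁻¹ 1ℚ)
  ... | N , sN = ℚ.∣ s N ∣ ℚ.+ 1ℚ
               , ℚ.+-mono-≤-< (ℚ.0≤∣p∣ (s N)) (ℚ.positive⁻¹ 1ℚ)
               , N , λ n n≥ → begin
    ℚ.∣ s n ∣                          ≡⟨ cong ℚ.∣_∣ (lemma (s n) (s N)) ⟩
    ℚ.∣ s N ℚ.+ (s n ℚ.- s N) ∣        ≤⟨ ℚ.∣p+q∣≤∣p∣+∣q∣ (s N) (s n ℚ.- s N) ⟩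
    ℚ.∣ s N ∣ ℚ.+ ℚ.∣ s n ℚ.- s N ∣    ≤⟨ ℚ.+-monoʳ-≤ ℚ.∣ s N ∣ (ℚ.<⇒≤ (sN n N n≥ ℕ.≤-refl)) ⟩
    ℚ.∣ s N ∣ ℚ.+ 1ℚ                   ∎
    where
    open ℚ.≤-Reasoning
    open +-*-Solver
    lemma : ∀ a b → a ≡ b ℚ.+ (a ℚ.- b)
    lemma = solve 2 (λ a b → a := b :+ (a :- b)) refl

  *-bound : ∀ {p q b ε} → 0ℚ ℚ.< b → ℚ.∣ p ∣ ℚ.≤ b → ℚ.∣ q ∣ ℚ.< ε → ℚ.∣ p ℚ.* q ∣ ℚ.< b ℚ.* ε
  *-bound {p} {q} {b} {ε} 0<b p≤b q<ε = begin-strict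
    ℚ.∣ p ℚ.* q ∣          ≡⟨ ℚ.∣p*q∣≡∣p∣*∣q∣ p q ⟩
    ℚ.∣ p ∣ ℚ.* ℚ.∣ q ∣    ≤⟨ ℚ.*-monoʳ-≤-nonNeg ℚ.∣ q ∣ p≤b ⟩
    b ℚ.* ℚ.∣ q ∣          <⟨ ℚ.*-monoʳ-<-pos b q<ε ⟩
    b ℚ.* ε                ∎
    where
    open ℚ.≤-Reasoning
    instance
      _ = ℚ.positive 0<b
      _ = ℚ.∣-∣-nonNeg q

  *-cauchy : ∀ s t → IsCauchy s → IsCauchy t → IsCauchy (λ n → s n ℚ.* t n)
  *-cauchy s t sc tc ε 0<ε =
    let b , 0<b , K , s≤b = eventually-bounded s sc
        c , 0<c , L , t≤c = eventually-bounded t tc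
        δ , 0<δ , bδ≡ = quotient b (half ε) 0<b (half>0 0<ε)
        η , 0<η , cη≡ = quotient c (half ε) 0<c (half>0 0<ε)
        M , sM = sc η 0<η
        N , tN = tc δ 0<δ
    in (K ℕ.⊔ L) ℕ.⊔ (M ℕ.⊔ N) , λ m n m≥ n≥ →
    let m≥KL = ℕ.m⊔n≤o⇒m≤o (K ℕ.⊔ L) (M ℕ.⊔ N) m≥
        n≥KL = ℕ.m⊔n≤o⇒m≤o (K ℕ.⊔ L) (M ℕ.⊔ N) n≥
        m≥MN = ℕ.m⊔n≤o⇒n≤o (K ℕ.⊔ L) (M ℕ.⊔ N) m≥
        n≥MN = ℕ.m⊔n≤o⇒n≤o (K ℕ.⊔ L) (M ℕ.⊔ N) n≥
    in estimate {b} {c} {δ} {η} {s m} {t m} {s n} {t n} 0<b 0<c bδ≡ cη≡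
         (s≤b m (ℕ.m⊔n≤o⇒m≤o K L m≥KL))
         (t≤c n (ℕ.m⊔n≤o⇒n≤o K L n≥KL))
         (tN m n (ℕ.m⊔n≤o⇒n≤o M N m≥MN) (ℕ.m⊔n≤o⇒n≤o M N n≥MN))
         (sM m n (ℕ.m⊔n≤o⇒m≤o M N m≥MN) (ℕ.m⊔n≤o⇒m≤o M N n≥MN))
    where
    estimate : ∀ {b c δ η p q p′ q′} → 0ℚ ℚ.< b → 0ℚ ℚ.< c →
               b ℚ.* δ ≡ half ε → c ℚ.* η ≡ half ε →
               ℚ.∣ p ∣ ℚ.≤ b → ℚ.∣ q′ ∣ ℚ.≤ c →
               ℚ.∣ q ℚ.- q′ ∣ ℚ.< δ → ℚ.∣ p ℚ.- p′ ∣ ℚ.< η →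
               ℚ.∣ p ℚ.* q ℚ.- p′ ℚ.* q′ ∣ ℚ.< ε
    estimate {b} {c} {δ} {η} {p} {q} {p′} {q′} 0<b 0<c bδ≡ cη≡ p≤b q′≤c q< p< = begin-strict
      ℚ.∣ p ℚ.* q ℚ.- p′ ℚ.* q′ ∣
        ≡⟨ cong ℚ.∣_∣ (lemma p q p′ q′) ⟩
      ℚ.∣ p ℚ.* (q ℚ.- q′) ℚ.+ q′ ℚ.* (p ℚ.- p′) ∣
        ≤⟨ ℚ.∣p+q∣≤∣p∣+∣q∣ (p ℚ.* (q ℚ.- q′)) (q′ ℚ.* (p ℚ.- p′)) ⟩
      ℚ.∣ p ℚ.* (q ℚ.- q′) ∣ ℚ.+ ℚ.∣ q′ ℚ.* (p ℚ.- p′) ∣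
        <⟨ ℚ.+-mono-< (*-bound {p} {q ℚ.- q′} 0<b p≤b q<) (*-bound {q′} {p ℚ.- p′} 0<c q′≤c p<) ⟩
      b ℚ.* δ ℚ.+ c ℚ.* η
        ≡⟨ cong₂ ℚ._+_ bδ≡ cη≡ ⟩
      half ε ℚ.+ half ε
        ≡⟨ half+half ε ⟩
      ε ∎
      where
      open ℚ.≤-Reasoning
      open +-*-Solver
      lemma : ∀ a b c d → a ℚ.* b ℚ.- c ℚ.* d ≡ a ℚ.* (b ℚ.- d) ℚ.+ d ℚ.* (a ℚ.- c)
      lemma = solve 4 (λ a b c d → a :* b :- c :* d := a :* (b :- d) :+ d :* (a :- c)) refl

infix  8 -_
infixl 7 _*_
infixl 6 _+_ _-_
infix  4 _≃_ _≤_ _<_ _∈O_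

fromℚ : ℚ → ℝ
fromℚ p = mkℝ (λ _ → p) (const-cauchy p)

fromℕ : ℕ → ℝ
fromℕ n = fromℚ (+ n ℚ./ 1)

0ℝ 1ℝ : ℝ
0ℝ = fromℕ 0
1ℝ = fromℕ 1

_+_ _*_ : ℝ → ℝ → ℝ
x + y = mkℝ (λ n → seq x n ℚ.+ seq y n) (+-cauchy (seq x) (seq y) (cauchy x) (cauchy y))
x * y = mkℝ (λ n → seq x n ℚ.* seq y n) (*-cauchy (seq x) (seq y) (cauchy x) (cauchy y))

-_ ∣_∣ : ℝ → ℝ
- x   = mkℝ (λ n → ℚ.- seq x n) (neg-cauchy (seq x) (cauchy x))
∣ x ∣ = mkℝ (λ n → ℚ.∣ seq x n ∣) (abs-cauchy (seq x) (cauchy x))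

_-_ : ℝ → ℝ → ℝ
x - y = x + (- y)

_≃_ _≤_ _<_ : ℝ → ℝ → Set
x ≃ y = ∀ ε → 0ℚ ℚ.< ε → ∃[ N ] ∀ n → N ℕ.≤ n → ℚ.∣ seq x n ℚ.- seq y n ∣ ℚ.< ε
x ≤ y = ∀ ε → 0ℚ ℚ.< ε → ∃[ N ] ∀ n → N ℕ.≤ n → seq x n ℚ.< seq y n ℚ.+ ε
x < y = ∃[ ε ] 0ℚ ℚ.< ε × ∃[ N ] ∀ n → N ℕ.≤ n → seq x n ℚ.+ ε ℚ.≤ seq y n

ℝ-rawRing : RawRing 0ℓ 0ℓ
ℝ-rawRing = record
  { Carrier = ℝ
  ; _≈_     = _≃_
  ; _+_     = _+_
  ; _*_     = _*_
  ; -_      = -_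
  ; 0#      = 0ℝ
  ; 1#      = 1ℝ
  }

det : ∀ {n} → Matrix ℝ n → ℝ
det = determinant ℝ-rawRing

-- As ε → 0 from both sides.
_∈O_ : (ℝ → ℝ) → (ℝ → ℝ) → Set
f ∈O g = ∃[ C ] ∃[ δ ] 0ℝ < δ × (∀ ε → ∣ ε ∣ < δ → ∣ f ε ∣ ≤ C * ∣ g ε ∣)

-- Coefficients are listed from the constant term upwards.
evalPoly : List ℝ → ℝ → ℝ
evalPoly p x = foldr (λ c r → c + x * r) 0ℝ p

IsEvenPolynomial : (ℝ → ℝ) → Set
IsEvenPolynomial f =
  (∃[ p ] ∀ x → f x ≃ evalPoly p x) × (∀ x → f (- x) ≃ f x)

InCube : ∀ {n} → Vector ℝ n → Set
InCube a = ∀ i → (- 1ℝ ≤ a i) × (a i ≤ 1ℝ)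

-- The extreme points of [-1,1]ⁿ are the points of {-1,1}ⁿ.
IsExtremePoint : ∀ {n} → Vector ℝ n → Set
IsExtremePoint a = ∀ i → (a i ≃ 1ℝ) ⊎ (a i ≃ - 1ℝ)

IsMaximum : (ℝ → Set) → ℝ → Set
IsMaximum S M = S M × (∀ y → S y → y ≤ M)

-- y ∈ { |det circ(a)| : a ∈ [-1,1]ⁿ }.
CubeValue : ℕ → ℝ → Set
CubeValue n y = Σ (Vector ℝ n) λ a → InCube a × y ≃ ∣ det (circ a) ∣

A₉ : ℝ → Matrix ℝ 9
A₉ ε = circ (1ℝ - ε ∷ 1ℝ ∷ - 1ℝ ∷ 1ℝ ∷ - 1ℝ ∷ - 1ℝ ∷ 1ℝ ∷ 1ℝ ∷ 1ℝ ∷ [])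

A₁₀ : ℝ → Matrix ℝ 10
A₁₀ x = circ (x ∷ - 1ℝ ∷ 1ℝ ∷ - 1ℝ ∷ 1ℝ ∷ 1ℝ ∷ - 1ℝ ∷ - 1ℝ ∷ - 1ℝ ∷ - 1ℝ ∷ [])

A₂₂ : ℝ → Matrix ℝ 22
A₂₂ x = circ
  ( x ∷ - 1ℝ ∷ 1ℝ ∷ 1ℝ ∷ - 1ℝ ∷ - 1ℝ ∷ - 1ℝ ∷ - 1ℝ ∷ - 1ℝ ∷ - 1ℝ ∷ - 1ℝ
  ∷ 1ℝ ∷ 1ℝ ∷ - 1ℝ ∷ 1ℝ ∷ - 1ℝ ∷ 1ℝ ∷ - 1ℝ ∷ 1ℝ ∷ 1ℝ ∷ - 1ℝ ∷ - 1ℝ ∷ [])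

B₁₀ C₁₀ : ℝ → Matrix ℝ 10
B₁₀ ε = circ (1ℝ - ε ∷ - 1ℝ ∷ 1ℝ ∷ 1ℝ ∷ - 1ℝ ∷ - 1ℝ ∷ - 1ℝ ∷ - 1ℝ ∷ - 1ℝ ∷ - 1ℝ ∷ [])
C₁₀ ε = circ (- 1ℝ + ε ∷ - 1ℝ ∷ - 1ℝ ∷ 1ℝ ∷ - 1ℝ ∷ 1ℝ ∷ 1ℝ ∷ - 1ℝ ∷ - 1ℝ ∷ - 1ℝ ∷ [])

{-# OPTIONS --safe #-}

-- Modulo m, the matrix (ω⁻ʲᵏ) of a root of unity ω of order n diagonalises every circulant
-- matrix, so det circ(a) ≡ ∏ⱼ Σₖ aₖ ωʲᵏ (mod m). As |det| ≤ n! bⁿ for entries bounded by b, a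
-- large m determines the determinant. This evaluates single determinants, and an exhaustive
-- search sharing partial sums yields D±1(9) and D±1(10).
--
-- For n = 22 put pₖ = aₖ + aₖ₊₁₁ and qₖ = (-1)ᵏ (aₖ - aₖ₊₁₁). Then det circ(a) equals
-- det circ(p) det circ(q), and for a sign vector a the entries of p and q lie in {0, ±2} and
-- their supports are complementary. So it suffices to maximise |det circ(p)| for each of the
-- 2¹¹ supports, which takes 3¹¹ instead of 2²² evaluations.
--
-- Real determinants are evaluated termwise along Cauchy sequences, as values of polynomials
-- obtained by expanding products of rows in the exterior algebra over ℤ[x].

module Submission where

open import Algebra.Bundles using (CommutativeRing)
open import Algebra.Bundles.Raw using (RawRing)
import Algebra.Definitions.RawSemiring as RawSemiringDefs
open import Data.Fin.Base using (Fin; zero; suc; toℕ; punchIn; _↑ˡ_; _↑ʳ_; splitAt)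
open import Data.Fin.Permutation using (Permutation; permutation)
import Data.Fin.Properties as Fin
open import Data.Fin.Properties using (all?; toℕ<n; toℕ-injective; toℕ-fromℕ<; toℕ-↑ˡ; toℕ-↑ʳ; splitAt-↑ˡ; splitAt-↑ʳ; nonZeroIndex)
open import Data.Fin.Subset using (Subset; inside; outside; ⊤)
open import Data.List.Base as List using (List; _∷_; [])
import Data.List.Extrema.Nat as Extrema
open import Data.List.Membership.Propositional using (_∈_)
open import Data.List.Membership.Propositional.Properties using (∈-map⁺; ∈-map⁻; ∈-cartesianProductWith⁺; ∈-cartesianProductWith⁻)
open import Data.List.Properties using (≡-dec)
import Data.List.Relation.Unary.All as All
open import Data.List.Relation.Unary.Any using (here; there)
open import Data.Nat.Base as ℕ using (ℕ; zero; suc; _!)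
import Data.Nat.Divisibility as ℕ
open import Data.Nat.DivMod using (_mod_; _%_; _/_; m≡m%n+[m/n]*n; [m+kn]%n≡m%n; m<n⇒m%n≡m; m%n<n)
import Data.Nat.Properties as ℕ
open import Data.Nat.Solver using (module +-*-Solver)
open import Data.Product.Base using (Σ; _×_; _,_; proj₁; proj₂; ∃-syntax)
open import Data.Sum.Base using (inj₁; inj₂; [_,_]′)
open import Data.Unit.Base using (tt)
open import Data.Vec.Base as Vec using (Vec; []; _∷_)
open import Data.Vec.Functional as Vector using (Vector; head; tail)
import Data.Vec.Properties as Vec
open import Function.Base using (_∘_; const; id)
open import Function.Bundles using (Equivalence)
open import Level using (0ℓ; _⊔_)
open import Relation.Binary.Core using (REL)
open import Relation.Binary.PropositionalEquality as ≡ using (_≡_; _≢_)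
open import Relation.Nullary.Decidable using (Dec; yes; no; True; ⌊_⌋; toWitness; ¬?; _→-dec_)
open import Relation.Nullary.Negation using (¬_; contradiction)
open import Defs using (Matrix; determinant; circ; signVectors; D±1)

-- Determinants over a commutative ring

-- The obstacle is that `determinant` is a Laplace expansion with n! terms and `D±1` ranges over 2ⁿ
-- vectors, so no value can be read off by unfolding definitions. Diagonalisation requires det(MN) =
-- det M det N for this recursive definition; it is obtained by identifying the determinant with the
-- top coefficient of the product of the rows in the exterior algebra, where a matrix acts on the
-- top degree by its own determinant.
--
-- Residues modulo m replace complex numbers because everything about the root of unity becomes a
-- finite check: the vanishing of its power sums and the invertibility of n are verified directly,
-- so m need not be prime.
--
-- For a fixed support the signs of p and of q vary independently, so maximising the two factors
-- separately loses nothing.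
--
-- The reals enter only through the ring operations, which act termwise. Explicit matrices have
-- constant integer sequences as entries and allow exact equalities. The entries of an extreme point
-- are merely `≃` to 1 or -1, so for these only limits of determinants are available.

module Determinant {c ℓ} (R : CommutativeRing c ℓ) where
  open CommutativeRing R hiding (zero)
  open import Algebra.Properties.Ring ring
  open import Data.Fin.Subset using (∣_∣)
  open import Data.Vec.Base using (insertAt)
  open import Algebra.Properties.Semiring.Sum semiring
  open import Algebra.Properties.Monoid.Sum *-monoid using () renaming (sum to product)
  open import Algebra.Properties.CommutativeSemigroup +-commutativeSemigroup
    using () renaming (interchange to +-interchange)
  open import Algebra.Properties.CommutativeSemigroup *-commutativeSemigroup
    using (x∙yz≈y∙xz)
  open import Algebra.Definitions.RawSemiring (RawRing.rawSemiring rawRing) using (_^_)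
  open import Relation.Binary.Reasoning.Setoid setoid

  -- The coefficient of e_{i₁} ∧ … ∧ e_{iₖ} in an element of the exterior algebra
  -- of Rⁿ is its value at {i₁ < … < iₖ}.
  Λ : ℕ → Set c
  Λ n = Subset n → Carrier

  infix 4 _≋_
  _≋_ : ∀ {n} → Λ n → Λ n → Set ℓ
  S ≋ T = ∀ p → S p ≈ T p

  -- Writing T = a + e₀ ∧ b, we have v ∧ T = v′ ∧ a + e₀ ∧ (v₀ a - v′ ∧ b).
  infixr 7 _∧_
  _∧_ : ∀ {n} → Vector Carrier n → Λ n → Λ n
  (v ∧ T) []            = 0#
  (v ∧ T) (outside ∷ p) = (tail v ∧ (λ q → T (outside ∷ q))) p
  (v ∧ T) (inside ∷ p)  =
    head v * T (outside ∷ p) - (tail v ∧ (λ q → T (inside ∷ q))) p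

  unit : ∀ {n} → Λ n
  unit []            = 1#
  unit (outside ∷ p) = unit p
  unit (inside ∷ p)  = 0#

  ⋀ : ∀ {k n} → Vector (Vector Carrier n) k → Λ n
  ⋀ {zero}  M = unit
  ⋀ {suc k} M = head M ∧ ⋀ (tail M)

  private
    -‿+-interchange : ∀ a b x y → (a + b) - (x + y) ≈ (a - x) + (b - y)
    -‿+-interchange a b x y =
      trans (+-congˡ (sym (-‿+-comm x y))) (+-interchange a b (- x) (- y))

    0-0≈0 : 0# - 0# ≈ 0#
    0-0≈0 = -‿inverseʳ 0#

  ∧-cong : ∀ {n} {u v : Vector Carrier n} {S T} →
           (∀ i → u i ≈ v i) → S ≋ T → u ∧ S ≋ v ∧ T
  ∧-cong u≈v S≋T []            = refl
  ∧-cong u≈v S≋T (outside ∷ p) = ∧-cong (u≈v ∘ suc) (S≋T ∘ (outside ∷_)) p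
  ∧-cong u≈v S≋T (inside ∷ p)  =
    +-cong (*-cong (u≈v zero) (S≋T (outside ∷ p)))
           (-‿cong (∧-cong (u≈v ∘ suc) (S≋T ∘ (inside ∷_)) p))

  ∧-congʳ : ∀ {n} (v : Vector Carrier n) {S T} → S ≋ T → v ∧ S ≋ v ∧ T
  ∧-congʳ v = ∧-cong {u = v} (λ _ → refl)

  ∧-zeroʳ : ∀ {n} (v : Vector Carrier n) → v ∧ const 0# ≋ const 0#
  ∧-zeroʳ v []            = refl
  ∧-zeroʳ v (outside ∷ p) = ∧-zeroʳ (tail v) p
  ∧-zeroʳ v (inside ∷ p)  =
    trans (+-cong (zeroʳ (head v)) (-‿cong (∧-zeroʳ (tail v) p))) 0-0≈0

  ∧-zeroˡ : ∀ {n} (T : Λ n) → const 0# ∧ T ≋ const 0#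
  ∧-zeroˡ T []            = refl
  ∧-zeroˡ T (outside ∷ p) = ∧-zeroˡ (T ∘ (outside ∷_)) p
  ∧-zeroˡ T (inside ∷ p)  =
    trans (+-cong (zeroˡ _) (-‿cong (∧-zeroˡ (T ∘ (inside ∷_)) p))) 0-0≈0

  ∧-distribˡ-+ : ∀ {n} (v : Vector Carrier n) S T →
                 v ∧ (λ p → S p + T p) ≋ λ p → (v ∧ S) p + (v ∧ T) p
  ∧-distribˡ-+ v S T []            = sym (+-identityʳ 0#)
  ∧-distribˡ-+ v S T (outside ∷ p) = ∧-distribˡ-+ (tail v) _ _ p
  ∧-distribˡ-+ v S T (inside ∷ p)  =
    trans (+-cong (distribˡ (head v) _ _) (-‿cong (∧-distribˡ-+ (tail v) _ _ p)))
          (-‿+-interchange _ _ _ _)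

  ∧-distribʳ-+ : ∀ {n} (u v : Vector Carrier n) T →
                 (λ i → u i + v i) ∧ T ≋ λ p → (u ∧ T) p + (v ∧ T) p
  ∧-distribʳ-+ u v T []            = sym (+-identityʳ 0#)
  ∧-distribʳ-+ u v T (outside ∷ p) = ∧-distribʳ-+ (tail u) (tail v) _ p
  ∧-distribʳ-+ u v T (inside ∷ p)  =
    trans (+-cong (distribʳ _ (head u) (head v)) (-‿cong (∧-distribʳ-+ (tail u) (tail v) _ p)))
          (-‿+-interchange _ _ _ _)

  ∧-*ʳ : ∀ {n} (v : Vector Carrier n) x T →
         v ∧ (λ p → x * T p) ≋ λ p → x * (v ∧ T) p
  ∧-*ʳ v x T []            = sym (zeroʳ x)
  ∧-*ʳ v x T (outside ∷ p) = ∧-*ʳ (tail v) x _ p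
  ∧-*ʳ v x T (inside ∷ p)  =
    trans (+-cong (x∙yz≈y∙xz (head v) x _) (-‿cong (∧-*ʳ (tail v) x _ p)))
          (sym (x[y-z]≈xy-xz x _ _))

  ∧-*ˡ : ∀ {n} x (v : Vector Carrier n) T →
         (λ i → x * v i) ∧ T ≋ λ p → x * (v ∧ T) p
  ∧-*ˡ x v T []            = sym (zeroʳ x)
  ∧-*ˡ x v T (outside ∷ p) = ∧-*ˡ x (tail v) _ p
  ∧-*ˡ x v T (inside ∷ p)  =
    trans (+-cong (*-assoc x (head v) _) (-‿cong (∧-*ˡ x (tail v) _ p)))
          (sym (x[y-z]≈xy-xz x _ _))

  ∧-‿ : ∀ {n} (v : Vector Carrier n) T → v ∧ (λ p → - T p) ≋ λ p → - (v ∧ T) p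
  ∧-‿ v T p = begin
    (v ∧ (λ q → - T q)) p       ≈⟨ ∧-congʳ v (λ q → sym (-1*x≈-x (T q))) p ⟩
    (v ∧ (λ q → - 1# * T q)) p  ≈⟨ ∧-*ʳ v (- 1#) T p ⟩
    - 1# * (v ∧ T) p            ≈⟨ -1*x≈-x _ ⟩
    - (v ∧ T) p                 ∎

  -- The coefficients of a product have the shape `x * S - T`, so linearity in this combination is
  -- what nested products call for.
  ∧-minus : ∀ {n} (v : Vector Carrier n) x S T →
            v ∧ (λ p → x * S p - T p) ≋ λ p → x * (v ∧ S) p - (v ∧ T) p
  ∧-minus v x S T p =
    trans (∧-distribˡ-+ v (λ q → x * S q) (λ q → - T q) p)
          (+-cong (∧-*ʳ v x S p) (∧-‿ v T p))

  -- The mixed terms v₀ (v′ ∧ a) cancel and v′ ∧ v′ ∧ b remains. A separate induction is used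
  -- because anticommutativity only yields that twice the product vanishes, and 2 may be a zero
  -- divisor in R.
  ∧-alternating : ∀ {n} (v : Vector Carrier n) T → v ∧ v ∧ T ≋ const 0#
  ∧-alternating v T []            = refl
  ∧-alternating v T (outside ∷ p) = ∧-alternating (tail v) _ p
  ∧-alternating v T (inside ∷ p)  = begin
    head v * (tail v ∧ a) p - (tail v ∧ (λ q → head v * a q - (tail v ∧ b) q)) p
      ≈⟨ +-congˡ (-‿cong (∧-minus (tail v) (head v) a (tail v ∧ b) p)) ⟩
    head v * (tail v ∧ a) p - (head v * (tail v ∧ a) p - (tail v ∧ tail v ∧ b) p)
      ≈⟨ +-congˡ (-‿cong (+-congˡ (-‿cong (∧-alternating (tail v) b p)))) ⟩
    head v * (tail v ∧ a) p - (head v * (tail v ∧ a) p - 0#)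
      ≈⟨ +-congˡ (-‿cong (trans (+-congˡ -0#≈0#) (+-identityʳ _))) ⟩
    head v * (tail v ∧ a) p - head v * (tail v ∧ a) p
      ≈⟨ -‿inverseʳ _ ⟩
    0# ∎
    where
    a b : Λ _
    a q = T (outside ∷ q)
    b q = T (inside ∷ q)

  -- In the coefficients containing e₀, exchanging u and v exchanges the terms x and y, which occur
  -- with opposite signs; the term z changes sign by induction.
  ∧-anticomm : ∀ {n} (u v : Vector Carrier n) T → u ∧ v ∧ T ≋ λ p → - (v ∧ u ∧ T) p
  ∧-anticomm u v T []            = sym -0#≈0#
  ∧-anticomm u v T (outside ∷ p) = ∧-anticomm (tail u) (tail v) _ p
  ∧-anticomm u v T (inside ∷ p)  = begin
    x - (tail u ∧ (λ q → head v * a q - (tail v ∧ b) q)) p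
      ≈⟨ +-congˡ (-‿cong (∧-minus (tail u) (head v) a (tail v ∧ b) p)) ⟩
    x - (y - (tail u ∧ tail v ∧ b) p)
      ≈⟨ +-congˡ (-‿cong (+-congˡ (-‿cong (∧-anticomm (tail u) (tail v) b p)))) ⟩
    x - (y - - z)
      ≈⟨ +-congˡ (sym (-‿+-comm y (- - z))) ⟩
    x + (- y + - - - z)
      ≈⟨ +-cong (sym (-‿involutive x)) (+-congˡ (-‿involutive (- z))) ⟩
    - - x + (- y + - z)
      ≈⟨ +-congˡ (+-comm (- y) (- z)) ⟩
    - - x + (- z + - y)
      ≈⟨ sym (+-assoc (- - x) (- z) (- y)) ⟩
    - - x + - z + - y
      ≈⟨ +-congʳ (-‿+-comm (- x) z) ⟩
    - (- x + z) + - y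
      ≈⟨ +-comm _ (- y) ⟩
    - y + - (- x + z)
      ≈⟨ -‿+-comm y (- x + z) ⟩
    - (y + (- x + z))
      ≈⟨ -‿cong (+-congˡ (+-congˡ (sym (-‿involutive z)))) ⟩
    - (y + (- x + - - z))
      ≈⟨ -‿cong (+-congˡ (-‿+-comm x (- z))) ⟩
    - (y - (x - z))
      ≈⟨ -‿cong (+-congˡ (-‿cong (sym (∧-minus (tail v) (head u) a (tail u ∧ b) p)))) ⟩
    - (y - (tail v ∧ (λ q → head u * a q - (tail u ∧ b) q)) p) ∎
    where
    a b : Λ _
    a q = T (outside ∷ q)
    b q = T (inside ∷ q)
    x y z : Carrier
    x = head u * (tail v ∧ a) p
    y = head v * (tail u ∧ a) p
    z = (tail v ∧ tail u ∧ b) p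

  ⋀-cong : ∀ {k n} {M N : Vector (Vector Carrier n) k} →
           (∀ i j → M i j ≈ N i j) → ⋀ M ≋ ⋀ N
  ⋀-cong {zero}  M≈N p = refl
  ⋀-cong {suc k} M≈N p = ∧-cong (M≈N zero) (⋀-cong (M≈N ∘ suc)) p

  ⋀-scale : ∀ {k n} (d : Vector Carrier k) (M : Vector (Vector Carrier n) k) →
            ⋀ (λ i j → d i * M i j) ≋ λ p → product d * ⋀ M p
  ⋀-scale {zero}  d M p = sym (*-identityˡ _)
  ⋀-scale {suc k} d M p = begin
    ((λ j → head d * head M j) ∧ ⋀ (λ i j → tail d i * tail M i j)) p
      ≈⟨ ∧-congʳ (λ j → head d * head M j) (⋀-scale (tail d) (tail M)) p ⟩
    ((λ j → head d * head M j) ∧ (λ q → product (tail d) * ⋀ (tail M) q)) p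
      ≈⟨ ∧-*ˡ (head d) (head M) _ p ⟩
    head d * (head M ∧ (λ q → product (tail d) * ⋀ (tail M) q)) p
      ≈⟨ *-congˡ (∧-*ʳ (head M) (product (tail d)) _ p) ⟩
    head d * (product (tail d) * (head M ∧ ⋀ (tail M)) p)
      ≈⟨ sym (*-assoc (head d) _ _) ⟩
    head d * product (tail d) * (head M ∧ ⋀ (tail M)) p ∎

  ∧-degree : ∀ {n} k (v : Vector Carrier n) T →
             (∀ p → ∣ p ∣ ℕ.< k → T p ≈ 0#) → ∀ p → ∣ p ∣ ℕ.< suc k → (v ∧ T) p ≈ 0#
  ∧-degree k       v T T≈0 []            p<  = refl
  ∧-degree k       v T T≈0 (outside ∷ p) p<  = ∧-degree k (tail v) _ (T≈0 ∘ (outside ∷_)) p p<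
  ∧-degree zero    v T T≈0 (inside ∷ p)  (ℕ.s≤s ())
  ∧-degree (suc k) v T T≈0 (inside ∷ p)  (ℕ.s≤s p<) = begin
    head v * T (outside ∷ p) - (tail v ∧ (λ q → T (inside ∷ q))) p
      ≈⟨ +-cong (*-congˡ (T≈0 (outside ∷ p) p<))
           (-‿cong (∧-degree k (tail v) _ (λ q q< → T≈0 (inside ∷ q) (ℕ.s≤s q<)) p p<)) ⟩
    head v * 0# - 0#  ≈⟨ +-congʳ (zeroʳ _) ⟩
    0# - 0#           ≈⟨ 0-0≈0 ⟩
    0#                ∎

  -- A product of k vectors is homogeneous of degree k. The vanishing below degree k is the half
  -- that matters: for k = n it leaves only the coefficient at `⊤`.
  ⋀-degree : ∀ {k n} (M : Vector (Vector Carrier n) k) p → ∣ p ∣ ℕ.< k → ⋀ M p ≈ 0#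
  ⋀-degree {suc k} M p = ∧-degree k (head M) _ (⋀-degree (tail M)) p

  -- Multiplicativity of the determinant

  infixl 7 _·_
  _·_ : ∀ {k n} → Vector Carrier k → Vector (Vector Carrier n) k → Vector Carrier n
  (v · C) j = sum (λ i → v i * C i j)

  _⊗_ : ∀ {k n o} → Vector (Vector Carrier n) k → Vector (Vector Carrier o) n → Vector (Vector Carrier o) k
  (M ⊗ N) i = M i · N

  -- The algebra homomorphism sending eᵢ to the i-th row of C.
  map-⋀ : ∀ {k n} → Vector (Vector Carrier n) k → Λ k → Λ n
  map-⋀ {zero}  C T p = T [] * unit p
  map-⋀ {suc k} C T p =
    map-⋀ (tail C) (λ q → T (outside ∷ q)) p + (head C ∧ map-⋀ (tail C) (λ q → T (inside ∷ q))) p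

  map-⋀-cong : ∀ {k n} (C : Vector (Vector Carrier n) k) {S T} → S ≋ T → map-⋀ C S ≋ map-⋀ C T
  map-⋀-cong {zero}  C S≋T p = *-congʳ (S≋T [])
  map-⋀-cong {suc k} C S≋T p =
    +-cong (map-⋀-cong (tail C) (S≋T ∘ (outside ∷_)) p)
           (∧-congʳ (head C) (map-⋀-cong (tail C) (S≋T ∘ (inside ∷_))) p)

  map-⋀-zero : ∀ {k n} (C : Vector (Vector Carrier n) k) → map-⋀ C (const 0#) ≋ const 0#
  map-⋀-zero {zero}  C p = zeroˡ _
  map-⋀-zero {suc k} C p =
    trans (+-cong (map-⋀-zero (tail C) p)
                  (trans (∧-congʳ (head C) (map-⋀-zero (tail C)) p) (∧-zeroʳ (head C) p)))
          (+-identityʳ 0#)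

  map-⋀-minus : ∀ {k n} (C : Vector (Vector Carrier n) k) x S T →
                map-⋀ C (λ q → x * S q - T q) ≋ λ p → x * map-⋀ C S p - map-⋀ C T p
  map-⋀-minus {zero}  C x S T p =
    trans ([y-z]x≈yx-zx (unit p) (x * S []) (T [])) (+-congʳ (*-assoc x (S []) (unit p)))
  map-⋀-minus {suc k} C x S T p = begin
    map-⋀ (tail C) (λ q → x * S (outside ∷ q) - T (outside ∷ q)) p
      + (head C ∧ map-⋀ (tail C) (λ q → x * S (inside ∷ q) - T (inside ∷ q))) p
      ≈⟨ +-cong (map-⋀-minus (tail C) x _ _ p)
           (trans (∧-congʳ (head C) (map-⋀-minus (tail C) x _ _) p) (∧-minus (head C) x _ _ p)) ⟩
    (x * s - t) + (x * s′ - t′)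
      ≈⟨ sym (-‿+-interchange _ _ _ _) ⟩
    (x * s + x * s′) - (t + t′)
      ≈⟨ +-congʳ (sym (distribˡ x s s′)) ⟩
    x * (s + s′) - (t + t′) ∎
    where
    s s′ t t′ : Carrier
    s  = map-⋀ (tail C) (S ∘ (outside ∷_)) p
    s′ = (head C ∧ map-⋀ (tail C) (S ∘ (inside ∷_))) p
    t  = map-⋀ (tail C) (T ∘ (outside ∷_)) p
    t′ = (head C ∧ map-⋀ (tail C) (T ∘ (inside ∷_))) p

  -- Write φT = φa + C₀ ∧ φb. Moving C₀ past w by anticommutativity leaves the image of v ∧ T short
  -- of (v₀ C₀ + w) ∧ φT by v₀ (C₀ ∧ C₀ ∧ φb) only, which vanishes by alternation.
  map-⋀-∧ : ∀ {k n} (C : Vector (Vector Carrier n) k) v T →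
            map-⋀ C (v ∧ T) ≋ (v · C) ∧ map-⋀ C T
  map-⋀-∧ {zero}  C v T p = trans (zeroˡ _) (sym (∧-zeroˡ _ p))
  map-⋀-∧ {suc k} C v T p = begin
    map-⋀ (tail C) (tail v ∧ a) p
      + (head C ∧ map-⋀ (tail C) (λ q → head v * a q - (tail v ∧ b) q)) p
      ≈⟨ +-cong (map-⋀-∧ (tail C) (tail v) a p)
           (∧-congʳ (head C) (λ q → trans (map-⋀-minus (tail C) (head v) a (tail v ∧ b) q)
              (+-congˡ (-‿cong (map-⋀-∧ (tail C) (tail v) b q)))) p) ⟩
    (w ∧ φa) p + (head C ∧ (λ q → head v * φa q - (w ∧ φb) q)) p
      ≈⟨ +-congˡ (∧-minus (head C) (head v) φa (w ∧ φb) p) ⟩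
    (w ∧ φa) p + (head v * (head C ∧ φa) p - (head C ∧ w ∧ φb) p)
      ≈⟨ +-congˡ (+-congˡ (sym (∧-anticomm w (head C) φb p))) ⟩
    (w ∧ φa) p + (head v * (head C ∧ φa) p + (w ∧ head C ∧ φb) p)
      ≈⟨ trans (sym (+-assoc _ _ _)) (trans (+-congʳ (+-comm _ _)) (+-assoc _ _ _)) ⟩
    head v * (head C ∧ φa) p + ((w ∧ φa) p + (w ∧ head C ∧ φb) p)
      -- The vanishing product C₀ ∧ C₀ ∧ φb is inserted here to complete φa to φT.
      ≈⟨ +-cong (*-congˡ (sym (trans (+-congˡ (∧-alternating (head C) φb p)) (+-identityʳ _))))
                (sym (∧-distribˡ-+ w φa _ p)) ⟩
    head v * ((head C ∧ φa) p + (head C ∧ head C ∧ φb) p) + (w ∧ φT) p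
      ≈⟨ +-congʳ (*-congˡ (sym (∧-distribˡ-+ (head C) φa _ p))) ⟩
    head v * (head C ∧ φT) p + (w ∧ φT) p
      ≈⟨ +-congʳ (sym (∧-*ˡ (head v) (head C) φT p)) ⟩
    ((λ j → head v * head C j) ∧ φT) p + (w ∧ φT) p
      ≈⟨ sym (∧-distribʳ-+ (λ j → head v * head C j) w φT p) ⟩
    ((v · C) ∧ φT) p ∎
    where
    a b : Λ k
    a q = T (outside ∷ q)
    b q = T (inside ∷ q)
    φa φb φT : Λ _
    φa = map-⋀ (tail C) a
    φb = map-⋀ (tail C) b
    φT = map-⋀ C T
    w : Vector Carrier _
    w = tail v · tail C

  map-⋀-unit : ∀ {k n} (C : Vector (Vector Carrier n) k) → map-⋀ C unit ≋ unit
  map-⋀-unit {zero}  C p = *-identityˡ _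
  map-⋀-unit {suc k} C p =
    trans (+-cong (map-⋀-unit (tail C) p)
                  (trans (∧-congʳ (head C) (map-⋀-zero (tail C)) p) (∧-zeroʳ (head C) p)))
          (+-identityʳ _)

  map-⋀-⋀ : ∀ {k n o} (C : Vector (Vector Carrier o) n) (M : Vector (Vector Carrier n) k) →
            map-⋀ C (⋀ M) ≋ ⋀ (M ⊗ C)
  map-⋀-⋀ {zero}  C M p = map-⋀-unit C p
  map-⋀-⋀ {suc k} C M p =
    trans (map-⋀-∧ C (head M) _ p) (∧-congʳ (head M · C) (map-⋀-⋀ C (tail M)) p)

  -- Such a T is a multiple of e₀ ∧ ... ∧ eₖ₋₁, and the image of that product is the product of the
  -- rows of C.
  map-⋀-top : ∀ {k n} (C : Vector (Vector Carrier n) k) T →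
              (∀ p → ∣ p ∣ ℕ.< k → T p ≈ 0#) → map-⋀ C T ≋ λ p → T ⊤ * ⋀ C p
  map-⋀-top {zero}  C T T≈0 p = refl
  map-⋀-top {suc k} C T T≈0 p = begin
    map-⋀ (tail C) (T ∘ (outside ∷_)) p + (head C ∧ map-⋀ (tail C) (T ∘ (inside ∷_))) p
      ≈⟨ +-cong
           (trans (map-⋀-cong (tail C) (λ q → T≈0 (outside ∷ q) (ℕ.s≤s (∣p∣≤n q))) p) (map-⋀-zero (tail C) p))
           (∧-congʳ (head C) (map-⋀-top (tail C) _ (λ q q< → T≈0 (inside ∷ q) (ℕ.s≤s q<))) p) ⟩
    0# + (head C ∧ (λ q → T ⊤ * ⋀ (tail C) q)) p
      ≈⟨ trans (+-identityˡ _) (∧-*ʳ (head C) (T ⊤) _ p) ⟩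
    T ⊤ * (head C ∧ ⋀ (tail C)) p ∎
    where open import Data.Fin.Subset.Properties using (∣p∣≤n)

  -- Each coordinate passed contributes the minus sign from the definition of `∧`, which produces
  -- the alternating signs of the Laplace expansion; v j meets the coefficient at the complement of
  -- {j}.
  ∧-⊤ : ∀ {n} (v : Vector Carrier (suc n)) T →
        (v ∧ T) ⊤ ≈ sum (λ j → (- 1#) ^ toℕ j * (v j * T (insertAt ⊤ j outside)))
  ∧-⊤ {zero}  v T = begin
    v zero * T (outside ∷ []) - 0#              ≈⟨ +-cong (sym (*-identityˡ _)) -0#≈0# ⟩
    1# * (v zero * T (outside ∷ [])) + 0#       ∎
  ∧-⊤ {suc n} v T = +-cong (sym (*-identityˡ _)) (begin
    - (tail v ∧ (T ∘ (inside ∷_))) ⊤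
      ≈⟨ -‿cong (∧-⊤ (tail v) (T ∘ (inside ∷_))) ⟩
    - sum terms
      ≈⟨ sym (-1*x≈-x _) ⟩
    - 1# * sum terms
      ≈⟨ *-distribˡ-sum (- 1#) terms ⟩
    sum (λ j → - 1# * terms j)
      ≈⟨ sum-cong-≋ {suc n} (λ j → sym (*-assoc (- 1#) ((- 1#) ^ toℕ j) (v (suc j) * T (inside ∷ insertAt ⊤ j outside)))) ⟩
    sum (λ j → (- 1#) ^ toℕ (suc j) * (v (suc j) * T (insertAt ⊤ (suc j) outside))) ∎)
    where
    terms : Vector Carrier (suc n)
    terms j = (- 1#) ^ toℕ j * (v (suc j) * T (inside ∷ insertAt ⊤ j outside))

  -- A coefficient at a set avoiding j does not see the coordinate j, so column j may be deleted.
  -- This is how minors appear as coefficients.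
  ∧-insertAt : ∀ {n} (v : Vector Carrier (suc n)) T j p →
    (v ∧ T) (insertAt p j outside) ≈ ((v ∘ punchIn j) ∧ (λ q → T (insertAt q j outside))) p
  ∧-insertAt v T zero    p             = refl
  ∧-insertAt v T (suc j) (outside ∷ p) = ∧-insertAt (tail v) _ j p
  ∧-insertAt v T (suc j) (inside ∷ p)  = +-congˡ (-‿cong (∧-insertAt (tail v) _ j p))

  unit-insertAt : ∀ {n} (j : Fin (suc n)) p → unit (insertAt p j outside) ≈ unit p
  unit-insertAt zero    p             = refl
  unit-insertAt (suc j) (outside ∷ p) = unit-insertAt j p
  unit-insertAt (suc j) (inside ∷ p)  = refl

  ⋀-insertAt : ∀ {k n} (M : Vector (Vector Carrier (suc n)) k) j p →
               ⋀ M (insertAt p j outside) ≈ ⋀ (λ i → M i ∘ punchIn j) p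
  ⋀-insertAt {zero}  M j p = unit-insertAt j p
  ⋀-insertAt {suc k} M j p =
    trans (∧-insertAt (head M) _ j p) (∧-congʳ (head M ∘ punchIn j) (⋀-insertAt (tail M) j) p)

  determinant≈⋀ : ∀ {n} (M : Matrix Carrier n) → determinant rawRing M ≈ ⋀ M ⊤
  determinant≈⋀ {zero}  M = refl
  determinant≈⋀ {suc n} M = trans
    (sum-cong-≋ (λ j → *-congˡ {(- 1#) ^ toℕ j} (*-congˡ {M zero j}
      (trans (determinant≈⋀ (λ i → M (suc i) ∘ punchIn j)) (sym (⋀-insertAt (tail M) j ⊤))))))
    (sym (∧-⊤ (head M) (⋀ (tail M))))

  -- The rows of `M ⊗ N` are the images of the rows of M under eᵢ ↦ N i, and this map multiplies the
  -- top degree by det N.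
  determinant-⊗ : ∀ {n} (M N : Matrix Carrier n) →
    determinant rawRing (M ⊗ N) ≈ determinant rawRing M * determinant rawRing N
  determinant-⊗ M N = begin
    determinant rawRing (M ⊗ N)  ≈⟨ determinant≈⋀ (M ⊗ N) ⟩
    ⋀ (M ⊗ N) ⊤                  ≈⟨ sym (map-⋀-⋀ N M ⊤) ⟩
    map-⋀ N (⋀ M) ⊤              ≈⟨ map-⋀-top N (⋀ M) (⋀-degree M) ⊤ ⟩
    ⋀ M ⊤ * ⋀ N ⊤                ≈⟨ *-cong (sym (determinant≈⋀ M)) (sym (determinant≈⋀ N)) ⟩
    determinant rawRing M * determinant rawRing N ∎

  determinant-scale : ∀ {n} (d : Vector Carrier n) (M : Matrix Carrier n) →
    determinant rawRing (λ i j → d i * M i j) ≈ product d * determinant rawRing M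
  determinant-scale d M = trans (determinant≈⋀ (λ i j → d i * M i j))
    (trans (⋀-scale d M ⊤) (*-congˡ (sym (determinant≈⋀ M))))

  determinant-cong : ∀ {n} {M N : Matrix Carrier n} → (∀ i j → M i j ≈ N i j) →
    determinant rawRing M ≈ determinant rawRing N
  determinant-cong {M = M} {N} M≈N =
    trans (determinant≈⋀ M) (trans (⋀-cong M≈N ⊤) (sym (determinant≈⋀ N)))

  identity : ∀ {n} → Matrix Carrier n
  identity zero    zero    = 1#
  identity zero    (suc j) = 0#
  identity (suc i) zero    = 0#
  identity (suc i) (suc j) = identity i j

  determinant-identity : ∀ n → determinant rawRing (identity {n}) ≈ 1#
  determinant-identity n = trans (determinant≈⋀ (identity {n})) (go n)
    where
    ⋀-0∷ : ∀ {k n} (M : Vector (Vector Carrier (suc n)) k) → (∀ i → M i zero ≈ 0#) →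
           ∀ p → ⋀ M (outside ∷ p) ≈ ⋀ (λ i → M i ∘ suc) p
    ⋀-0∷ {zero}  M z p = refl
    ⋀-0∷ {suc k} M z p = ∧-congʳ (tail (head M)) (⋀-0∷ (tail M) (z ∘ suc)) p
    go : ∀ n → ⋀ (identity {n}) ⊤ ≈ 1#
    go zero    = refl
    go (suc n) = begin
      1# * ⋀ I (outside ∷ ⊤) - (const 0# ∧ (λ q → ⋀ I (inside ∷ q))) ⊤
        ≈⟨ +-cong (trans (*-identityˡ _) (⋀-0∷ I (λ _ → refl) ⊤)) (-‿cong (∧-zeroˡ (⋀ I ∘ (inside ∷_)) ⊤)) ⟩
      ⋀ (identity {n}) ⊤ - 0#  ≈⟨ +-cong (go n) -0#≈0# ⟩
      1# + 0#                  ≈⟨ +-identityʳ 1# ⟩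
      1#                       ∎
      where
      I : Vector (Vector Carrier (suc n)) n
      I = tail (identity {suc n})

-- Circulant matrices

module Rotation where
  open import Data.Nat.Base using (_+_; _*_; _∸_)
  open ≡ using (refl; sym; trans; cong; cong₂)
  open ≡.≡-Reasoning
  open +-*-Solver using (solve; _:+_; _:*_; _:=_)

  toℕ-mod : ∀ k n .{{_ : ℕ.NonZero n}} → k ≡ toℕ (k mod n) + (k / n) * n
  toℕ-mod k n = trans (m≡m%n+[m/n]*n k n) (cong (_+ (k / n) * n) (sym (toℕ-fromℕ< (m%n<n k n))))

  mod-unique : ∀ k {n} .{{_ : ℕ.NonZero n}} (i : Fin n) q → k ≡ toℕ i + q * n → k mod n ≡ i
  mod-unique k {n} i q eq = toℕ-injective (begin
    toℕ (k mod n)        ≡⟨ toℕ-fromℕ< (m%n<n k n) ⟩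
    k % n                ≡⟨ cong (_% n) eq ⟩
    (toℕ i + q * n) % n  ≡⟨ [m+kn]%n≡m%n (toℕ i) q n ⟩
    toℕ i % n            ≡⟨ m<n⇒m%n≡m (toℕ<n i) ⟩
    toℕ i                ∎)

  infix 8 _ᶜ
  _ᶜ : ∀ {n} → Fin n → ℕ
  _ᶜ {n} i = n ∸ toℕ i

  i+iᶜ≡n : ∀ {n} (i : Fin n) → toℕ i + i ᶜ ≡ n
  i+iᶜ≡n i = ℕ.m+[n∸m]≡n (ℕ.<⇒≤ (toℕ<n i))

  -- The position at which entry (i , k) of circ a reads a.
  _⊖_ : ∀ {n} → Fin n → Fin n → Fin n
  _⊖_ {n} k i = (toℕ k + i ᶜ) mod n
    where instance _ = nonZeroIndex i

  ⊖-unique : ∀ {n} (k j i : Fin n) q → toℕ k + j ᶜ ≡ toℕ i + q * n → k ⊖ j ≡ i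
  ⊖-unique {n} k j i q eq = unique
    where
    instance _ = nonZeroIndex j
    unique : (toℕ k + j ᶜ) mod n ≡ i
    unique = mod-unique (toℕ k + j ᶜ) i q eq

  ⊖-spec : ∀ {n} (k i : Fin n) → ∃[ q ] toℕ k + i ᶜ ≡ toℕ (k ⊖ i) + q * n
  ⊖-spec {n} k i = (toℕ k + i ᶜ) / n , toℕ-mod (toℕ k + i ᶜ) n
    where instance _ = nonZeroIndex i

  -- k - (k - i) = i modulo n, so i ↦ k ⊖ i is a permutation that is its own inverse; it reindexes
  -- the sums in the diagonalisation.
  ⊖-involutive : ∀ {n} (k i : Fin n) → k ⊖ (k ⊖ i) ≡ i
  ⊖-involutive {n} k i = ⊖-unique k l i q (ℕ.+-cancelˡ-≡ (toℕ l) _ _ (cancelled (⊖-spec k i .proj₂)))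
    where
    l : Fin n
    l = k ⊖ i
    q : ℕ
    q = ⊖-spec k i .proj₁
    cancelled : toℕ k + i ᶜ ≡ toℕ l + q * n → toℕ l + (toℕ k + l ᶜ) ≡ toℕ l + (toℕ i + q * n)
    cancelled eq = begin
      toℕ l + (toℕ k + l ᶜ)      ≡⟨ solve 3 (λ l k l′ → l :+ (k :+ l′) := k :+ (l :+ l′)) refl (toℕ l) (toℕ k) (l ᶜ) ⟩
      toℕ k + (toℕ l + l ᶜ)      ≡⟨ cong (toℕ k +_) (trans (i+iᶜ≡n l) (sym (i+iᶜ≡n i))) ⟩
      toℕ k + (toℕ i + i ᶜ)      ≡⟨ solve 3 (λ k i i′ → k :+ (i :+ i′) := i :+ (k :+ i′)) refl (toℕ k) (toℕ i) (i ᶜ) ⟩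
      toℕ i + (toℕ k + i ᶜ)      ≡⟨ cong (toℕ i +_) eq ⟩
      toℕ i + (toℕ l + q * n)    ≡⟨ solve 3 (λ i l x → i :+ (l :+ x) := l :+ (i :+ x)) refl (toℕ i) (toℕ l) (q * n) ⟩
      toℕ l + (toℕ i + q * n)    ∎

  i⊖i≡0 : ∀ {n} (i : Fin n) → toℕ (i ⊖ i) ≡ 0
  -- The quotient is 1 because i + (n - i) is n rather than 0.
  i⊖i≡0 {suc n} i = cong toℕ (⊖-unique i i zero 1
    (trans (i+iᶜ≡n i) (sym (ℕ.*-identityˡ (suc n)))))

  k⊖i≡0⇒i≡k : ∀ {n} (k i : Fin n) → toℕ (k ⊖ i) ≡ 0 → i ≡ k
  k⊖i≡0⇒i≡k {n} k i d≡0 = trans (sym (⊖-involutive k i)) (⊖-unique k (k ⊖ i) k 1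
    (trans (cong (λ z → toℕ k + (n ∸ z)) d≡0) (cong (toℕ k +_) (sym (ℕ.+-identityʳ n)))))

  -- Exponents are compared after adding multiples of n to both sides, so that no
  -- subtraction occurs.
  shift-exponent : ∀ {n} t (k i : Fin n) q → toℕ k + i ᶜ ≡ toℕ (k ⊖ i) + q * n →
                   t * i ᶜ + t * n ≡ t * k ᶜ + t * toℕ (k ⊖ i) + t * q * n
  shift-exponent {n} t k i q eq = begin
    t * i ᶜ + t * n                              ≡⟨ cong (λ z → t * i ᶜ + t * z) (sym (i+iᶜ≡n k)) ⟩
    t * i ᶜ + t * (toℕ k + k ᶜ)                  ≡⟨ solve 4 (λ t i′ k k′ → t :* i′ :+ t :* (k :+ k′) := t :* k′ :+ t :* (k :+ i′)) refl t (i ᶜ) (toℕ k) (k ᶜ) ⟩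
    t * k ᶜ + t * (toℕ k + i ᶜ)                  ≡⟨ cong (λ z → t * k ᶜ + t * z) eq ⟩
    t * k ᶜ + t * (toℕ (k ⊖ i) + q * n)          ≡⟨ solve 5 (λ t k′ l q n → t :* k′ :+ t :* (l :+ q :* n) := t :* k′ :+ t :* l :+ t :* q :* n) refl t (k ᶜ) (toℕ (k ⊖ i)) q n ⟩
    t * k ᶜ + t * toℕ (k ⊖ i) + t * q * n        ∎

  -- Modulo n this says -ik + kl = (l - i)k, the exponent of the k-th summand in an entry of the
  -- product of the Fourier matrix and its inverse.
  inner-exponent : ∀ {n} (i l k : Fin n) q → toℕ l + i ᶜ ≡ toℕ (l ⊖ i) + q * n →
                   toℕ i * k ᶜ + toℕ k * toℕ l + toℕ k * n ≡
                   toℕ (l ⊖ i) * toℕ k + (q * toℕ k + toℕ i) * n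
  inner-exponent {n} i l k q eq = begin
    toℕ i * k ᶜ + toℕ k * toℕ l + toℕ k * n
      ≡⟨ cong (λ z → toℕ i * k ᶜ + toℕ k * toℕ l + toℕ k * z) (sym (i+iᶜ≡n i)) ⟩
    toℕ i * k ᶜ + toℕ k * toℕ l + toℕ k * (toℕ i + i ᶜ)
      ≡⟨ solve 5 (λ t k k′ u j′ → t :* k′ :+ k :* u :+ k :* (t :+ j′) := (u :+ j′) :* k :+ t :* (k :+ k′)) refl (toℕ i) (toℕ k) (k ᶜ) (toℕ l) (i ᶜ) ⟩
    (toℕ l + i ᶜ) * toℕ k + toℕ i * (toℕ k + k ᶜ)
      ≡⟨ cong₂ (λ y z → y * toℕ k + toℕ i * z) eq (i+iᶜ≡n k) ⟩
    (toℕ (l ⊖ i) + q * n) * toℕ k + toℕ i * n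
      ≡⟨ solve 5 (λ d q n k t → (d :+ q :* n) :* k :+ t :* n := d :* k :+ (q :* k :+ t) :* n) refl (toℕ (l ⊖ i)) q n (toℕ k) (toℕ i) ⟩
    toℕ (l ⊖ i) * toℕ k + (q * toℕ k + toℕ i) * n ∎

module Circulant {c ℓ} (R : CommutativeRing c ℓ) where
  open CommutativeRing R hiding (zero)
  open Determinant R
  open Rotation
  open import Algebra.Properties.Semiring.Sum semiring
  open import Algebra.Properties.Monoid.Sum *-monoid using () renaming (sum to product)
  open import Algebra.Properties.Semiring.Exp semiring
  open import Algebra.Properties.CommutativeSemigroup *-commutativeSemigroup
    using (x∙yz≈y∙xz; x∙yz≈y∙zx)
  open import Relation.Binary.Reasoning.Setoid setoid

  identity-≡ : ∀ {n} (i : Fin n) → identity i i ≈ 1#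
  identity-≡ zero    = refl
  identity-≡ (suc i) = identity-≡ i

  identity-≢ : ∀ {n} {i j : Fin n} → i ≢ j → identity i j ≈ 0#
  identity-≢ {i = zero}  {zero}  i≢j = contradiction ≡.refl i≢j
  identity-≢ {i = zero}  {suc j} i≢j = refl
  identity-≢ {i = suc i} {zero}  i≢j = refl
  identity-≢ {i = suc i} {suc j} i≢j = identity-≢ (i≢j ∘ ≡.cong suc)

  1^n≈1 : ∀ n → 1# ^ n ≈ 1#
  1^n≈1 zero    = refl
  1^n≈1 (suc n) = trans (*-identityˡ _) (1^n≈1 n)

  -- In a ring with zero divisors the power sums of an element of order n need not vanish, and n
  -- need not be invertible, so both facts are part of the data.
  record RootOfUnity (n : ℕ) : Set (c ⊔ ℓ) where
    field
      ω          : Carrier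
      ωⁿ≈1       : ω ^ n ≈ 1#
      orthogonal : ∀ (d : Fin n) → toℕ d ≢ 0 → sum {n} (λ k → ω ^ (toℕ d ℕ.* toℕ k)) ≈ 0#
      n⁻¹        : Carrier
      n⁻¹*n≈1    : n⁻¹ * sum {n} (const 1#) ≈ 1#

  module _ {n} (root : RootOfUnity n) where
    open RootOfUnity root

    ω^-periodic : ∀ a b c d → a ℕ.+ c ℕ.* n ≡ b ℕ.+ d ℕ.* n → ω ^ a ≈ ω ^ b
    ω^-periodic a b c d eq = begin
      ω ^ a              ≈⟨ sym (drop a c) ⟩
      ω ^ (a ℕ.+ c ℕ.* n)  ≡⟨ ≡.cong (ω ^_) eq ⟩
      ω ^ (b ℕ.+ d ℕ.* n)  ≈⟨ drop b d ⟩
      ω ^ b              ∎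
      where
      drop : ∀ a c → ω ^ (a ℕ.+ c ℕ.* n) ≈ ω ^ a
      drop a c = begin
        ω ^ (a ℕ.+ c ℕ.* n)   ≈⟨ ^-homo-* ω a (c ℕ.* n) ⟩
        ω ^ a * ω ^ (c ℕ.* n) ≡⟨ ≡.cong (λ e → ω ^ a * ω ^ e) (ℕ.*-comm c n) ⟩
        ω ^ a * ω ^ (n ℕ.* c) ≈⟨ *-congˡ (sym (^-assocʳ ω n c)) ⟩
        ω ^ a * (ω ^ n) ^ c   ≈⟨ *-congˡ (trans (^-congˡ c ωⁿ≈1) (1^n≈1 c)) ⟩
        ω ^ a * 1#            ≈⟨ *-identityʳ _ ⟩
        ω ^ a                 ∎

    eigenvalue : Vector Carrier n → ℕ → Carrier
    eigenvalue a j = sum (λ k → a k * ω ^ (j ℕ.* toℕ k))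

    -- The injection s reorders the frequencies. It lets the eigenvalues be listed in the order that
    -- suits the splitting into halves, without a rearrangement of the product afterwards.
    module _ (s : Fin n → Fin n) (s-injective : ∀ {i j} → s i ≡ s j → i ≡ j) where

      private
        -- With `k ᶜ` in the role of -k, these are the Fourier matrix (ω⁻ʲᵏ) and its inverse
        -- (ωᵏˡ)/n, written with natural exponents.
        F F⁻¹ : Matrix Carrier n
        F   j k = ω ^ (toℕ (s j) ℕ.* k ᶜ)
        F⁻¹ k l = n⁻¹ * ω ^ (toℕ k ℕ.* toℕ (s l))

        λs : Vector Carrier n → Vector Carrier n
        λs a j = eigenvalue a (toℕ (s j))

        -- The rows of F are left eigenvectors: ∑ᵢ ω⁻ʲⁱ aₖ₋ᵢ = ω⁻ʲᵏ ∑ₗ aₗ ωʲˡ, substituting l = k -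
        -- i.
        F-eigen : ∀ a j k → (F ⊗ circ a) j k ≈ λs a j * F j k
        F-eigen a j k = begin
          sum (λ i → F j i * a (k ⊖ i))  ≈⟨ sum-cong-≋ {n} step ⟩
          sum (λ i → F j k * g (k ⊖ i))  ≈⟨ *-distribˡ-sum (F j k) (g ∘ (k ⊖_)) ⟨
          F j k * sum (g ∘ (k ⊖_))       ≈⟨ *-congˡ (sum-permute g rotation) ⟨
          F j k * sum g                  ≈⟨ *-comm _ _ ⟩
          λs a j * F j k                 ∎
          where
          rotation : Permutation n n
          rotation = permutation (k ⊖_) (k ⊖_) (⊖-involutive k) (⊖-involutive k)
          t : ℕ
          t = toℕ (s j)
          g : Vector Carrier n
          g l = a l * ω ^ (t ℕ.* toℕ l)
          step : ∀ i → F j i * a (k ⊖ i) ≈ F j k * g (k ⊖ i)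
          step i with q , eq ← ⊖-spec k i = begin
            F j i * a l                                ≈⟨ *-congʳ (ω^-periodic _ (t ℕ.* k ᶜ ℕ.+ t ℕ.* toℕ l) t (t ℕ.* q) (shift-exponent t k i q eq)) ⟩
            ω ^ (t ℕ.* k ᶜ ℕ.+ t ℕ.* toℕ l) * a l      ≈⟨ *-congʳ (^-homo-* ω (t ℕ.* k ᶜ) (t ℕ.* toℕ l)) ⟩
            F j k * ω ^ (t ℕ.* toℕ l) * a l            ≈⟨ *-assoc _ _ _ ⟩
            F j k * (ω ^ (t ℕ.* toℕ l) * a l)          ≈⟨ *-congˡ (*-comm _ _) ⟩
            F j k * g l                                ∎
            where
            l : Fin n
            l = k ⊖ i

        F-F⁻¹ : ∀ j l → (F ⊗ F⁻¹) j l ≈ identity j l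
        F-F⁻¹ j l = begin
          sum (λ k → F j k * F⁻¹ k l)                  ≈⟨ sum-cong-≋ {n} step ⟩
          sum {n} (λ k → n⁻¹ * ω ^ (toℕ d ℕ.* toℕ k))  ≈⟨ *-distribˡ-sum {n} n⁻¹ (λ k → ω ^ (toℕ d ℕ.* toℕ k)) ⟨
          n⁻¹ * sum {n} (λ k → ω ^ (toℕ d ℕ.* toℕ k))  ≈⟨ finish ⟩
          identity j l                                 ∎
          where
          d : Fin n
          d = s l ⊖ s j
          step : ∀ k → F j k * F⁻¹ k l ≈ n⁻¹ * ω ^ (toℕ d ℕ.* toℕ k)
          step k with q , eq ← ⊖-spec (s l) (s j) = begin
            F j k * (n⁻¹ * ω ^ (toℕ k ℕ.* toℕ (s l)))
              ≈⟨ x∙yz≈y∙xz _ _ _ ⟩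
            n⁻¹ * (F j k * ω ^ (toℕ k ℕ.* toℕ (s l)))
              ≈⟨ *-congˡ (^-homo-* ω (toℕ (s j) ℕ.* k ᶜ) (toℕ k ℕ.* toℕ (s l))) ⟨
            n⁻¹ * ω ^ (toℕ (s j) ℕ.* k ᶜ ℕ.+ toℕ k ℕ.* toℕ (s l))
              ≈⟨ *-congˡ (ω^-periodic _ (toℕ d ℕ.* toℕ k) (toℕ k) (q ℕ.* toℕ k ℕ.+ toℕ (s j)) (inner-exponent (s j) (s l) k q eq)) ⟩
            n⁻¹ * ω ^ (toℕ d ℕ.* toℕ k) ∎
          finish : n⁻¹ * sum {n} (λ k → ω ^ (toℕ d ℕ.* toℕ k)) ≈ identity j l
          finish with j Fin.≟ l
          ... | yes ≡.refl = begin
            n⁻¹ * sum {n} (λ k → ω ^ (toℕ d ℕ.* toℕ k))  ≡⟨ ≡.cong (λ z → n⁻¹ * sum {n} (λ k → ω ^ (z ℕ.* toℕ k))) (i⊖i≡0 (s j)) ⟩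
            n⁻¹ * sum {n} (const 1#)                     ≈⟨ n⁻¹*n≈1 ⟩
            1#                                           ≈⟨ identity-≡ j ⟨
            identity j j                                 ∎
          ... | no j≢l     = begin
            n⁻¹ * sum {n} (λ k → ω ^ (toℕ d ℕ.* toℕ k))  ≈⟨ *-congˡ (orthogonal d (λ d≡0 → j≢l (s-injective (k⊖i≡0⇒i≡k (s l) (s j) d≡0)))) ⟩
            n⁻¹ * 0#                                     ≈⟨ zeroʳ n⁻¹ ⟩
            0#                                           ≈⟨ identity-≢ j≢l ⟨
            identity j l                                 ∎

      -- From F circ(a) = diag(λ) F one gets det F det circ(a) = ∏ λⱼ det F, and det F cancels
      -- because det F det F⁻¹ = 1.
      determinant-circ : ∀ a →
        determinant rawRing (circ a) ≈ product (λ j → eigenvalue a (toℕ (s j)))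
      determinant-circ a = begin
        D (circ a)                          ≈⟨ *-identityˡ _ ⟨
        1# * D (circ a)                     ≈⟨ *-congʳ unit-F ⟨
        D F * D F⁻¹ * D (circ a)            ≈⟨ *-congʳ (*-comm _ _) ⟩
        D F⁻¹ * D F * D (circ a)            ≈⟨ *-assoc _ _ _ ⟩
        D F⁻¹ * (D F * D (circ a))          ≈⟨ *-congˡ (determinant-⊗ F (circ a)) ⟨
        D F⁻¹ * D (F ⊗ circ a)              ≈⟨ *-congˡ (determinant-cong (F-eigen a)) ⟩
        D F⁻¹ * D (λ j k → λs a j * F j k)  ≈⟨ *-congˡ (determinant-scale (λs a) F) ⟩
        D F⁻¹ * (product (λs a) * D F)      ≈⟨ x∙yz≈y∙zx _ _ _ ⟩
        product (λs a) * (D F * D F⁻¹)      ≈⟨ *-congˡ unit-F ⟩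
        product (λs a) * 1#                 ≈⟨ *-identityʳ _ ⟩
        product (λs a)                      ∎
        where
        D : Matrix Carrier n → Carrier
        D = determinant rawRing
        unit-F : D F * D F⁻¹ ≈ 1#
        unit-F = begin
          D F * D F⁻¹   ≈⟨ determinant-⊗ F F⁻¹ ⟨
          D (F ⊗ F⁻¹)   ≈⟨ determinant-cong F-F⁻¹ ⟩
          D identity    ≈⟨ determinant-identity n ⟩
          1#            ∎

-- Comparing determinants over different rings

open import Data.Integer.Base as ℤ using (ℤ; +_; -[1+_]; 1ℤ; -1ℤ)
open import Data.Integer.Divisibility.Signed using (_∣_; divides; ∣⇒∣ᵤ)
open import Data.Integer.DivMod using (_%ℕ_; _/ℕ_; a≡a%ℕn+[a/ℕn]*n; n%ℕd<d)
import Data.Integer.Properties as ℤ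
import Data.Integer.Solver as ℤ
open Rotation using (_⊖_)

-- The Laplace expansion is a term in the ring operations, so a relation compatible with these
-- relates determinants. This form covers equality of k-th terms, convergence to an integer and
-- evaluation of polynomials at once, and it applies to ℝ, which comes only as a raw ring.
record RingRelation {a b ℓ₁ ℓ₂ r} (A : RawRing a ℓ₁) (B : RawRing b ℓ₂)
                    (_~_ : REL (RawRing.Carrier A) (RawRing.Carrier B) r) : Set (a ⊔ b ⊔ r) where
  private
    module A = RawRing A
    module B = RawRing B
  field
    +-rel  : ∀ {x y u v} → x ~ u → y ~ v → (x A.+ y) ~ (u B.+ v)
    *-rel  : ∀ {x y u v} → x ~ u → y ~ v → (x A.* y) ~ (u B.* v)
    -‿rel  : ∀ {x u} → x ~ u → (A.- x) ~ (B.- u)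
    0#-rel : A.0# ~ B.0#
    1#-rel : A.1# ~ B.1#

  private
    module SA = RawSemiringDefs A.rawSemiring
    module SB = RawSemiringDefs B.rawSemiring

  sum-rel : ∀ {n} {f : Vector A.Carrier n} {g : Vector B.Carrier n} →
            (∀ i → f i ~ g i) → SA.sum f ~ SB.sum g
  sum-rel {zero}  f~g = 0#-rel
  sum-rel {suc n} f~g = +-rel (f~g zero) (sum-rel (f~g ∘ suc))

  ^-rel : ∀ {x u} n → x ~ u → (x SA.^ n) ~ (u SB.^ n)
  ^-rel zero    x~u = 1#-rel
  ^-rel (suc n) x~u = *-rel x~u (^-rel n x~u)

  determinant-rel : ∀ {n} {M : Matrix A.Carrier n} {N : Matrix B.Carrier n} →
                    (∀ i j → M i j ~ N i j) → determinant A M ~ determinant B N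
  determinant-rel {zero}  M~N = 1#-rel
  determinant-rel {suc n} M~N = sum-rel (λ j →
    *-rel (^-rel (toℕ j) (-‿rel 1#-rel))
      (*-rel (M~N zero j) (determinant-rel (λ i k → M~N (suc i) (punchIn j k)))))

  determinant-circ-rel : ∀ {n} {a : Vector A.Carrier n} {b : Vector B.Carrier n} →
                         (∀ i → a i ~ b i) → determinant A (circ a) ~ determinant B (circ b)
  determinant-circ-rel {n} {a} {b} a~b =
    determinant-rel {n} {circ a} {circ b} (λ j k → a~b (k ⊖ j))

-- The exterior algebra again, but with elements stored as binary trees of
-- coefficients: evaluating ⋀ᵗ shares all minors and takes about n 2ⁿ operations.
module Memoised {a ℓ} (A : RawRing a ℓ) where
  open RawRing A

  data Tree : ℕ → Set a where
    leaf : Carrier → Tree 0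
    node : ∀ {n} → Tree n → Tree n → Tree (suc n)

  lookup : ∀ {n} → Tree n → Subset n → Carrier
  lookup (leaf x)   []            = x
  lookup (node s t) (outside ∷ p) = lookup s p
  lookup (node s t) (inside ∷ p)  = lookup t p

  zeroᵗ unitᵗ : ∀ n → Tree n
  zeroᵗ zero    = leaf 0#
  zeroᵗ (suc n) = node (zeroᵗ n) (zeroᵗ n)
  unitᵗ zero    = leaf 1#
  unitᵗ (suc n) = node (unitᵗ n) (zeroᵗ n)

  axpy : ∀ {n} → Carrier → Tree n → Tree n → Tree n
  axpy x (leaf y)   (leaf z)     = leaf (x * y + - z)
  axpy x (node s t) (node s′ t′) = node (axpy x s s′) (axpy x t t′)

  infixr 7 _∧ᵗ_
  _∧ᵗ_ : ∀ {n} → Vector Carrier n → Tree n → Tree n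
  v ∧ᵗ leaf x   = leaf 0#
  v ∧ᵗ node s t = node (tail v ∧ᵗ s) (axpy (head v) s (tail v ∧ᵗ t))

  ⋀ᵗ : ∀ {k n} → Vector (Vector Carrier n) k → Tree n
  ⋀ᵗ {zero}  M = unitᵗ _
  ⋀ᵗ {suc k} M = head M ∧ᵗ ⋀ᵗ (tail M)

  determinantᵗ : ∀ {n} → Matrix Carrier n → Carrier
  determinantᵗ M = lookup (⋀ᵗ M) ⊤

module _ {c ℓ} (R : CommutativeRing c ℓ) where
  private module R = CommutativeRing R

  module _ {a ℓ₁ r} {A : RawRing a ℓ₁} {_~_ : REL (RawRing.Carrier A) R.Carrier r}
           (rel : RingRelation A R.rawRing _~_)
           (~-respʳ-≈ : ∀ {x u v} → u R.≈ v → x ~ u → x ~ v) where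
    open RingRelation rel
    open Memoised A
    open Determinant R

    -- Coefficient lists do not form a ring under `_≡_`, since p - p is a list of zeros instead of
    -- `[]`. Trees over A are therefore compared with `⋀` across the relation, and the passage to
    -- the Laplace expansion takes place in R, where the ring laws hold.
    determinantᵗ-rel : ∀ {n} {M : Matrix (RawRing.Carrier A) n} {N : Matrix R.Carrier n} →
                       (∀ i j → M i j ~ N i j) → determinantᵗ M ~ determinant R.rawRing N
    determinantᵗ-rel {M = M} {N} M~N =
      ~-respʳ-≈ (R.sym (determinant≈⋀ N)) (⋀-rel M~N ⊤)
      where
      zero-rel : ∀ n (p : Subset n) → lookup (zeroᵗ n) p ~ R.0#
      zero-rel zero    []            = 0#-rel
      zero-rel (suc n) (outside ∷ p) = zero-rel n p
      zero-rel (suc n) (inside ∷ p)  = zero-rel n p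

      unit-rel : ∀ n (p : Subset n) → lookup (unitᵗ n) p ~ unit p
      unit-rel zero    []            = 1#-rel
      unit-rel (suc n) (outside ∷ p) = unit-rel n p
      unit-rel (suc n) (inside ∷ p)  = zero-rel n p

      axpy-rel : ∀ {n x u} (s t : Tree n) {S T : Λ n} → x ~ u →
                 (∀ p → lookup s p ~ S p) → (∀ p → lookup t p ~ T p) →
                 ∀ p → lookup (axpy x s t) p ~ (u R.* S p R.- T p)
      axpy-rel (leaf _)   (leaf _)     x~u s~S t~T []            = +-rel (*-rel x~u (s~S [])) (-‿rel (t~T []))
      axpy-rel (node s _) (node s′ _)  x~u s~S t~T (outside ∷ p) =
        axpy-rel s s′ x~u (s~S ∘ (outside ∷_)) (t~T ∘ (outside ∷_)) p
      axpy-rel (node _ t) (node _ t′)  x~u s~S t~T (inside ∷ p)  =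
        axpy-rel t t′ x~u (s~S ∘ (inside ∷_)) (t~T ∘ (inside ∷_)) p

      ∧-rel : ∀ {n} {v : Vector _ n} {w : Vector _ n} (t : Tree n) {T : Λ n} → (∀ i → v i ~ w i) →
              (∀ p → lookup t p ~ T p) → ∀ p → lookup (v ∧ᵗ t) p ~ (w ∧ T) p
      ∧-rel (leaf _)   v~w t~T []            = 0#-rel
      ∧-rel (node s _) v~w t~T (outside ∷ p) = ∧-rel s (v~w ∘ suc) (t~T ∘ (outside ∷_)) p
      ∧-rel {v = v} (node s t) v~w t~T (inside ∷ p)  =
        axpy-rel s (tail v ∧ᵗ t) (v~w zero) (t~T ∘ (outside ∷_))
          (∧-rel t (v~w ∘ suc) (t~T ∘ (inside ∷_))) p

      ⋀-rel : ∀ {k n} {M : Vector (Vector _ n) k} {N : Vector (Vector _ n) k} →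
              (∀ i j → M i j ~ N i j) → ∀ p → lookup (⋀ᵗ M) p ~ ⋀ N p
      ⋀-rel {zero}          M~N p = unit-rel _ p
      ⋀-rel {suc k} {M = M} M~N p = ∧-rel (⋀ᵗ (tail M)) (M~N zero) (⋀-rel (M~N ∘ suc)) p

-- Size and congruence of integer determinants

detℤ : ∀ {n} → Matrix ℤ n → ℤ
detℤ = determinant ℤ.+-*-rawRing

module _ where
  open RawSemiringDefs (RawRing.rawSemiring ℤ.+-*-rawRing) using (sum; _^_)

  ∣sum∣≤ : ∀ {n} (f : Vector ℤ n) c → (∀ i → ℤ.∣ f i ∣ ℕ.≤ c) → ℤ.∣ sum f ∣ ℕ.≤ n ℕ.* c
  ∣sum∣≤ {zero}  f c f≤c = ℕ.z≤n
  ∣sum∣≤ {suc n} f c f≤c = ℕ.≤-trans (ℤ.∣i+j∣≤∣i∣+∣j∣ (head f) (sum (tail f)))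
    (ℕ.+-mono-≤ (f≤c zero) (∣sum∣≤ (tail f) c (f≤c ∘ suc)))

  ∣[-1]^n∣≡1 : ∀ n → ℤ.∣ -1ℤ ^ n ∣ ≡ 1
  ∣[-1]^n∣≡1 zero    = ≡.refl
  ∣[-1]^n∣≡1 (suc n) = ≡.trans (ℤ.abs-* -1ℤ (-1ℤ ^ n))
    (≡.trans (ℕ.*-identityˡ _) (∣[-1]^n∣≡1 n))

  -- There are n! terms, each a product of n entries. This crude bound suffices because m can be
  -- chosen beyond it.
  ∣det∣≤n!*bⁿ : ∀ {n} b (M : Matrix ℤ n) → (∀ i j → ℤ.∣ M i j ∣ ℕ.≤ b) →
                ℤ.∣ detℤ M ∣ ℕ.≤ n ! ℕ.* b ℕ.^ n
  ∣det∣≤n!*bⁿ {zero}  b M M≤b = ℕ.≤-refl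
  ∣det∣≤n!*bⁿ {suc n} b M M≤b = begin
    ℤ.∣ detℤ M ∣                             ≤⟨ ∣sum∣≤ term _ bound ⟩
    suc n ℕ.* (b ℕ.* (n ! ℕ.* b ℕ.^ n))      ≡⟨ solve 4 (λ s b f p → s :* (b :* (f :* p)) := s :* f :* (b :* p)) ≡.refl (suc n) b (n !) (b ℕ.^ n) ⟩
    suc n ! ℕ.* b ℕ.^ suc n                  ∎
    where
    open ℕ.≤-Reasoning
    open +-*-Solver
    term : Vector ℤ (suc n)
    term j = -1ℤ ^ toℕ j ℤ.* (M zero j ℤ.* detℤ (λ i k → M (suc i) (punchIn j k)))
    bound : ∀ j → ℤ.∣ term j ∣ ℕ.≤ b ℕ.* (n ! ℕ.* b ℕ.^ n)
    bound j = begin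
      ℤ.∣ -1ℤ ^ toℕ j ℤ.* (M zero j ℤ.* minor) ∣            ≡⟨ ℤ.abs-* (-1ℤ ^ toℕ j) _ ⟩
      ℤ.∣ -1ℤ ^ toℕ j ∣ ℕ.* ℤ.∣ M zero j ℤ.* minor ∣        ≡⟨ ≡.cong (ℕ._* ℤ.∣ M zero j ℤ.* minor ∣) (∣[-1]^n∣≡1 (toℕ j)) ⟩
      1 ℕ.* ℤ.∣ M zero j ℤ.* minor ∣                        ≡⟨ ℕ.*-identityˡ _ ⟩
      ℤ.∣ M zero j ℤ.* minor ∣                              ≡⟨ ℤ.abs-* (M zero j) minor ⟩
      ℤ.∣ M zero j ∣ ℕ.* ℤ.∣ minor ∣                        ≤⟨ ℕ.*-mono-≤ (M≤b zero j) (∣det∣≤n!*bⁿ b _ (λ i k → M≤b (suc i) (punchIn j k))) ⟩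
      b ℕ.* (n ! ℕ.* b ℕ.^ n)                               ∎
      where
      minor : ℤ
      minor = detℤ (λ i k → M (suc i) (punchIn j k))

module Modular (m : ℕ) where
  -- Congruence is a record so that x and y can be inferred from its type, which the difference
  -- alone would not allow.
  infix 4 _≈_
  record _≈_ (x y : ℤ) : Set where
    constructor congruent
    field difference : + m ∣ x ℤ.- y

  open ℤ.+-*-Solver

  ≈-reflexive : ∀ {x y} → x ≡ y → x ≈ y
  ≈-reflexive {x} ≡.refl = congruent (divides (+ 0) (ℤ.+-inverseʳ x))

  private
    ≈-sym : ∀ {x y} → x ≈ y → y ≈ x
    ≈-sym {x} {y} (congruent (divides q eq)) = congruent (divides (ℤ.- q) (≡.trans
      (solve 2 (λ x y → y :- x := :- (x :- y)) ≡.refl x y)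
      (≡.trans (≡.cong (λ z → ℤ.- z) eq) (ℤ.neg-distribˡ-* q (+ m)))))

    ≈-trans : ∀ {x y z} → x ≈ y → y ≈ z → x ≈ z
    ≈-trans {x} {y} {z} (congruent (divides q eq)) (congruent (divides r eq′)) = congruent (divides (q ℤ.+ r) (≡.trans
      (solve 3 (λ x y z → x :- z := x :- y :+ (y :- z)) ≡.refl x y z)
      (≡.trans (≡.cong₂ ℤ._+_ eq eq′) (≡.sym (ℤ.*-distribʳ-+ (+ m) q r)))))

    +-cong : ∀ {x y u v} → x ≈ y → u ≈ v → x ℤ.+ u ≈ y ℤ.+ v
    +-cong {x} {y} {u} {v} (congruent (divides q eq)) (congruent (divides r eq′)) = congruent (divides (q ℤ.+ r) (≡.trans
      (solve 4 (λ x y u v → x :+ u :- (y :+ v) := x :- y :+ (u :- v)) ≡.refl x y u v)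
      (≡.trans (≡.cong₂ ℤ._+_ eq eq′) (≡.sym (ℤ.*-distribʳ-+ (+ m) q r)))))

    *-cong : ∀ {x y u v} → x ≈ y → u ≈ v → x ℤ.* u ≈ y ℤ.* v
    *-cong {x} {y} {u} {v} (congruent (divides q eq)) (congruent (divides r eq′)) = congruent (divides (q ℤ.* u ℤ.+ y ℤ.* r) (≡.trans
      (solve 4 (λ x y u v → x :* u :- y :* v := (x :- y) :* u :+ y :* (u :- v)) ≡.refl x y u v)
      (≡.trans (≡.cong₂ (λ s t → s ℤ.* u ℤ.+ y ℤ.* t) eq eq′)
        (solve 5 (λ q r u y m → q :* m :* u :+ y :* (r :* m) := (q :* u :+ y :* r) :* m) ≡.refl q r u y (+ m)))))

    -‿cong : ∀ {x y} → x ≈ y → ℤ.- x ≈ ℤ.- y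
    -‿cong {x} {y} (congruent (divides q eq)) = congruent (divides (ℤ.- q) (≡.trans
      (solve 2 (λ x y → :- x :- :- y := :- (x :- y)) ≡.refl x y)
      (≡.trans (≡.cong (λ z → ℤ.- z) eq) (ℤ.neg-distribˡ-* q (+ m)))))

  commutativeRing : CommutativeRing 0ℓ 0ℓ
  commutativeRing = record
    { Carrier = ℤ ; _≈_ = _≈_ ; _+_ = ℤ._+_ ; _*_ = ℤ._*_ ; -_ = λ x → ℤ.- x ; 0# = + 0 ; 1# = + 1
    ; isCommutativeRing = record
      { isRing = record
        { +-isAbelianGroup = record
          { isGroup = record
            { isMonoid = record
              { isSemigroup = record
                { isMagma = record
                  { isEquivalence = record
                    { refl  = ≈-reflexive ≡.refl
                    ; sym   = ≈-sym
                    ; trans = ≈-trans }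
                  ; ∙-cong = +-cong }
                ; assoc = λ x y z → ≈-reflexive (ℤ.+-assoc x y z) }
              ; identity = ≈-reflexive ∘ ℤ.+-identityˡ , ≈-reflexive ∘ ℤ.+-identityʳ }
            ; inverse = (λ x → ≈-reflexive (ℤ.+-inverseˡ x)) , (λ x → ≈-reflexive (ℤ.+-inverseʳ x))
            ; ⁻¹-cong = -‿cong }
          ; comm = λ x y → ≈-reflexive (ℤ.+-comm x y) }
        ; *-cong = *-cong
        ; *-assoc = λ x y z → ≈-reflexive (ℤ.*-assoc x y z)
        ; *-identity = ≈-reflexive ∘ ℤ.*-identityˡ , ≈-reflexive ∘ ℤ.*-identityʳ
        ; distrib = (λ x y z → ≈-reflexive (ℤ.*-distribˡ-+ x y z))
                  , (λ x y z → ≈-reflexive (ℤ.*-distribʳ-+ x y z)) }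
      ; *-comm = λ x y → ≈-reflexive (ℤ.*-comm x y) } }

  -- m divides |x - y|, which is at most |x| + |y| < m and hence zero.
  ∣x∣+∣y∣<m⇒x≡y : ∀ {x y} → x ≈ y → ℤ.∣ x ∣ ℕ.+ ℤ.∣ y ∣ ℕ.< m → x ≡ y
  ∣x∣+∣y∣<m⇒x≡y {x} {y} x≈y <m with ℤ.∣ x ℤ.- y ∣ in eq
  ... | zero  = ℤ.i-j≡0⇒i≡j x y (ℤ.∣i∣≡0⇒i≡0 eq)
  ... | suc d = contradiction (≡.subst (m ℕ.∣_) eq (∣⇒∣ᵤ (_≈_.difference x≈y)))
    (ℕ.>⇒∤ (ℕ.≤-<-trans (≡.subst (ℕ._≤ ℤ.∣ x ∣ ℕ.+ ℤ.∣ y ∣) eq (ℤ.∣i-j∣≤∣i∣+∣j∣ x y)) <m))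

  -- The two raw rings share their operations but differ in `_≈_`, so for variable n the two
  -- determinants are not definitionally equal.
  detℤ≡determinant : ∀ {n} (M : Matrix ℤ n) → detℤ M ≡ determinant (CommutativeRing.rawRing commutativeRing) M
  detℤ≡determinant M = RingRelation.determinant-rel {A = ℤ.+-*-rawRing} {B = CommutativeRing.rawRing commutativeRing}
    {_~_ = _≡_} (record
    { +-rel = ≡.cong₂ ℤ._+_ ; *-rel = ≡.cong₂ ℤ._*_ ; -‿rel = ≡.cong (λ z → ℤ.- z) ; 0#-rel = ≡.refl ; 1#-rel = ≡.refl })
    {M = M} {N = M} (λ i j → ≡.refl)

-- Evaluation and search modulo m

-- `_⊔′_`, like `_⊓′_` below, decides by the built-in comparison `_<ᵇ_` instead of recursion on
-- unary numbers, which keeps the search feasible.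
maximum : List ℕ → ℕ
maximum = List.foldr ℕ._⊔′_ 0

≤maximum : ∀ {x xs} → x ∈ xs → x ℕ.≤ maximum xs
≤maximum {x} {y List.∷ ys} (here ≡.refl) =
  ≡.subst (x ℕ.≤_) (ℕ.⊔≡⊔′ y (maximum ys)) (ℕ.m≤m⊔n y (maximum ys))
≤maximum {x} {y List.∷ ys} (there x∈) =
  ≡.subst (x ℕ.≤_) (ℕ.⊔≡⊔′ y (maximum ys)) (ℕ.≤-trans (≤maximum x∈) (ℕ.m≤n⊔m y (maximum ys)))

module Enumeration (m : ℕ) .{{_ : ℕ.NonZero m}} where
  open Modular m
  open CommutativeRing commutativeRing
    using (setoid; *-monoid; semiring; rawRing; trans; sym; *-cong; +-identityʳ; +-assoc)
  open Circulant commutativeRing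
  open import Algebra.Properties.Semiring.Sum semiring using (sum)
  open import Algebra.Properties.Monoid.Sum *-monoid using () renaming (sum to product)
  open import Algebra.Properties.Semiring.Exp semiring using (_^_)
  open import Relation.Binary.Reasoning.Setoid setoid

  %ℕ-≈ : ∀ z → + (z %ℕ m) ≈ z
  %ℕ-≈ z = congruent (divides (ℤ.- q) (≡.trans (≡.cong (λ y → r ℤ.- y) (a≡a%ℕn+[a/ℕn]*n z m))
    (solve 3 (λ r q m → r :- (r :+ q :* m) := :- q :* m) ≡.refl r q (+ m))))
    where
    open ℤ.+-*-Solver
    r q : ℤ
    r = + (z %ℕ m)
    q = z /ℕ m

  -- For a residue r, this is the absolute value of the representative of its class nearest to zero.
  centred : ℕ → ℕ
  centred r = r ℕ.⊓′ (m ℕ.∸ r)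

  -- Among the representatives of its class, x has the least absolute value: |y| < |x| would give
  -- |x| + |y| < m and thus x = y. This applies to the representatives r and r - m.
  ∣x∣≤centred : ∀ {x N} → x ≈ + N → 2 ℕ.* ℤ.∣ x ∣ ℕ.< m → ℤ.∣ x ∣ ℕ.≤ centred (N % m)
  ∣x∣≤centred {x} {N} x≈N 2x<m = ≡.subst (ℤ.∣ x ∣ ℕ.≤_) (ℕ.⊓≡⊓′ r (m ℕ.∸ r)) (ℕ.⊓-glb ≤r ≤m-r)
    where
    r : ℕ
    r = N % m
    x≈r : x ≈ + r
    x≈r = trans x≈N (sym (%ℕ-≈ (+ N)))
    near : ∀ {y} → x ≈ y → ℤ.∣ x ∣ ℕ.≤ ℤ.∣ y ∣
    near {y} x≈y with ℕ.≤-<-connex ℤ.∣ x ∣ ℤ.∣ y ∣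
    ... | inj₁ ∣x∣≤∣y∣ = ∣x∣≤∣y∣
    ... | inj₂ ∣y∣<∣x∣ = ℕ.≤-reflexive (≡.cong ℤ.∣_∣ (∣x∣+∣y∣<m⇒x≡y x≈y
      (ℕ.<-trans (ℕ.+-monoʳ-< ℤ.∣ x ∣ ∣y∣<∣x∣) (≡.subst (ℕ._< m) (≡.cong (ℤ.∣ x ∣ ℕ.+_) (ℕ.+-identityʳ _)) 2x<m))))
    ≤r : ℤ.∣ x ∣ ℕ.≤ r
    ≤r = near x≈r
    r≤m : r ℕ.≤ m
    r≤m = ℕ.<⇒≤ (n%ℕd<d (+ N) m)
    r-m≈r : + r ≈ + r ℤ.- + m
    r-m≈r = congruent (divides 1ℤ (solve 2 (λ r m → r :- (r :- m) := con 1ℤ :* m) ≡.refl (+ r) (+ m)))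
      where open ℤ.+-*-Solver
    ≤m-r : ℤ.∣ x ∣ ℕ.≤ m ℕ.∸ r
    ≤m-r = ≡.subst (ℤ.∣ x ∣ ℕ.≤_) (≡.trans (ℤ.∣i-j∣≡∣j-i∣ (+ r) (+ m))
      (≡.cong ℤ.∣_∣ (≡.trans (ℤ.m-n≡m⊖n m r) (ℤ.⊖-≥ r≤m)))) (near (trans x≈r r-m≈r))

  productᵛ : ∀ {r} → Vec ℕ r → ℕ
  productᵛ = Vec.foldr′ ℕ._*_ 1

  productᵛ-≈ : ∀ {r} (v : Vec ℕ r) (f : Vector ℤ r) → (∀ j → + Vec.lookup v j ≈ f j) →
               + productᵛ v ≈ product f
  productᵛ-≈ []      f v≈f = ≈-reflexive ≡.refl
  productᵛ-≈ (x ∷ v) f v≈f = trans (≈-reflexive (ℤ.pos-* x (productᵛ v)))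
    (*-cong {+ x} {f zero} {+ productᵛ v} (v≈f zero) (productᵛ-≈ v (f ∘ suc) (v≈f ∘ suc)))

  total : ∀ {n r} → Vec ℕ n → Vec (Vec ℕ n) r → Vec ℕ n
  total acc []       = acc
  total acc (w ∷ ws) = total (Vec.zipWith ℕ._+_ acc w) ws

  total-≈ : ∀ {n r} acc (ws : Vec (Vec ℕ n) r) j {x} (f : Vector ℤ r) → + Vec.lookup acc j ≈ x →
            (∀ k → + Vec.lookup (Vec.lookup ws k) j ≈ f k) → + Vec.lookup (total acc ws) j ≈ x ℤ.+ sum f
  total-≈ acc []       j {x} f acc≈x ws≈f = trans acc≈x (sym (+-identityʳ x))
  total-≈ acc (w ∷ ws) j {x} f acc≈x ws≈f = trans
    (total-≈ (Vec.zipWith ℕ._+_ acc w) ws j {x ℤ.+ f zero} (f ∘ suc) step (ws≈f ∘ suc))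
    (+-assoc x (f zero) (sum (f ∘ suc)))
    where
    step : + Vec.lookup (Vec.zipWith ℕ._+_ acc w) j ≈ x ℤ.+ f zero
    step = trans (≈-reflexive (≡.trans (≡.cong +_ (Vec.lookup-zipWith ℕ._+_ j acc w)) (ℤ.pos-+ (Vec.lookup acc j) (Vec.lookup w j))))
      (CommutativeRing.+-cong commutativeRing {+ Vec.lookup acc j} {x} {+ Vec.lookup w j} acc≈x (ws≈f zero))

  -- Lazy evaluation shares the partial sums along the branches of the search tree.
  search : ∀ {n r} → Vec (List (Vec ℕ n)) r → Vec ℕ n → ℕ
  search []         acc = centred (productᵛ acc % m)
  search (cs ∷ css) acc = maximum (List.map (λ w → search css (Vec.zipWith ℕ._+_ acc w)) cs)

  ≤search : ∀ {n r} (css : Vec (List (Vec ℕ n)) r) acc ws →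
            (∀ k → Vec.lookup ws k ∈ Vec.lookup css k) →
            centred (productᵛ (total acc ws) % m) ℕ.≤ search css acc
  ≤search []         acc []       ∈css = ℕ.≤-refl
  ≤search (cs ∷ css) acc (w ∷ ws) ∈css = ℕ.≤-trans
    (≤search css (Vec.zipWith ℕ._+_ acc w) ws (∈css ∘ suc))
    (≤maximum (∈-map⁺ (λ w → search css (Vec.zipWith ℕ._+_ acc w)) (∈css zero)))

  module _ {n} (root : RootOfUnity n) where
    open RootOfUnity root

    -- The contribution of aₖ = c to all n eigenvalues at once. The spectrum is a sum of such
    -- columns, one for each position, which makes a search tree over positions possible.
    column : Fin n → ℤ → Vec ℕ n
    column k c = Vec.tabulate λ j → (c ℤ.* ω ^ (toℕ j ℕ.* toℕ k)) %ℕ m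

    spectrum : Vector ℤ n → Vec ℕ n
    spectrum a = total (Vec.replicate n 0) (Vec.tabulate λ k → column k (a k))

    spectrum-≈ : ∀ a j → + Vec.lookup (spectrum a) j ≈ eigenvalue root a (toℕ j)
    spectrum-≈ a j = trans
      (total-≈ (Vec.replicate n 0) (Vec.tabulate λ k → column k (a k)) j {+ 0}
        (λ k → a k ℤ.* ω ^ (toℕ j ℕ.* toℕ k))
        (≈-reflexive (≡.cong +_ (Vec.lookup-replicate j 0)))
        (λ k → trans (≈-reflexive (≡.cong +_ (entry k))) (%ℕ-≈ (a k ℤ.* ω ^ (toℕ j ℕ.* toℕ k)))))
      (≈-reflexive (ℤ.+-identityˡ _))
      where
      entry : ∀ k → Vec.lookup (Vec.lookup (Vec.tabulate λ k → column k (a k)) k) j ≡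
                    (a k ℤ.* ω ^ (toℕ j ℕ.* toℕ k)) %ℕ m
      entry k = ≡.trans (≡.cong (λ w → Vec.lookup w j) (Vec.lookup∘tabulate (λ k → column k (a k)) k))
                        (Vec.lookup∘tabulate (λ j → (a k ℤ.* ω ^ (toℕ j ℕ.* toℕ k)) %ℕ m) j)

    detℤ-circ≈ : ∀ a → detℤ (circ a) ≈ + productᵛ (spectrum a)
    detℤ-circ≈ a = begin
      detℤ (circ a)                                  ≡⟨ detℤ≡determinant (circ a) ⟩
      determinant rawRing (circ a)                   ≈⟨ determinant-circ root id id a ⟩
      product {n} (λ j → eigenvalue root a (toℕ j))      ≈⟨ productᵛ-≈ (spectrum a) (λ j → eigenvalue root a (toℕ j)) (spectrum-≈ a) ⟨
      + productᵛ (spectrum a)                        ∎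

    detℤ-circ≡ : ∀ a v → ℤ.∣ detℤ (circ a) ∣ ℕ.+ ℤ.∣ v ∣ ℕ.< m →
                 productᵛ (spectrum a) % m ≡ v %ℕ m → detℤ (circ a) ≡ v
    detℤ-circ≡ a v <m eq = ∣x∣+∣y∣<m⇒x≡y (begin
      detℤ (circ a)                    ≈⟨ detℤ-circ≈ a ⟩
      + productᵛ (spectrum a)          ≈⟨ %ℕ-≈ (+ productᵛ (spectrum a)) ⟨
      + (productᵛ (spectrum a) % m)    ≡⟨ ≡.cong +_ eq ⟩
      + (v %ℕ m)                       ≈⟨ %ℕ-≈ v ⟩
      v                                ∎) <m

    ∣detℤ-circ∣≤search : ∀ (css : Vec (List (Vec ℕ n)) n) a → (∀ k → column k (a k) ∈ Vec.lookup css k) →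
                         2 ℕ.* ℤ.∣ detℤ (circ a) ∣ ℕ.< m →
                         ℤ.∣ detℤ (circ a) ∣ ℕ.≤ search css (Vec.replicate n 0)
    ∣detℤ-circ∣≤search css a ∈css <m = ℕ.≤-trans (∣x∣≤centred (detℤ-circ≈ a) <m)
      (≤search css (Vec.replicate n 0) (Vec.tabulate λ k → column k (a k)) (λ k →
        ≡.subst (_∈ Vec.lookup css k) (≡.sym (Vec.lookup∘tabulate (λ k → column k (a k)) k)) (∈css k)))

    maxAbsDet : Vector (List ℤ) n → ℕ
    maxAbsDet L = search (Vec.tabulate λ k → List.map (column k) (L k)) (Vec.replicate n 0)

    ∣detℤ-circ∣≤maxAbsDet : ∀ L a → (∀ k → a k ∈ L k) → 2 ℕ.* ℤ.∣ detℤ (circ a) ∣ ℕ.< m →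
                            ℤ.∣ detℤ (circ a) ∣ ℕ.≤ maxAbsDet L
    ∣detℤ-circ∣≤maxAbsDet L a a∈L = ∣detℤ-circ∣≤search (Vec.tabulate λ k → List.map (column k) (L k)) a (λ k →
      ≡.subst (column k (a k) ∈_) (≡.sym (Vec.lookup∘tabulate (λ k → List.map (column k) (L k)) k))
        (∈-map⁺ (column k) (a∈L k)))

-- Splitting a circulant of order 2h into two of order h

module Interleaving (h : ℕ) where
  open import Data.Nat.Base using (_+_; _*_)

  -- For odd h, the residues 2j + h (j < h) are the odd residues modulo 2h.
  interleave : Fin (h + h) → Fin (h + h)
  interleave i = [ (λ j → (2 * toℕ j) mod (h + h)) , (λ j → (2 * toℕ j + h) mod (h + h)) ]′ (splitAt h i)
    where instance _ = nonZeroIndex i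

  interleave-↑ˡ : ∀ j → ∃[ q ] 2 * toℕ j ≡ toℕ (interleave (j ↑ˡ h)) + q * (h + h)
  interleave-↑ˡ j rewrite splitAt-↑ˡ h j h = (2 * toℕ j) / (h + h) , Rotation.toℕ-mod (2 * toℕ j) (h + h)
    where instance _ = nonZeroIndex (j ↑ˡ h)

  interleave-↑ʳ : ∀ j → ∃[ q ] 2 * toℕ j + h ≡ toℕ (interleave (h ↑ʳ j)) + q * (h + h)
  interleave-↑ʳ j rewrite splitAt-↑ʳ h h j = (2 * toℕ j + h) / (h + h) , Rotation.toℕ-mod (2 * toℕ j + h) (h + h)
    where instance _ = nonZeroIndex (h ↑ʳ j)

module Doubling {c ℓ} (R : CommutativeRing c ℓ) where
  open CommutativeRing R hiding (zero)
  open Circulant R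
  open import Algebra.Properties.Ring ring
  open import Algebra.Properties.Semiring.Sum semiring
  open import Algebra.Properties.Monoid.Sum *-monoid using () renaming (sum to product; sum-cong-≋ to product-cong)
  open import Algebra.Properties.Semiring.Exp semiring
  open import Algebra.Properties.CommutativeSemigroup *-commutativeSemigroup
    using (x∙yz≈zx∙y)
  open import Relation.Binary.Reasoning.Setoid setoid

  sum-split : ∀ m {n} (f : Vector Carrier (m ℕ.+ n)) → sum f ≈ sum (f ∘ (_↑ˡ n)) + sum (f ∘ (m ↑ʳ_))
  sum-split zero    f = sym (+-identityˡ _)
  sum-split (suc m) f = trans (+-congˡ (sum-split m (f ∘ suc))) (sym (+-assoc _ _ _))

  product-split : ∀ m {n} (f : Vector Carrier (m ℕ.+ n)) →
                  product f ≈ product (f ∘ (_↑ˡ n)) * product (f ∘ (m ↑ʳ_))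
  product-split zero    f = sym (*-identityˡ _)
  product-split (suc m) f = trans (*-congˡ (product-split m (f ∘ suc))) (sym (*-assoc _ _ _))

  even-half odd-half : ∀ h → Vector Carrier (h ℕ.+ h) → Vector Carrier h
  even-half h a k = a (k ↑ˡ h) + a (h ↑ʳ k)
  odd-half  h a k = (- 1#) ^ toℕ k * (a (k ↑ˡ h) - a (h ↑ʳ k))

  -- R[x]/(x²ʰ - 1) ≅ R[x]/(xʰ - 1) × R[x]/(xʰ + 1), and x ↦ -x identifies the
  -- second factor with the first when h is odd.
  module _ {h} (root₂ : RootOfUnity (h ℕ.+ h)) (root : RootOfUnity h) where

    open Interleaving h
    private
      module r₂ = RootOfUnity root₂
      module r  = RootOfUnity root

    module _ (r₂²≈r : r₂.ω ^ 2 ≈ r.ω) (ωʰ≈-1 : r₂.ω ^ h ≈ - 1#) (h-odd : (- 1#) ^ h ≈ - 1#)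
             (interleave-injective : ∀ {i j : Fin (h ℕ.+ h)} → interleave i ≡ interleave j → i ≡ j) where

      private
        N : ℕ
        N = h ℕ.+ h

        w : Fin h → ℕ → Carrier
        w j k = r.ω ^ (toℕ j ℕ.* k)

        w-lower : ∀ j (k : Fin h) → w j (toℕ (k ↑ˡ h)) ≈ w j (toℕ k)
        w-lower j k = reflexive (≡.cong (w j) (toℕ-↑ˡ k h))

        w-upper : ∀ j (k : Fin h) → w j (toℕ (h ↑ʳ k)) ≈ w j (toℕ k)
        w-upper j k = ω^-periodic root _ _ 0 (toℕ j) (≡.trans (≡.cong (λ e → toℕ j ℕ.* e ℕ.+ 0) (toℕ-↑ʳ h k))
          (solve 3 (λ j h k → j :* (h :+ k) :+ con 0 := j :* k :+ j :* h) ≡.refl (toℕ j) h (toℕ k)))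
          where open +-*-Solver

        ω-even : ∀ j k → r₂.ω ^ (toℕ (interleave (j ↑ˡ h)) ℕ.* k) ≈ w j k
        ω-even j k with q , eq ← interleave-↑ˡ j = begin
          r₂.ω ^ (e ℕ.* k)                ≈⟨ ω^-periodic root₂ (e ℕ.* k) (2 ℕ.* (toℕ j ℕ.* k)) (q ℕ.* k) 0 exponents ⟩
          r₂.ω ^ (2 ℕ.* (toℕ j ℕ.* k))    ≈⟨ ^-assocʳ r₂.ω 2 (toℕ j ℕ.* k) ⟨
          (r₂.ω ^ 2) ^ (toℕ j ℕ.* k)      ≈⟨ ^-congˡ (toℕ j ℕ.* k) r₂²≈r ⟩
          w j k                           ∎
          where
          e : ℕ
          e = toℕ (interleave (j ↑ˡ h))
          open +-*-Solver
          exponents : e ℕ.* k ℕ.+ q ℕ.* k ℕ.* N ≡ 2 ℕ.* (toℕ j ℕ.* k) ℕ.+ 0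
          exponents = ≡.trans (solve 4 (λ e k q N → e :* k :+ q :* k :* N := (e :+ q :* N) :* k) ≡.refl e k q N)
            (≡.trans (≡.cong (ℕ._* k) (≡.sym eq))
              (solve 2 (λ j k → con 2 :* j :* k := con 2 :* (j :* k) :+ con 0) ≡.refl (toℕ j) k))

        -- Since ω₂²ʲ⁺ʰ = -ωʲ, an odd frequency evaluates the polynomial of a at -ωʲ. The resulting
        -- sign (-1)ᵏ is absorbed into `odd-half`.
        ω-odd : ∀ j k → r₂.ω ^ (toℕ (interleave (h ↑ʳ j)) ℕ.* k) ≈ w j k * (- 1#) ^ k
        ω-odd j k with q , eq ← interleave-↑ʳ j = begin
          r₂.ω ^ (e ℕ.* k)                             ≈⟨ ω^-periodic root₂ (e ℕ.* k) (2 ℕ.* (toℕ j ℕ.* k) ℕ.+ h ℕ.* k) (q ℕ.* k) 0 exponents ⟩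
          r₂.ω ^ (2 ℕ.* (toℕ j ℕ.* k) ℕ.+ h ℕ.* k)     ≈⟨ ^-homo-* r₂.ω (2 ℕ.* (toℕ j ℕ.* k)) (h ℕ.* k) ⟩
          r₂.ω ^ (2 ℕ.* (toℕ j ℕ.* k)) * r₂.ω ^ (h ℕ.* k)
            ≈⟨ *-cong (^-assocʳ r₂.ω 2 (toℕ j ℕ.* k)) (^-assocʳ r₂.ω h k) ⟨
          (r₂.ω ^ 2) ^ (toℕ j ℕ.* k) * (r₂.ω ^ h) ^ k
            ≈⟨ *-cong (^-congˡ (toℕ j ℕ.* k) r₂²≈r) (^-congˡ k ωʰ≈-1) ⟩
          w j k * (- 1#) ^ k                           ∎
          where
          e : ℕ
          e = toℕ (interleave (h ↑ʳ j))
          open +-*-Solver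
          exponents : e ℕ.* k ℕ.+ q ℕ.* k ℕ.* N ≡ 2 ℕ.* (toℕ j ℕ.* k) ℕ.+ h ℕ.* k ℕ.+ 0
          exponents = ≡.trans (solve 4 (λ e k q N → e :* k :+ q :* k :* N := (e :+ q :* N) :* k) ≡.refl e k q N)
            (≡.trans (≡.cong (ℕ._* k) (≡.sym eq))
              (solve 3 (λ j h k → (con 2 :* j :+ h) :* k := con 2 :* (j :* k) :+ h :* k :+ con 0) ≡.refl (toℕ j) h k))

        fold-eigenvalue : ∀ a (b : Vector Carrier h) e (j : Fin h) →
          (∀ k → a (k ↑ˡ h) * r₂.ω ^ (e ℕ.* toℕ (k ↑ˡ h)) + a (h ↑ʳ k) * r₂.ω ^ (e ℕ.* toℕ (h ↑ʳ k)) ≈ b k * w j (toℕ k)) →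
          eigenvalue root₂ a e ≈ eigenvalue root b (toℕ j)
        fold-eigenvalue a b e j terms = begin
          sum f                                          ≈⟨ sum-split h f ⟩
          sum {h} (f ∘ (_↑ˡ h)) + sum {h} (f ∘ (h ↑ʳ_))  ≈⟨ ∑-distrib-+ (f ∘ (_↑ˡ h)) (f ∘ (h ↑ʳ_)) ⟨
          sum {h} (λ k → f (k ↑ˡ h) + f (h ↑ʳ k))        ≈⟨ sum-cong-≋ {h} terms ⟩
          eigenvalue root b (toℕ j)                      ∎
          where
          f : Vector Carrier N
          f k = a k * r₂.ω ^ (e ℕ.* toℕ k)

        even-eigenvalue : ∀ a j →
          eigenvalue root₂ a (toℕ (interleave (j ↑ˡ h))) ≈ eigenvalue root (even-half h a) (toℕ j)
        even-eigenvalue a j = fold-eigenvalue a (even-half h a) (toℕ (interleave (j ↑ˡ h))) j (λ k → trans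
          (+-cong (*-congˡ (trans (ω-even j (toℕ (k ↑ˡ h))) (w-lower j k)))
                  (*-congˡ (trans (ω-even j (toℕ (h ↑ʳ k))) (w-upper j k))))
          (sym (distribʳ _ _ _)))

        odd-eigenvalue : ∀ a j →
          eigenvalue root₂ a (toℕ (interleave (h ↑ʳ j))) ≈ eigenvalue root (odd-half h a) (toℕ j)
        odd-eigenvalue a j = fold-eigenvalue a (odd-half h a) (toℕ (interleave (h ↑ʳ j))) j (λ k → begin
          a (k ↑ˡ h) * r₂.ω ^ (e ℕ.* toℕ (k ↑ˡ h)) + a (h ↑ʳ k) * r₂.ω ^ (e ℕ.* toℕ (h ↑ʳ k))
            ≈⟨ +-cong (*-congˡ (trans (ω-odd j (toℕ (k ↑ˡ h))) (*-cong (w-lower j k) (σ-lower k))))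
                      (*-congˡ (trans (ω-odd j (toℕ (h ↑ʳ k))) (*-cong (w-upper j k) (σ-upper k)))) ⟩
          a (k ↑ˡ h) * (w j (toℕ k) * σ k) + a (h ↑ʳ k) * (w j (toℕ k) * - σ k)
            ≈⟨ +-cong (x∙yz≈zx∙y _ _ _) (x∙yz≈zx∙y _ _ _) ⟩
          σ k * a (k ↑ˡ h) * w j (toℕ k) + - σ k * a (h ↑ʳ k) * w j (toℕ k)
            ≈⟨ distribʳ _ _ _ ⟨
          (σ k * a (k ↑ˡ h) + - σ k * a (h ↑ʳ k)) * w j (toℕ k)
            ≈⟨ *-congʳ (+-congˡ (-‿distribˡ-* (σ k) (a (h ↑ʳ k)))) ⟨
          (σ k * a (k ↑ˡ h) - σ k * a (h ↑ʳ k)) * w j (toℕ k)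
            ≈⟨ *-congʳ (x[y-z]≈xy-xz (σ k) (a (k ↑ˡ h)) (a (h ↑ʳ k))) ⟨
          odd-half h a k * w j (toℕ k) ∎)
          where
          e : ℕ
          e = toℕ (interleave (h ↑ʳ j))
          σ : Fin h → Carrier
          σ k = (- 1#) ^ toℕ k
          σ-lower : ∀ (k : Fin h) → (- 1#) ^ toℕ (k ↑ˡ h) ≈ σ k
          σ-lower k = reflexive (≡.cong ((- 1#) ^_) (toℕ-↑ˡ k h))
          -- Oddness of h gives the positions k and k + h opposite signs, which turns the sum of the
          -- two entries into their difference.
          σ-upper : ∀ (k : Fin h) → (- 1#) ^ toℕ (h ↑ʳ k) ≈ - σ k
          σ-upper k = begin
            (- 1#) ^ toℕ (h ↑ʳ k)    ≡⟨ ≡.cong ((- 1#) ^_) (toℕ-↑ʳ h k) ⟩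
            (- 1#) ^ (h ℕ.+ toℕ k)   ≈⟨ ^-homo-* (- 1#) h (toℕ k) ⟩
            (- 1#) ^ h * σ k         ≈⟨ *-congʳ h-odd ⟩
            - 1# * σ k               ≈⟨ -1*x≈-x (σ k) ⟩
            - σ k                    ∎

      determinant-halves : ∀ a → determinant rawRing (circ a) ≈
        determinant rawRing (circ (even-half h a)) * determinant rawRing (circ (odd-half h a))
      determinant-halves a = begin
        determinant rawRing (circ a)
          ≈⟨ determinant-circ root₂ interleave interleave-injective a ⟩
        product ev
          ≈⟨ product-split h ev ⟩
        product (ev ∘ (_↑ˡ h)) * product (ev ∘ (h ↑ʳ_))
          ≈⟨ *-cong (product-cong {h} (even-eigenvalue a)) (product-cong {h} (odd-eigenvalue a)) ⟩
        product {h} (λ j → eigenvalue root (even-half h a) (toℕ j)) * product {h} (λ j → eigenvalue root (odd-half h a) (toℕ j))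
          ≈⟨ *-cong (determinant-circ root id id (even-half h a)) (determinant-circ root id id (odd-half h a)) ⟨
        determinant rawRing (circ (even-half h a)) * determinant rawRing (circ (odd-half h a)) ∎
        where
        ev : Vector Carrier N
        ev i = eigenvalue root₂ a (toℕ (interleave i))

-- Maximal determinants of sign vectors

signs : List ℤ
signs = 1ℤ ∷ -1ℤ ∷ []

∈signVectors⁻ : ∀ {n a} → a ∈ signVectors n → ∀ i → a i ∈ signs
∈signVectors⁻ {suc n} a∈ i with ∈-cartesianProductWith⁻ Vector._∷_ signs (signVectors n) a∈
... | x , b , x∈ , b∈ , ≡.refl with i
...   | zero  = x∈
...   | suc j = ∈signVectors⁻ b∈ j

-- Vectors are functions, so without extensionality a is matched by a listed vector only pointwise;
-- `detℤ-circ-cong` bridges the difference.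
∈signVectors⁺ : ∀ {n} (a : Vector ℤ n) → (∀ i → a i ∈ signs) →
                ∃[ b ] b ∈ signVectors n × ∀ i → b i ≡ a i
∈signVectors⁺ {zero}  a a∈ = Vector.[] , here ≡.refl , λ ()
∈signVectors⁺ {suc n} a a∈ with b , b∈ , b≗a ← ∈signVectors⁺ (tail a) (a∈ ∘ suc) =
  a zero Vector.∷ b , ∈-cartesianProductWith⁺ Vector._∷_ (a∈ zero) b∈ , λ where
    zero    → ≡.refl
    (suc i) → b≗a i

detℤ-circ-cong : ∀ {n} {a b : Vector ℤ n} → (∀ i → a i ≡ b i) → detℤ (circ a) ≡ detℤ (circ b)
detℤ-circ-cong = RingRelation.determinant-circ-rel {A = ℤ.+-*-rawRing} {B = ℤ.+-*-rawRing} {_~_ = _≡_} (record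
  { +-rel = ≡.cong₂ ℤ._+_ ; *-rel = ≡.cong₂ ℤ._*_ ; -‿rel = ≡.cong (λ z → ℤ.- z) ; 0#-rel = ≡.refl ; 1#-rel = ≡.refl })

∣detℤ∣≤D±1 : ∀ {n} (a : Vector ℤ n) → (∀ i → a i ∈ signs) → ℤ.∣ detℤ (circ a) ∣ ℕ.≤ D±1 n
∣detℤ∣≤D±1 {n} a a∈ with b , b∈ , b≗a ← ∈signVectors⁺ a a∈ =
  ≡.subst (λ d → ℤ.∣ d ∣ ℕ.≤ D±1 n) (detℤ-circ-cong b≗a)
    (All.lookup (Extrema.xs≤max 0 _) (∈-map⁺ (λ a → ℤ.∣ detℤ (circ a) ∣) b∈))

D±1≤ : ∀ n {X} → (∀ a → (∀ i → a i ∈ signs) → ℤ.∣ detℤ (circ {n = n} a) ∣ ℕ.≤ X) → D±1 n ℕ.≤ X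
D±1≤ n bound = Extrema.max≤v⁺ {xs = List.map (λ a → ℤ.∣ detℤ (circ a) ∣) (signVectors n)} ℕ.z≤n (All.tabulate bound′)
  where
  bound′ : ∀ {x} → x ∈ List.map (λ a → ℤ.∣ detℤ (circ a) ∣) (signVectors n) → x ℕ.≤ _
  bound′ x∈ with a , a∈ , ≡.refl ← ∈-map⁻ (λ a → ℤ.∣ detℤ (circ a) ∣) x∈ = bound a (∈signVectors⁻ a∈)

∣sign∣≤1 : ∀ {x} → x ∈ signs → ℤ.∣ x ∣ ℕ.≤ 1
∣sign∣≤1 (here ≡.refl)         = ℕ.≤-refl
∣sign∣≤1 (there (here ≡.refl)) = ℕ.≤-refl

is-sign? : ∀ {n} (a : Vector ℤ n) → Dec (∀ i → a i ∈ signs)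
is-sign? a = all? λ i → a i ∈? signs
  where open import Data.List.Membership.DecPropositional ℤ._≟_ using (_∈?_)

D±1≡ : ∀ n (a : Vector ℤ n) v → detℤ (circ a) ≡ v → True (is-sign? a) → D±1 n ℕ.≤ ℤ.∣ v ∣ → D±1 n ≡ ℤ.∣ v ∣
D±1≡ n a v det≡v a∈ ≤v = ℕ.≤-antisym ≤v
  (≡.subst (λ d → ℤ.∣ d ∣ ℕ.≤ D±1 n) det≡v (∣detℤ∣≤D±1 {n} a (toWitness {a? = is-sign? a} a∈)))

module Bounds (m : ℕ) .{{_ : ℕ.NonZero m}} where
  open Modular m
  open CommutativeRing commutativeRing using (semiring; trans; sym; reflexive)
  open Circulant commutativeRing
  open Enumeration m
  open import Algebra.Properties.Semiring.Sum semiring using (sum)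
  open import Algebra.Properties.Semiring.Exp semiring using (_^_)

  %ℕ-≡⇒≈ : ∀ x y → x %ℕ m ≡ y %ℕ m → x ≈ y
  %ℕ-≡⇒≈ x y eq = trans (sym (%ℕ-≈ x)) (trans (reflexive (≡.cong +_ eq)) (%ℕ-≈ y))

  mkRoot : ∀ n (ω n⁻¹ : ℤ) → (ω ^ n) %ℕ m ≡ 1ℤ %ℕ m → (n⁻¹ ℤ.* sum {n} (const 1ℤ)) %ℕ m ≡ 1ℤ %ℕ m →
           True (all? {n = n} λ d → ¬? (toℕ d ℕ.≟ 0) →-dec (sum {n} (λ k → ω ^ (toℕ d ℕ.* toℕ k)) %ℕ m ℕ.≟ + 0 %ℕ m)) →
           RootOfUnity n
  mkRoot n ω n⁻¹ ωⁿ≡1 n⁻¹*n≡1 orth = record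
    { ω          = ω
    ; ωⁿ≈1       = %ℕ-≡⇒≈ (ω ^ n) 1ℤ ωⁿ≡1
    ; orthogonal = λ d d≢0 → %ℕ-≡⇒≈ (sum {n} (λ k → ω ^ (toℕ d ℕ.* toℕ k))) (+ 0) (toWitness orth d d≢0)
    ; n⁻¹        = n⁻¹
    ; n⁻¹*n≈1    = %ℕ-≡⇒≈ (n⁻¹ ℤ.* sum {n} (const 1ℤ)) 1ℤ n⁻¹*n≡1
    }

  detℤ-value : ∀ {n} (root : RootOfUnity n) a v → True (all? (λ i → ℤ.∣ a i ∣ ℕ.≤? 1)) →
               True (n ! ℕ.* 1 ℕ.^ n ℕ.+ ℤ.∣ v ∣ ℕ.<? m) →
               productᵛ (spectrum root a) ℕ.% m ≡ v %ℕ m → detℤ (circ a) ≡ v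
  detℤ-value root a v a≤1 <m = detℤ-circ≡ root a v
    (ℕ.≤-<-trans (ℕ.+-monoˡ-≤ ℤ.∣ v ∣ (∣det∣≤n!*bⁿ 1 (circ a) (λ i j → toWitness {a? = all? (λ i → ℤ.∣ a i ∣ ℕ.≤? 1)} a≤1 (j ⊖ i)))) (toWitness <m))

  D±1-value : ∀ n (root : RootOfUnity n) a v → detℤ (circ a) ≡ v → True (is-sign? a) →
              True (2 ℕ.* (n ! ℕ.* 1 ℕ.^ n) ℕ.<? m) → maxAbsDet root (const signs) ≡ ℤ.∣ v ∣ →
              D±1 n ≡ ℤ.∣ v ∣
  D±1-value n root a v det≡v a∈ <m maxAbsDet≡∣v∣ = D±1≡ n a v det≡v a∈
    (D±1≤ n (λ b b∈ → ≡.subst (ℤ.∣ detℤ (circ b) ∣ ℕ.≤_) maxAbsDet≡∣v∣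
      (∣detℤ-circ∣≤maxAbsDet root (const signs) b b∈
        (ℕ.≤-<-trans (ℕ.*-monoʳ-≤ 2 (∣det∣≤n!*bⁿ 1 (circ b) (λ i j → ∣sign∣≤1 (b∈ (j ⊖ i))))) (toWitness <m)))))

-- The moduli are Φ₉(2⁵), Φ₁₀(2⁷) and Φ₂₂(2⁸), so that powers of 2 are primitive roots of unity.
module Order9 where
  m : ℕ
  m = 1073774593

  open Bounds m
  open Enumeration m
  open Circulant (Modular.commutativeRing m) using (RootOfUnity)

  root : RootOfUnity 9
  -- 954466305 = (8m + 1) / 9 is the inverse of 9 modulo m.
  root = mkRoot 9 (+ 32) (+ 954466305) ≡.refl ≡.refl tt

  a : ℤ → Vector ℤ 9
  a x = x Vector.∷ 1ℤ Vector.∷ -1ℤ Vector.∷ 1ℤ Vector.∷ -1ℤ Vector.∷ -1ℤ Vector.∷ 1ℤ Vector.∷ 1ℤ Vector.∷ 1ℤ Vector.∷ Vector.[]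

  det-a₀ : detℤ (circ (a (+ 0))) ≡ + 8582
  det-a₀ = detℤ-value root (a (+ 0)) (+ 8582) tt tt ≡.refl

  det-a₁ : detℤ (circ (a 1ℤ)) ≡ + 6912
  det-a₁ = detℤ-value root (a 1ℤ) (+ 6912) tt tt ≡.refl

  D±1-9 : D±1 9 ≡ 6912
  D±1-9 = D±1-value 9 root (a 1ℤ) (+ 6912) det-a₁ tt tt ≡.refl

module Order10 where
  m : ℕ
  m = 266354561

  open Bounds m
  open Enumeration m
  open Circulant (Modular.commutativeRing m) using (RootOfUnity)

  root : RootOfUnity 10
  root = mkRoot 10 (+ 128) (+ 239719105) ≡.refl ≡.refl tt

  a : ℤ → Vector ℤ 10
  a x = x Vector.∷ -1ℤ Vector.∷ 1ℤ Vector.∷ -1ℤ Vector.∷ 1ℤ Vector.∷ 1ℤ Vector.∷ -1ℤ Vector.∷ -1ℤ Vector.∷ -1ℤ Vector.∷ -1ℤ Vector.∷ Vector.[]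

  det-a₀ : detℤ (circ (a (+ 0))) ≡ ℤ.- + 33489
  det-a₀ = detℤ-value root (a (+ 0)) (ℤ.- + 33489) tt tt ≡.refl

  det-a₁ : detℤ (circ (a 1ℤ)) ≡ ℤ.- + 22528
  det-a₁ = detℤ-value root (a 1ℤ) (ℤ.- + 22528) tt tt ≡.refl

  det-a₋₁ : detℤ (circ (a -1ℤ)) ≡ ℤ.- + 22528
  det-a₋₁ = detℤ-value root (a -1ℤ) (ℤ.- + 22528) tt tt ≡.refl

  D±1-10 : D±1 10 ≡ 22528
  D±1-10 = D±1-value 10 root (a 1ℤ) (ℤ.- + 22528) det-a₁ tt tt ≡.refl

-- Search over pairs of complementary supports

open import Data.Bool.Base using (Bool; true; false; not; if_then_else_; _∧_)
open import Data.Bool.Properties using (T-≡; not-involutive)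

select : ∀ {a} {A : Set a} {n} → Vec Bool n → Vec A n → Vec A n → Vec A n
select []      []       []       = []
select (b ∷ S) (x ∷ xs) (y ∷ ys) = (if b then x else y) ∷ select S xs ys

lookup-select : ∀ {a} {A : Set a} {n} (S : Vec Bool n) (xs ys : Vec A n) k →
  Vec.lookup (select S xs ys) k ≡ (if Vec.lookup S k then Vec.lookup xs k else Vec.lookup ys k)
lookup-select (b ∷ S) (x ∷ xs) (y ∷ ys) zero    = ≡.refl
lookup-select (b ∷ S) (x ∷ xs) (y ∷ ys) (suc k) = lookup-select S xs ys k

allSubsets : ∀ n → (Vec Bool n → Bool) → Bool
allSubsets zero    f = f []
allSubsets (suc n) f = allSubsets n (f ∘ (true ∷_)) ∧ allSubsets n (f ∘ (false ∷_))

allSubsets-sound : ∀ {n} f → allSubsets n f ≡ true → ∀ S → f S ≡ true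
allSubsets-sound f all []         = all
allSubsets-sound f all (b ∷ S) with allSubsets _ (f ∘ (true ∷_)) in eq
allSubsets-sound f all (true ∷ S)  | true = allSubsets-sound (f ∘ (true ∷_)) eq S
allSubsets-sound f all (false ∷ S) | true = allSubsets-sound (f ∘ (false ∷_)) all S

-- For a sign vector a, the halves of circ a have complementary supports: position k
-- belongs to the even half if a k = a (k + h) and to the odd half otherwise.
letters : Bool → List ℤ
letters true  = + 2 ∷ -[1+ 1 ] ∷ []
letters false = + 0 ∷ []

equal-signs : ℤ → ℤ → Bool
equal-signs x y = ⌊ x ℤ.≟ y ⌋

+-letters : ∀ {x y} → x ∈ signs → y ∈ signs → x ℤ.+ y ∈ letters (equal-signs x y)
+-letters (here ≡.refl)         (here ≡.refl)         = here ≡.refl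
+-letters (here ≡.refl)         (there (here ≡.refl)) = here ≡.refl
+-letters (there (here ≡.refl)) (here ≡.refl)         = here ≡.refl
+-letters (there (here ≡.refl)) (there (here ≡.refl)) = there (here ≡.refl)

*-signs : ∀ {x y} → x ∈ signs → y ∈ signs → x ℤ.* y ∈ signs
*-signs (here ≡.refl)         (here ≡.refl)         = here ≡.refl
*-signs (here ≡.refl)         (there (here ≡.refl)) = there (here ≡.refl)
*-signs (there (here ≡.refl)) (here ≡.refl)         = there (here ≡.refl)
*-signs (there (here ≡.refl)) (there (here ≡.refl)) = here ≡.refl

*---letters : ∀ {σ x y} → σ ∈ signs → x ∈ signs → y ∈ signs →
              σ ℤ.* (x ℤ.- y) ∈ letters (not (equal-signs x y))
*---letters (here ≡.refl)         (here ≡.refl)         (here ≡.refl)         = here ≡.refl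
*---letters (here ≡.refl)         (here ≡.refl)         (there (here ≡.refl)) = here ≡.refl
*---letters (here ≡.refl)         (there (here ≡.refl)) (here ≡.refl)         = there (here ≡.refl)
*---letters (here ≡.refl)         (there (here ≡.refl)) (there (here ≡.refl)) = here ≡.refl
*---letters (there (here ≡.refl)) (here ≡.refl)         (here ≡.refl)         = here ≡.refl
*---letters (there (here ≡.refl)) (here ≡.refl)         (there (here ≡.refl)) = there (here ≡.refl)
*---letters (there (here ≡.refl)) (there (here ≡.refl)) (here ≡.refl)         = here ≡.refl
*---letters (there (here ≡.refl)) (there (here ≡.refl)) (there (here ≡.refl)) = here ≡.refl

∣letter∣≤2 : ∀ b {x} → x ∈ letters b → ℤ.∣ x ∣ ℕ.≤ 2
∣letter∣≤2 true  (here ≡.refl)         = ℕ.≤-refl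
∣letter∣≤2 true  (there (here ≡.refl)) = ℕ.≤-refl
∣letter∣≤2 false (here ≡.refl)         = ℕ.z≤n

module HalfSearch (m : ℕ) .{{_ : ℕ.NonZero m}} where
  open Modular m
  open Enumeration m
  open Circulant commutativeRing using (RootOfUnity; module RootOfUnity)
  open Doubling commutativeRing
  open CommutativeRing commutativeRing using (semiring; trans; reflexive; 1#; -_)
  open import Algebra.Properties.Semiring.Exp semiring using (_^_)

  -- The tables for positions inside and outside the support are variables here, so that
  -- lazy evaluation computes their entries only once.
  module _ {n} (P Z : Vec (List (Vec ℕ (suc n))) (suc n)) where
    searchOn : Vec Bool (suc n) → ℕ
    searchOn S = search (select S P Z) (Vec.replicate (suc n) 0)

    -- A support and its complement give the same product, so only the supports containing position
    -- 0 are run through.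
    balanced : ℕ → Bool
    balanced X = allSubsets n λ S → searchOn (true ∷ S) ℕ.* searchOn (false ∷ Vec.map not S) ℕ.≤ᵇ X

    balanced-sound : ∀ X → balanced X ≡ true → ∀ S → searchOn S ℕ.* searchOn (Vec.map not S) ℕ.≤ X
    balanced-sound X all (true ∷ S)  = ℕ.≤ᵇ⇒≤ _ X (Equivalence.from T-≡ (allSubsets-sound _ all S))
    balanced-sound X all (false ∷ S) = ≡.subst (ℕ._≤ X)
      (≡.trans (ℕ.*-comm (searchOn (true ∷ Vec.map not S)) _)
        (≡.cong (λ U → searchOn (false ∷ U) ℕ.* searchOn (true ∷ Vec.map not S)) not-not))
      (ℕ.≤ᵇ⇒≤ _ X (Equivalence.from T-≡ (allSubsets-sound _ all (Vec.map not S))))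
      where
      not-not : Vec.map not (Vec.map not S) ≡ S
      not-not = ≡.trans (≡.sym (Vec.map-∘ not not S)) (≡.trans (Vec.map-cong not-involutive S) (Vec.map-id S))

  table : ∀ {n} → RootOfUnity n → Bool → Vec (List (Vec ℕ n)) n
  table root b = Vec.tabulate λ k → List.map (column root k) (letters b)

  Balanced : ∀ {n} → RootOfUnity (suc n) → ℕ → Set
  Balanced root X = balanced (table root true) (table root false) X ≡ true

  lookup-table : ∀ {n} (root : RootOfUnity n) S k →
    Vec.lookup (select S (table root true) (table root false)) k ≡
    List.map (column root k) (letters (Vec.lookup S k))
  lookup-table root S k = ≡.trans (lookup-select S (table root true) (table root false) k) (branch (Vec.lookup S k))
    where
    branch : ∀ b → (if b then Vec.lookup (table root true) k else Vec.lookup (table root false) k) ≡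
             List.map (column root k) (letters b)
    branch true  = Vec.lookup∘tabulate (λ k → List.map (column root k) (letters true)) k
    branch false = Vec.lookup∘tabulate (λ k → List.map (column root k) (letters false)) k

  module _ {n} (root : RootOfUnity (suc n)) (root₂ : RootOfUnity (suc n ℕ.+ suc n)) where
    open Interleaving (suc n)

    private
      h bound : ℕ
      h     = suc n
      bound = h ! ℕ.* 2 ℕ.^ h

      searchFor : Vec Bool h → ℕ
      searchFor = searchOn (table root true) (table root false)

      ∣detℤ∣≤bound : ∀ (c : Vector ℤ h) S → (∀ k → c k ∈ letters (Vec.lookup S k)) → ℤ.∣ detℤ (circ c) ∣ ℕ.≤ bound
      ∣detℤ∣≤bound c S c∈ = ∣det∣≤n!*bⁿ 2 (circ c) (λ i j → ∣letter∣≤2 (Vec.lookup S (j ⊖ i)) (c∈ (j ⊖ i)))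

      ∣detℤ∣≤searchFor : 2 ℕ.* bound ℕ.< m → ∀ c S → (∀ k → c k ∈ letters (Vec.lookup S k)) →
                         ℤ.∣ detℤ (circ c) ∣ ℕ.≤ searchFor S
      ∣detℤ∣≤searchFor <m c S c∈ = ∣detℤ-circ∣≤search root (select S (table root true) (table root false)) c
        (λ k → ≡.subst (column root k (c k) ∈_) (≡.sym (lookup-table root S k)) (∈-map⁺ (column root k) (c∈ k)))
        (ℕ.≤-<-trans (ℕ.*-monoʳ-≤ 2 (∣detℤ∣≤bound c S c∈)) <m)

    D±1≤-balanced : ∀ N → N ≡ suc n ℕ.+ suc n → ∀ X → Balanced root X →
      RootOfUnity.ω root₂ ^ 2 ≈ RootOfUnity.ω root → RootOfUnity.ω root₂ ^ suc n ≈ - 1# →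
      (- 1#) ^ suc n ≈ - 1# → (∀ {i j} → interleave i ≡ interleave j → i ≡ j) →
      True ((suc n ℕ.+ suc n) ! ℕ.* 1 ℕ.^ (suc n ℕ.+ suc n) ℕ.+ suc n ! ℕ.* 2 ℕ.^ suc n ℕ.* (suc n ! ℕ.* 2 ℕ.^ suc n) ℕ.<? m) →
      True (2 ℕ.* (suc n ! ℕ.* 2 ℕ.^ suc n) ℕ.<? m) →
      D±1 N ℕ.≤ X
    D±1≤-balanced _ ≡.refl X checked ω₂²≈ω ωʰ≈-1 odd injective product<m bound<m = D±1≤ (h ℕ.+ h) ∣detℤ∣≤X
      where
      module _ (b : Vector ℤ (h ℕ.+ h)) (b∈ : ∀ i → b i ∈ signs) where
        open ℕ.≤-Reasoning
        p q : Vector ℤ h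
        p = even-half h b
        q = odd-half h b
        s : Vector Bool h
        s k = equal-signs (b (k ↑ˡ h)) (b (h ↑ʳ k))
        S : Vec Bool h
        S = Vec.tabulate s
        p∈ : ∀ k → p k ∈ letters (Vec.lookup S k)
        p∈ k = ≡.subst (λ t → p k ∈ letters t) (≡.sym (Vec.lookup∘tabulate s k)) (+-letters (b∈ (k ↑ˡ h)) (b∈ (h ↑ʳ k)))
        power∈ : ∀ e → -1ℤ ^ e ∈ signs
        power∈ zero    = here ≡.refl
        power∈ (suc e) = *-signs (there (here ≡.refl)) (power∈ e)
        q∈ : ∀ k → q k ∈ letters (Vec.lookup (Vec.map not S) k)
        q∈ k = ≡.subst (λ t → q k ∈ letters t)
          (≡.sym (≡.trans (Vec.lookup-map k not S) (≡.cong not (Vec.lookup∘tabulate s k))))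
          (*---letters (power∈ (toℕ k)) (b∈ (k ↑ˡ h)) (b∈ (h ↑ʳ k)))
        halves≈ : detℤ (circ b) ≈ detℤ (circ p) ℤ.* detℤ (circ q)
        halves≈ = trans (reflexive (detℤ≡determinant (circ b)))
          (trans (determinant-halves root₂ root ω₂²≈ω ωʰ≈-1 odd injective b)
            (reflexive (≡.sym (≡.cong₂ ℤ._*_ (detℤ≡determinant (circ p)) (detℤ≡determinant (circ q))))))
        -- The factorisation is known only modulo m; the bounds on both sides add up to less than m,
        -- so it holds in ℤ.
        halves≡ : detℤ (circ b) ≡ detℤ (circ p) ℤ.* detℤ (circ q)
        halves≡ = ∣x∣+∣y∣<m⇒x≡y halves≈ (begin-strict
          ℤ.∣ detℤ (circ b) ∣ ℕ.+ ℤ.∣ detℤ (circ p) ℤ.* detℤ (circ q) ∣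
            ≡⟨ ≡.cong (ℤ.∣ detℤ (circ b) ∣ ℕ.+_) (ℤ.abs-* (detℤ (circ p)) (detℤ (circ q))) ⟩
          ℤ.∣ detℤ (circ b) ∣ ℕ.+ ℤ.∣ detℤ (circ p) ∣ ℕ.* ℤ.∣ detℤ (circ q) ∣
            ≤⟨ ℕ.+-mono-≤ (∣det∣≤n!*bⁿ 1 (circ b) (λ i j → ∣sign∣≤1 (b∈ (j ⊖ i))))
                 (ℕ.*-mono-≤ (∣detℤ∣≤bound p S p∈) (∣detℤ∣≤bound q (Vec.map not S) q∈)) ⟩
          (h ℕ.+ h) ! ℕ.* 1 ℕ.^ (h ℕ.+ h) ℕ.+ bound ℕ.* bound
            <⟨ toWitness product<m ⟩
          m ∎)
        ∣detℤ∣≤X : ℤ.∣ detℤ (circ b) ∣ ℕ.≤ X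
        ∣detℤ∣≤X = begin
          ℤ.∣ detℤ (circ b) ∣                            ≡⟨ ≡.cong (λ d → ℤ.∣ d ∣) halves≡ ⟩
          ℤ.∣ detℤ (circ p) ℤ.* detℤ (circ q) ∣          ≡⟨ ℤ.abs-* (detℤ (circ p)) (detℤ (circ q)) ⟩
          ℤ.∣ detℤ (circ p) ∣ ℕ.* ℤ.∣ detℤ (circ q) ∣    ≤⟨ ℕ.*-mono-≤ (∣detℤ∣≤searchFor (toWitness bound<m) p S p∈) (∣detℤ∣≤searchFor (toWitness bound<m) q (Vec.map not S) q∈) ⟩
          searchFor S ℕ.* searchFor (Vec.map not S)      ≤⟨ balanced-sound (table root true) (table root false) X checked S ⟩
          X                                              ∎

module Order22 where
  m : ℕ
  -- m has to exceed 22! + (11! 2¹¹)², the bound under which the factorisation modulo m is an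
  -- equality. The base 2⁷ in place of 2⁸ would fall short of it.
  m = 1204221828098618944454401

  open Modular m
  open Bounds m
  open Enumeration m
  open Circulant commutativeRing using (RootOfUnity)
  open HalfSearch m
  open CommutativeRing commutativeRing using (semiring)
  open import Algebra.Properties.Semiring.Exp semiring using (_^_)
  open Interleaving 11

  root₂₂ : RootOfUnity 22
  root₂₂ = mkRoot 22 (+ 256) (+ 1149484472275954446979201) ≡.refl ≡.refl tt

  root₁₁ : RootOfUnity 11
  root₁₁ = mkRoot 11 (+ 65536) (+ 1094747116453289949504001) ≡.refl ≡.refl tt

  a : ℤ → Vector ℤ 22
  a x = x Vector.∷ -1ℤ Vector.∷ 1ℤ Vector.∷ 1ℤ Vector.∷ -1ℤ Vector.∷ -1ℤ Vector.∷ -1ℤ Vector.∷ -1ℤ Vector.∷ -1ℤ Vector.∷ -1ℤ Vector.∷ -1ℤ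
    Vector.∷ 1ℤ Vector.∷ 1ℤ Vector.∷ -1ℤ Vector.∷ 1ℤ Vector.∷ -1ℤ Vector.∷ 1ℤ Vector.∷ -1ℤ Vector.∷ 1ℤ Vector.∷ 1ℤ Vector.∷ -1ℤ Vector.∷ -1ℤ Vector.∷ Vector.[]

  det-a₀ : detℤ (circ (a (+ 0))) ≡ ℤ.- + 216409254831025
  det-a₀ = detℤ-value root₂₂ (a (+ 0)) (ℤ.- + 216409254831025) tt tt ≡.refl

  det-a₁ : detℤ (circ (a 1ℤ)) ≡ ℤ.- + 215055782117376
  det-a₁ = detℤ-value root₂₂ (a 1ℤ) (ℤ.- + 215055782117376) tt tt ≡.refl

  det-a₋₁ : detℤ (circ (a -1ℤ)) ≡ ℤ.- + 215055782117376
  det-a₋₁ = detℤ-value root₂₂ (a -1ℤ) (ℤ.- + 215055782117376) tt tt ≡.refl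

  X : ℕ
  X = 215055782117376

  interleave-injective : ∀ {i j} → interleave i ≡ interleave j → i ≡ j
  interleave-injective {i} {j} =
    toWitness {a? = all? λ i → all? λ j → (interleave i Fin.≟ interleave j) →-dec (i Fin.≟ j)} tt i j

  -- The exhaustive search itself: evaluation runs through the 2¹⁰ pairs of complementary supports
  -- with all sign choices on each.
  checked : Balanced {10} root₁₁ X
  checked = ≡.refl

  D±1-22≤ : D±1 22 ℕ.≤ X
  D±1-22≤ = D±1≤-balanced {10} root₁₁ root₂₂ 22 ≡.refl X checked
    (%ℕ-≡⇒≈ ((+ 256) ^ 2) (+ 65536) ≡.refl) (%ℕ-≡⇒≈ ((+ 256) ^ 11) -1ℤ ≡.refl) (%ℕ-≡⇒≈ (-1ℤ ^ 11) -1ℤ ≡.refl)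
    interleave-injective tt tt

  D±1-22 : D±1 22 ≡ X
  D±1-22 = D±1≡ 22 (a 1ℤ) (ℤ.- + X) det-a₁ tt D±1-22≤

open import Data.Rational.Base as ℚ using (ℚ; 0ℚ; 1ℚ; toℚᵘ)
import Data.Rational.Properties as ℚ
open import Data.Rational.Solver using () renaming (module +-*-Solver to ℚ-Solver)
open import Data.Rational.Unnormalised.Base as ℚᵘ using (mkℚᵘ; *≡*; *≤*)
import Data.Rational.Unnormalised.Properties as ℚᵘ
open import Defs

-- Real sequences with integer values or limits

fromℤ : ℤ → ℚ
fromℤ z = z ℚ./ 1

toℚᵘ-fromℤ : ∀ z → toℚᵘ (fromℤ z) ℚᵘ.≃ mkℚᵘ z 0
toℚᵘ-fromℤ z = ℚ.toℚᵘ-fromℚᵘ (mkℚᵘ z 0)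

fromℤ-+ : ∀ x y → fromℤ (x ℤ.+ y) ≡ fromℤ x ℚ.+ fromℤ y
fromℤ-+ x y = ℚ.toℚᵘ-injective (begin
  toℚᵘ (fromℤ (x ℤ.+ y))                  ≈⟨ toℚᵘ-fromℤ (x ℤ.+ y) ⟩
  mkℚᵘ (x ℤ.+ y) 0                        ≈⟨ *≡* (solve 2 (λ x y → (x :+ y) :* con 1ℤ := (x :* con 1ℤ :+ y :* con 1ℤ) :* con 1ℤ) ≡.refl x y) ⟩
  mkℚᵘ x 0 ℚᵘ.+ mkℚᵘ y 0                  ≈⟨ ℚᵘ.+-cong (toℚᵘ-fromℤ x) (toℚᵘ-fromℤ y) ⟨
  toℚᵘ (fromℤ x) ℚᵘ.+ toℚᵘ (fromℤ y)      ≈⟨ ℚ.toℚᵘ-homo-+ (fromℤ x) (fromℤ y) ⟨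
  toℚᵘ (fromℤ x ℚ.+ fromℤ y)              ∎)
  where
  open ℚᵘ.≃-Reasoning
  open ℤ.+-*-Solver

fromℤ-* : ∀ x y → fromℤ (x ℤ.* y) ≡ fromℤ x ℚ.* fromℤ y
fromℤ-* x y = ℚ.toℚᵘ-injective (begin
  toℚᵘ (fromℤ (x ℤ.* y))                  ≈⟨ toℚᵘ-fromℤ (x ℤ.* y) ⟩
  mkℚᵘ x 0 ℚᵘ.* mkℚᵘ y 0                  ≈⟨ ℚᵘ.*-cong (toℚᵘ-fromℤ x) (toℚᵘ-fromℤ y) ⟨
  toℚᵘ (fromℤ x) ℚᵘ.* toℚᵘ (fromℤ y)      ≈⟨ ℚ.toℚᵘ-homo-* (fromℤ x) (fromℤ y) ⟨
  toℚᵘ (fromℤ x ℚ.* fromℤ y)              ∎)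
  where open ℚᵘ.≃-Reasoning

fromℤ-neg : ∀ x → fromℤ (ℤ.- x) ≡ ℚ.- fromℤ x
fromℤ-neg x = ℚ.toℚᵘ-injective (begin
  toℚᵘ (fromℤ (ℤ.- x))     ≈⟨ toℚᵘ-fromℤ (ℤ.- x) ⟩
  ℚᵘ.- mkℚᵘ x 0            ≈⟨ ℚᵘ.-‿cong (toℚᵘ-fromℤ x) ⟨
  ℚᵘ.- toℚᵘ (fromℤ x)      ≈⟨ ℚ.toℚᵘ-homo‿- (fromℤ x) ⟨
  toℚᵘ (ℚ.- fromℤ x)       ∎)
  where open ℚᵘ.≃-Reasoning

fromℤ-mono-≤ : ∀ {x y} → x ℤ.≤ y → fromℤ x ℚ.≤ fromℤ y
fromℤ-mono-≤ {x} {y} x≤y = ℚ.toℚᵘ-cancel-≤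
  (ℚᵘ.≤-respˡ-≃ (ℚᵘ.≃-sym (toℚᵘ-fromℤ x)) (ℚᵘ.≤-respʳ-≃ (ℚᵘ.≃-sym (toℚᵘ-fromℤ y))
    (*≤* (ℤ.*-monoʳ-≤-nonNeg 1ℤ x≤y))))

∣fromℤ∣ : ∀ x → ℚ.∣ fromℤ x ∣ ≡ fromℤ (+ ℤ.∣ x ∣)
∣fromℤ∣ (+ n)      = ℚ.0≤p⇒∣p∣≡p (fromℤ-mono-≤ {+ 0} {+ n} (ℤ.+≤+ ℕ.z≤n))
∣fromℤ∣ -[1+ n ]   = ≡.trans (ℚ.∣-p∣≡∣p∣ (fromℤ (+ suc n))) (∣fromℤ∣ (+ suc n))

0<1 : 0ℚ ℚ.< 1ℚ
0<1 = ℚ.positive⁻¹ 1ℚ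

p<p+q : ∀ p {q} → 0ℚ ℚ.< q → p ℚ.< p ℚ.+ q
p<p+q p {q} 0<q = ≡.subst (ℚ._< p ℚ.+ q) (ℚ.+-identityʳ p) (ℚ.+-monoʳ-< p 0<q)

≗⇒≃ : ∀ x y → (∀ k → seq x k ≡ seq y k) → x ≃ y
≗⇒≃ x y x≗y ε 0<ε = 0 , λ n _ → ≡.subst (λ d → ℚ.∣ d ∣ ℚ.< ε)
  (≡.sym (≡.trans (≡.cong (ℚ._- seq y n) (x≗y n)) (ℚ.+-inverseʳ (seq y n)))) 0<ε

infix 4 _↦_
-- Every term equals z, which is stronger than `≃`. It holds for the explicit entries, is preserved
-- by the ring operations without estimates, and reduces comparisons of reals to comparisons of
-- integers.
_↦_ : ℝ → ℤ → Set
x ↦ z = ∀ k → seq x k ≡ fromℤ z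

↦-det : ∀ {n} (a : Vector ℝ n) (z : Vector ℤ n) → (∀ i → a i ↦ z i) → det (circ a) ↦ detℤ (circ z)
↦-det a z a↦z = RingRelation.determinant-circ-rel {A = ℝ-rawRing} {B = ℤ.+-*-rawRing} {_~_ = _↦_} (record
  { +-rel  = λ {x} {y} {u} {v} x↦u y↦v k → ≡.trans (≡.cong₂ ℚ._+_ (x↦u k) (y↦v k)) (≡.sym (fromℤ-+ u v))
  ; *-rel  = λ {x} {y} {u} {v} x↦u y↦v k → ≡.trans (≡.cong₂ ℚ._*_ (x↦u k) (y↦v k)) (≡.sym (fromℤ-* u v))
  ; -‿rel  = λ {x} {u} x↦u k → ≡.trans (≡.cong (λ p → ℚ.- p) (x↦u k)) (≡.sym (fromℤ-neg u))
  ; 0#-rel = λ _ → ≡.refl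
  ; 1#-rel = λ _ → ≡.refl
  }) {a = a} {b = z} a↦z

↦-circ : ∀ {n} (M : Matrix ℝ n) (a : Vector ℝ n) (z : Vector ℤ n) {v} →
         M ≡ circ a → (∀ i → a i ↦ z i) → detℤ (circ z) ≡ v → det M ↦ v
↦-circ M a z ≡.refl a↦z ≡.refl = ↦-det a z a↦z

↦-neg : ∀ x z {w} → x ↦ z → w ≡ ℤ.- z → - x ↦ w
↦-neg x z x↦z ≡.refl k = ≡.trans (≡.cong (λ p → ℚ.- p) (x↦z k)) (≡.sym (fromℤ-neg z))

↦-entries : ∀ {n} (a : Vector ℝ n) (z : Vector ℤ n) →
            (∀ k → True (all? (λ i → seq (a i) k ℚ.≟ fromℤ (z i)))) → ∀ i → a i ↦ z i
↦-entries a z eq i k = toWitness {a? = all? (λ i → seq (a i) k ℚ.≟ fromℤ (z i))} (eq k) i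

↦-abs : ∀ x z → x ↦ z → ∣ x ∣ ↦ + ℤ.∣ z ∣
↦-abs x z x↦z k = ≡.trans (≡.cong ℚ.∣_∣ (x↦z k)) (∣fromℤ∣ z)

↦-fromℕ : ∀ n → fromℕ n ↦ + n
↦-fromℕ n k = ≡.refl

↦-≃ : ∀ x y {z} → x ↦ z → y ↦ z → x ≃ y
↦-≃ x y x↦z y↦z = ≗⇒≃ x y (λ k → ≡.trans (x↦z k) (≡.sym (y↦z k)))

↦-≤ : ∀ x y {u v} → x ↦ u → y ↦ v → u ℤ.≤ v → x ≤ y
↦-≤ x y {u} {v} x↦u y↦v u≤v ε 0<ε = 0 , λ n _ → begin-strict
  seq x n            ≡⟨ x↦u n ⟩
  fromℤ u            ≤⟨ fromℤ-mono-≤ u≤v ⟩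
  fromℤ v            ≡⟨ y↦v n ⟨
  seq y n            <⟨ p<p+q (seq y n) 0<ε ⟩
  seq y n ℚ.+ ε      ∎
  where open ℚ.≤-Reasoning

↦-< : ∀ x y {u v} → x ↦ u → y ↦ v → u ℤ.< v → x < y
↦-< x y {u} {v} x↦u y↦v u<v = 1ℚ , 0<1 , 0 , λ n _ → begin
  seq x n ℚ.+ 1ℚ          ≡⟨ ≡.cong (ℚ._+ 1ℚ) (x↦u n) ⟩
  fromℤ u ℚ.+ fromℤ 1ℤ    ≡⟨ fromℤ-+ u 1ℤ ⟨
  fromℤ (u ℤ.+ 1ℤ)        ≡⟨ ≡.cong fromℤ (ℤ.+-comm u 1ℤ) ⟩
  fromℤ (ℤ.suc u)         ≤⟨ fromℤ-mono-≤ (ℤ.i<j⇒suc[i]≤j u<v) ⟩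
  fromℤ v                 ≡⟨ y↦v n ⟨
  seq y n                 ∎
  where open ℚ.≤-Reasoning

halve : ∀ ε → 0ℚ ℚ.< ε → ∃[ δ ] 0ℚ ℚ.< δ × δ ℚ.+ δ ≡ ε
halve ε 0<ε = ε ℚ.* ℚ.½
  , ≡.subst (ℚ._< ε ℚ.* ℚ.½) (ℚ.*-zeroˡ ℚ.½) (ℚ.*-monoˡ-<-pos ℚ.½ 0<ε)
  , ≡.trans (≡.sym (ℚ.*-distribˡ-+ ε ℚ.½ ℚ.½)) (ℚ.*-identityʳ ε)

<-≤-trans : ∀ x y z → x < y → y ≤ z → x < z
<-≤-trans x y z (ε , 0<ε , M , x<y) y≤z with δ , 0<δ , ≡.refl ← halve ε 0<ε with N , y<z ← y≤z δ 0<δ =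
  δ , 0<δ , M ℕ.⊔ N , λ n n≥ → begin
    seq x n ℚ.+ δ                  ≡⟨ solve 2 (λ x d → x :+ d := x :+ (d :+ d) :- d) ≡.refl (seq x n) δ ⟩
    seq x n ℚ.+ (δ ℚ.+ δ) ℚ.- δ    ≤⟨ ℚ.+-monoˡ-≤ (ℚ.- δ) (x<y n (ℕ.m⊔n≤o⇒m≤o M N n≥)) ⟩
    seq y n ℚ.- δ                  ≤⟨ ℚ.+-monoˡ-≤ (ℚ.- δ) (ℚ.<⇒≤ (y<z n (ℕ.m⊔n≤o⇒n≤o M N n≥))) ⟩
    seq z n ℚ.+ δ ℚ.- δ            ≡⟨ solve 2 (λ z d → z :+ d :- d := z) ≡.refl (seq z n) δ ⟩
    seq z n                        ∎
  where
  open ℚ.≤-Reasoning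
  open ℚ-Solver hiding (Polynomial)

-- Limits, and determinants at extreme points

infix 4 _⟶_
_⟶_ : ℝ → ℤ → Set
x ⟶ z = x ≃ fromℚ (fromℤ z)

⟶-+ : ∀ {x y u v} → x ⟶ u → y ⟶ v → x + y ⟶ u ℤ.+ v
⟶-+ {x} {y} {u} {v} x⟶u y⟶v ε 0<ε
  with δ , 0<δ , ≡.refl ← halve ε 0<ε
  with M , x≈u ← x⟶u δ 0<δ
  with N , y≈v ← y⟶v δ 0<δ = M ℕ.⊔ N , λ n n≥ → begin-strict
    ℚ.∣ seq x n ℚ.+ seq y n ℚ.- fromℤ (u ℤ.+ v) ∣
      ≡⟨ ≡.cong (λ w → ℚ.∣ seq x n ℚ.+ seq y n ℚ.- w ∣) (fromℤ-+ u v) ⟩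
    ℚ.∣ seq x n ℚ.+ seq y n ℚ.- (fromℤ u ℚ.+ fromℤ v) ∣
      ≡⟨ ≡.cong ℚ.∣_∣ (solve 4 (λ x y u v → x :+ y :- (u :+ v) := x :- u :+ (y :- v)) ≡.refl (seq x n) (seq y n) (fromℤ u) (fromℤ v)) ⟩
    ℚ.∣ seq x n ℚ.- fromℤ u ℚ.+ (seq y n ℚ.- fromℤ v) ∣
      ≤⟨ ℚ.∣p+q∣≤∣p∣+∣q∣ (seq x n ℚ.- fromℤ u) (seq y n ℚ.- fromℤ v) ⟩
    ℚ.∣ seq x n ℚ.- fromℤ u ∣ ℚ.+ ℚ.∣ seq y n ℚ.- fromℤ v ∣
      <⟨ ℚ.+-mono-< (x≈u n (ℕ.m⊔n≤o⇒m≤o M N n≥)) (y≈v n (ℕ.m⊔n≤o⇒n≤o M N n≥)) ⟩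
    δ ℚ.+ δ ∎
  where
  open ℚ.≤-Reasoning
  open ℚ-Solver hiding (Polynomial)

⟶-neg : ∀ {x u} → x ⟶ u → - x ⟶ ℤ.- u
⟶-neg {x} {u} x⟶u ε 0<ε with N , x≈u ← x⟶u ε 0<ε = N , λ n n≥ → ≡.subst (ℚ._< ε) (begin
  ℚ.∣ seq x n ℚ.- fromℤ u ∣             ≡⟨ ℚ.∣-p∣≡∣p∣ (seq x n ℚ.- fromℤ u) ⟨
  ℚ.∣ ℚ.- (seq x n ℚ.- fromℤ u) ∣       ≡⟨ ≡.cong ℚ.∣_∣ (solve 2 (λ x u → :- (x :- u) := :- x :- :- u) ≡.refl (seq x n) (fromℤ u)) ⟩
  ℚ.∣ ℚ.- seq x n ℚ.- ℚ.- fromℤ u ∣     ≡⟨ ≡.cong (λ w → ℚ.∣ ℚ.- seq x n ℚ.- w ∣) (fromℤ-neg u) ⟨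
  ℚ.∣ ℚ.- seq x n ℚ.- fromℤ (ℤ.- u) ∣   ∎) (x≈u n n≥)
  where
  open ≡.≡-Reasoning
  open ℚ-Solver hiding (Polynomial)

⟶-* : ∀ {x y u v} → x ⟶ u → y ⟶ v → x * y ⟶ u ℤ.* v
⟶-* {x} {y} {u} {v} x⟶u y⟶v ε 0<ε = result
  where
  p q K : ℚ
  p = fromℤ u
  q = fromℤ v
  -- From st - pq = s(t - q) + q(s - p), with |s| < |p| + 1 once s is within 1 of p, the error is
  -- below Kδ when both factors are within δ of their limits.
  K = ℚ.∣ p ∣ ℚ.+ 1ℚ ℚ.+ ℚ.∣ q ∣
  0<K : 0ℚ ℚ.< K
  0<K = ℚ.+-mono-<-≤ (ℚ.+-mono-≤-< (ℚ.0≤∣p∣ p) 0<1) (ℚ.0≤∣p∣ q)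
  instance
    K-pos = ℚ.positive 0<K
    K-nonZero = ℚ.pos⇒nonZero K
    1/K-pos = ℚ.1/pos⇒pos K
  δ : ℚ
  δ = ε ℚ.* ℚ.1/ K
  0<δ : 0ℚ ℚ.< δ
  0<δ = ≡.subst (ℚ._< δ) (ℚ.*-zeroˡ (ℚ.1/ K)) (ℚ.*-monoˡ-<-pos (ℚ.1/ K) 0<ε)
  instance δ-pos = ℚ.positive 0<δ
  Kδ≡ε : K ℚ.* δ ≡ ε
  Kδ≡ε = ≡.trans (solve 3 (λ K ε r → K :* (ε :* r) := ε :* (K :* r)) ≡.refl K ε (ℚ.1/ K))
    (≡.trans (≡.cong (ε ℚ.*_) (ℚ.*-inverseʳ K)) (ℚ.*-identityʳ ε))
    where open ℚ-Solver
  module _ (n : ℕ) where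
    s t : ℚ
    s = seq x n
    t = seq y n
    open ℚ.≤-Reasoning
    open ℚ-Solver
    close : ℚ.∣ s ℚ.- p ∣ ℚ.< 1ℚ → ℚ.∣ s ℚ.- p ∣ ℚ.< δ → ℚ.∣ t ℚ.- q ∣ ℚ.< δ →
            ℚ.∣ s ℚ.* t ℚ.- fromℤ (u ℤ.* v) ∣ ℚ.< ε
    close s≈₁p s≈p t≈q = begin-strict
      ℚ.∣ s ℚ.* t ℚ.- fromℤ (u ℤ.* v) ∣
        ≡⟨ ≡.cong (λ w → ℚ.∣ s ℚ.* t ℚ.- w ∣) (fromℤ-* u v) ⟩
      ℚ.∣ s ℚ.* t ℚ.- p ℚ.* q ∣
        ≡⟨ ≡.cong ℚ.∣_∣ (solve 4 (λ s t p q → s :* t :- p :* q := s :* (t :- q) :+ q :* (s :- p)) ≡.refl s t p q) ⟩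
      ℚ.∣ s ℚ.* (t ℚ.- q) ℚ.+ q ℚ.* (s ℚ.- p) ∣
        ≤⟨ ℚ.∣p+q∣≤∣p∣+∣q∣ (s ℚ.* (t ℚ.- q)) (q ℚ.* (s ℚ.- p)) ⟩
      ℚ.∣ s ℚ.* (t ℚ.- q) ∣ ℚ.+ ℚ.∣ q ℚ.* (s ℚ.- p) ∣
        ≡⟨ ≡.cong₂ ℚ._+_ (ℚ.∣p*q∣≡∣p∣*∣q∣ s (t ℚ.- q)) (ℚ.∣p*q∣≡∣p∣*∣q∣ q (s ℚ.- p)) ⟩
      ℚ.∣ s ∣ ℚ.* ℚ.∣ t ℚ.- q ∣ ℚ.+ ℚ.∣ q ∣ ℚ.* ℚ.∣ s ℚ.- p ∣
        ≤⟨ ℚ.+-mono-≤ (ℚ.*-monoˡ-≤-nonNeg ℚ.∣ s ∣ {{ℚ.∣-∣-nonNeg s}} (ℚ.<⇒≤ t≈q))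
                      (ℚ.*-monoˡ-≤-nonNeg ℚ.∣ q ∣ {{ℚ.∣-∣-nonNeg q}} (ℚ.<⇒≤ s≈p)) ⟩
      ℚ.∣ s ∣ ℚ.* δ ℚ.+ ℚ.∣ q ∣ ℚ.* δ
        <⟨ ℚ.+-monoˡ-< (ℚ.∣ q ∣ ℚ.* δ) (ℚ.*-monoˡ-<-pos δ s-bound) ⟩
      (ℚ.∣ p ∣ ℚ.+ 1ℚ) ℚ.* δ ℚ.+ ℚ.∣ q ∣ ℚ.* δ
        ≡⟨ ℚ.*-distribʳ-+ δ (ℚ.∣ p ∣ ℚ.+ 1ℚ) ℚ.∣ q ∣ ⟨
      K ℚ.* δ
        ≡⟨ Kδ≡ε ⟩
      ε ∎
      where
      s-bound : ℚ.∣ s ∣ ℚ.< ℚ.∣ p ∣ ℚ.+ 1ℚ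
      s-bound = begin-strict
        ℚ.∣ s ∣                          ≡⟨ ≡.cong ℚ.∣_∣ (solve 2 (λ s p → s := p :+ (s :- p)) ≡.refl s p) ⟩
        ℚ.∣ p ℚ.+ (s ℚ.- p) ∣            ≤⟨ ℚ.∣p+q∣≤∣p∣+∣q∣ p (s ℚ.- p) ⟩
        ℚ.∣ p ∣ ℚ.+ ℚ.∣ s ℚ.- p ∣        <⟨ ℚ.+-monoʳ-< ℚ.∣ p ∣ s≈₁p ⟩
        ℚ.∣ p ∣ ℚ.+ 1ℚ                   ∎
  result : ∃[ N ] ∀ n → N ℕ.≤ n → ℚ.∣ seq x n ℚ.* seq y n ℚ.- fromℤ (u ℤ.* v) ∣ ℚ.< ε
  result
    with L , x≈₁u ← x⟶u 1ℚ 0<1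
    with M , x≈u ← x⟶u δ 0<δ
    with N , y≈v ← y⟶v δ 0<δ = L ℕ.⊔ (M ℕ.⊔ N) , λ n n≥ →
      let n≥MN = ℕ.m⊔n≤o⇒n≤o L (M ℕ.⊔ N) n≥
      in close n (x≈₁u n (ℕ.m⊔n≤o⇒m≤o L (M ℕ.⊔ N) n≥)) (x≈u n (ℕ.m⊔n≤o⇒m≤o M N n≥MN)) (y≈v n (ℕ.m⊔n≤o⇒n≤o M N n≥MN))

⟶-const : ∀ z → fromℚ (fromℤ z) ⟶ z
⟶-const z = ≗⇒≃ (fromℚ (fromℤ z)) (fromℚ (fromℤ z)) (λ _ → ≡.refl)

⟶-det : ∀ {n} (a : Vector ℝ n) (z : Vector ℤ n) → (∀ i → a i ⟶ z i) → det (circ a) ⟶ detℤ (circ z)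
⟶-det a z a⟶z = RingRelation.determinant-circ-rel {A = ℝ-rawRing} {B = ℤ.+-*-rawRing} {_~_ = _⟶_} (record
  { +-rel  = λ {x} {y} {u} {v} → ⟶-+ {x} {y} {u} {v}
  ; *-rel  = λ {x} {y} {u} {v} → ⟶-* {x} {y} {u} {v}
  ; -‿rel  = λ {x} {u} → ⟶-neg {x} {u}
  ; 0#-rel = ⟶-const (+ 0)
  ; 1#-rel = ⟶-const 1ℤ
  }) {a = a} {b = z} a⟶z

extremePoint⟶signs : ∀ {n} (a : Vector ℝ n) → IsExtremePoint a →
                     ∃[ z ] (∀ i → z i ∈ signs) × (∀ i → a i ⟶ z i)
extremePoint⟶signs {n} a extreme = (λ i → proj₁ (sign i)) , (λ i → proj₁ (proj₂ (sign i))) , (λ i → proj₂ (proj₂ (sign i)))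
  where
  sign : ∀ i → ∃[ z ] z ∈ signs × a i ⟶ z
  sign i with extreme i
  ... | inj₁ a≃1  = 1ℤ , here ≡.refl , a≃1
  ... | inj₂ a≃-1 = -1ℤ , there (here ≡.refl) , a≃-1

close⇒bounded : ∀ t w {d ε} → ℚ.∣ t ℚ.- w ∣ ℚ.< ε → ℚ.∣ w ∣ ℚ.≤ d → ¬ (d ℚ.+ ε ℚ.≤ ℚ.∣ t ∣)
close⇒bounded t w {d} {ε} t≈w w≤d d+ε≤t = ℚ.<-irrefl ≡.refl (begin-strict
  ℚ.∣ t ∣                      ≡⟨ ≡.cong ℚ.∣_∣ (solve 2 (λ t w → t := w :+ (t :- w)) ≡.refl t w) ⟩
  ℚ.∣ w ℚ.+ (t ℚ.- w) ∣        ≤⟨ ℚ.∣p+q∣≤∣p∣+∣q∣ w (t ℚ.- w) ⟩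
  ℚ.∣ w ∣ ℚ.+ ℚ.∣ t ℚ.- w ∣    <⟨ ℚ.+-mono-≤-< w≤d t≈w ⟩
  d ℚ.+ ε                      ≤⟨ d+ε≤t ⟩
  ℚ.∣ t ∣                      ∎)
  where
  open ℚ.≤-Reasoning
  open ℚ-Solver

-- The gap ε contained in `<` serves as tolerance for the convergence: at a late index the term
-- would have absolute value at least d + ε and also less than |z| + ε.
⟶⇒≯ : ∀ x z d → x ⟶ z → ℤ.∣ z ∣ ℕ.≤ d → ¬ fromℕ d < ∣ x ∣
⟶⇒≯ x z d x⟶z z≤d (ε , 0<ε , M , d<x) with N , x≈z ← x⟶z ε 0<ε =
  close⇒bounded (seq x k) (fromℤ z) (x≈z k (ℕ.m≤n⊔m M N))
    (≡.subst (ℚ._≤ fromℤ (+ d)) (≡.sym (∣fromℤ∣ z)) (fromℤ-mono-≤ (ℤ.+≤+ z≤d)))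
    (d<x k (ℕ.m≤m⊔n M N))
  where
  k : ℕ
  k = M ℕ.⊔ N

∣det∣≯D±1 : ∀ {n} (a : Vector ℝ n) → IsExtremePoint a → ¬ fromℕ (D±1 n) < ∣ det (circ a) ∣
∣det∣≯D±1 {n} a extreme = ⟶⇒≯ (det (circ a)) (detℤ (circ z)) (D±1 n) (⟶-det a z a⟶z) (∣detℤ∣≤D±1 {n} z z∈)
  where
  z : Vector ℤ n
  z = proj₁ (extremePoint⟶signs a extreme)
  z∈ : ∀ i → z i ∈ signs
  z∈ = proj₁ (proj₂ (extremePoint⟶signs a extreme))
  a⟶z : ∀ i → a i ⟶ z i
  a⟶z = proj₂ (proj₂ (extremePoint⟶signs a extreme))

inCube : ∀ {n} (a : Vector ℝ n) (z : Vector ℤ n) → (∀ i → a i ↦ z i) → (∀ i → ℤ.∣ z i ∣ ℕ.≤ 1) → InCube a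
inCube a z a↦z z≤1 i = ↦-≤ (- 1ℝ) (a i) {ℤ.- 1ℤ} {z i} (λ _ → ≡.refl) (a↦z i) (lower (z i) (z≤1 i))
                     , ↦-≤ (a i) 1ℝ {z i} {1ℤ} (a↦z i) (λ _ → ≡.refl) (upper (z i) (z≤1 i))
  where
  lower : ∀ z → ℤ.∣ z ∣ ℕ.≤ 1 → -1ℤ ℤ.≤ z
  lower (+ n)    _           = ℤ.-≤+
  lower -[1+ n ] (ℕ.s≤s n≤0) = ℤ.-≤- n≤0
  upper : ∀ z → ℤ.∣ z ∣ ℕ.≤ 1 → z ℤ.≤ 1ℤ
  upper (+ n)    n≤1 = ℤ.+≤+ n≤1
  upper -[1+ n ] _   = ℤ.-≤+

LargeCubeValue : ℕ → Set
LargeCubeValue n =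
  (Σ (Vector ℝ n) λ a → InCube a × (fromℕ (D±1 n) < ∣ det (circ a) ∣))
  × ((M : ℝ) → IsMaximum (CubeValue n) M → fromℕ (D±1 n) < M)
  × ((a : Vector ℝ n) → IsExtremePoint a → ¬ IsMaximum (CubeValue n) ∣ det (circ a) ∣)

largeCubeValue : ∀ n {d} → D±1 n ≡ d → (a : Vector ℝ n) (z : Vector ℤ n) (v : ℤ) → (∀ i → a i ↦ z i) →
  (∀ i → ℤ.∣ z i ∣ ℕ.≤ 1) → detℤ (circ z) ≡ v → d ℕ.< ℤ.∣ v ∣ → LargeCubeValue n
largeCubeValue n D≡d a z v a↦z z≤1 det≡v d<v =
  (a , a∈ , D<∣det∣) , D<max , λ b extreme max → ∣det∣≯D±1 b extreme (D<max ∣ det (circ b) ∣ max)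
  where
  a∈ : InCube a
  a∈ = inCube a z a↦z z≤1
  D<∣det∣ : fromℕ (D±1 n) < ∣ det (circ a) ∣
  D<∣det∣ = ↦-< (fromℕ (D±1 n)) ∣ det (circ a) ∣ {+ D±1 n} {+ ℤ.∣ detℤ (circ z) ∣} (↦-fromℕ (D±1 n))
    (↦-abs (det (circ a)) (detℤ (circ z)) (↦-det a z a↦z))
    (ℤ.+<+ (≡.subst₂ ℕ._<_ (≡.sym D≡d) (≡.cong (λ d → ℤ.∣ d ∣) (≡.sym det≡v)) d<v))
  D<max : (M : ℝ) → IsMaximum (CubeValue n) M → fromℕ (D±1 n) < M
  D<max M (_ , upper) = <-≤-trans (fromℕ (D±1 n)) ∣ det (circ a) ∣ M D<∣det∣
    (upper ∣ det (circ a) ∣ (a , a∈ , ≗⇒≃ ∣ det (circ a) ∣ ∣ det (circ a) ∣ (λ _ → ≡.refl)))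

-- Determinants of integer polynomials

Polynomial : Set
Polynomial = List ℤ

eval : Polynomial → ℚ → ℚ
eval p x = List.foldr (λ c r → fromℤ c ℚ.+ x ℚ.* r) 0ℚ p

infixl 6 _⊞_
infixl 7 _⊠_
_⊞_ _⊠_ : Polynomial → Polynomial → Polynomial
[]      ⊞ q       = q
(c ∷ p) ⊞ []      = c ∷ p
(c ∷ p) ⊞ (d ∷ q) = (c ℤ.+ d) ∷ (p ⊞ q)

-- Fixing `[]` makes `p ⊠ []` equal to `[]` rather than a list of padding zeros. This matters
-- because computed coefficient lists are compared literally.
shift : Polynomial → Polynomial
shift []      = []
shift (c ∷ p) = + 0 ∷ c ∷ p

[]      ⊠ q = []
(c ∷ p) ⊠ q = List.map (c ℤ.*_) q ⊞ shift (p ⊠ q)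

polynomialRing : RawRing 0ℓ 0ℓ
polynomialRing = record
  { Carrier = Polynomial ; _≈_ = _≡_ ; _+_ = _⊞_ ; _*_ = _⊠_ ; -_ = List.map (λ c → ℤ.- c)
  ; 0# = [] ; 1# = 1ℤ ∷ [] }

module _ (x : ℚ) where
  open ℚ-Solver hiding (Polynomial)

  eval-⊞ : ∀ p q → eval (p ⊞ q) x ≡ eval p x ℚ.+ eval q x
  eval-⊞ []      q       = ≡.sym (ℚ.+-identityˡ (eval q x))
  eval-⊞ (c ∷ p) []      = ≡.sym (ℚ.+-identityʳ (eval (c ∷ p) x))
  eval-⊞ (c ∷ p) (d ∷ q) = ≡.trans
    (≡.cong₂ (λ s t → s ℚ.+ x ℚ.* t) (fromℤ-+ c d) (eval-⊞ p q))
    (solve 5 (λ x c d p q → c :+ d :+ x :* (p :+ q) := c :+ x :* p :+ (d :+ x :* q)) ≡.refl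
      x (fromℤ c) (fromℤ d) (eval p x) (eval q x))

  eval-shift : ∀ p → eval (shift p) x ≡ x ℚ.* eval p x
  eval-shift []      = ≡.sym (ℚ.*-zeroʳ x)
  eval-shift (c ∷ p) = ℚ.+-identityˡ _

  eval-scale : ∀ c p → eval (List.map (c ℤ.*_) p) x ≡ fromℤ c ℚ.* eval p x
  eval-scale c []      = ≡.sym (ℚ.*-zeroʳ (fromℤ c))
  eval-scale c (d ∷ p) = ≡.trans
    (≡.cong₂ (λ s t → s ℚ.+ x ℚ.* t) (fromℤ-* c d) (eval-scale c p))
    (solve 4 (λ x c d p → c :* d :+ x :* (c :* p) := c :* (d :+ x :* p)) ≡.refl
      x (fromℤ c) (fromℤ d) (eval p x))

  eval-⊠ : ∀ p q → eval (p ⊠ q) x ≡ eval p x ℚ.* eval q x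
  eval-⊠ []      q = ≡.sym (ℚ.*-zeroˡ (eval q x))
  eval-⊠ (c ∷ p) q = ≡.trans (eval-⊞ (List.map (c ℤ.*_) q) (shift (p ⊠ q))) (≡.trans
    (≡.cong₂ ℚ._+_ (eval-scale c q) (≡.trans (eval-shift (p ⊠ q)) (≡.cong (x ℚ.*_) (eval-⊠ p q))))
    (solve 4 (λ x c p q → c :* q :+ x :* (p :* q) := (c :+ x :* p) :* q) ≡.refl
      x (fromℤ c) (eval p x) (eval q x)))

  eval-neg : ∀ p → eval (List.map (λ c → ℤ.- c) p) x ≡ ℚ.- eval p x
  eval-neg []      = ≡.refl
  eval-neg (c ∷ p) = ≡.trans
    (≡.cong₂ (λ s t → s ℚ.+ x ℚ.* t) (fromℤ-neg c) (eval-neg p))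
    (solve 3 (λ x c p → :- c :+ x :* (:- p) := :- (c :+ x :* p)) ≡.refl x (fromℤ c) (eval p x))

  eval-constant : ∀ c → eval (c ∷ []) x ≡ fromℤ c
  eval-constant c = ≡.trans (≡.cong (fromℤ c ℚ.+_) (ℚ.*-zeroʳ x)) (ℚ.+-identityʳ (fromℤ c))

  eval-determinantᵗ : ∀ {n} (P : Vector Polynomial n) (a : Vector ℚ n) → (∀ i → eval (P i) x ≡ a i) →
    eval (Memoised.determinantᵗ polynomialRing (circ P)) x ≡ determinant (CommutativeRing.rawRing ℚ.+-*-commutativeRing) (circ a)
  eval-determinantᵗ P a P~a = determinantᵗ-rel ℚ.+-*-commutativeRing {A = polynomialRing}
    {_~_ = λ p q → eval p x ≡ q} (record
    { +-rel  = λ {p} {q} ep eq → ≡.trans (eval-⊞ p q) (≡.cong₂ ℚ._+_ ep eq)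
    ; *-rel  = λ {p} {q} ep eq → ≡.trans (eval-⊠ p q) (≡.cong₂ ℚ._*_ ep eq)
    ; -‿rel  = λ {p} ep → ≡.trans (eval-neg p) (≡.cong (λ r → ℚ.- r) ep)
    ; 0#-rel = ≡.refl
    ; 1#-rel = eval-constant 1ℤ
    }) (λ u≡v ep → ≡.trans ep u≡v) {M = circ P} {N = circ a} (λ i j → P~a (j Rotation.⊖ i))

-- The operations of ℝ act termwise, so the k-th term of a real determinant is the rational
-- determinant of the k-th terms.
det-sample : ∀ {n} (a : Vector ℝ n) k →
  seq (det (circ a)) k ≡ determinant (CommutativeRing.rawRing ℚ.+-*-commutativeRing) (circ (λ i → seq (a i) k))
det-sample a k = RingRelation.determinant-circ-rel {A = ℝ-rawRing} {B = CommutativeRing.rawRing ℚ.+-*-commutativeRing}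
  {_~_ = λ x q → seq x k ≡ q} (record
  { +-rel = ≡.cong₂ ℚ._+_ ; *-rel = ≡.cong₂ ℚ._*_ ; -‿rel = ≡.cong (λ q → ℚ.- q) ; 0#-rel = ≡.refl ; 1#-rel = ≡.refl })
  {a = a} {b = λ i → seq (a i) k} (λ i → ≡.refl)

pencil : ∀ {n} → Polynomial → Vector ℤ n → Vector Polynomial (suc n)
pencil p z = p Vector.∷ λ i → z i ∷ []

detPencil : ∀ {n} → Polynomial → Vector ℤ n → Polynomial
detPencil p z = Memoised.determinantᵗ polynomialRing (circ (pencil p z))

det-pencil : ∀ {n} (A : ℝ → Matrix ℝ (suc n)) (f : ℝ → ℝ) (a : Vector ℝ n) p z →
  (∀ x → A x ≡ circ (f x Vector.∷ a)) → (∀ x k → seq (f x) k ≡ eval p (seq x k)) → (∀ i → a i ↦ z i) →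
  ∀ x k → seq (det (A x)) k ≡ eval (detPencil p z) (seq x k)
det-pencil A f a p z A≡circ f≡p a↦z x k = ≡.trans (≡.trans (≡.cong (λ M → seq (det M) k) (A≡circ x)) (det-sample (f x Vector.∷ a) k))
  (≡.sym (eval-determinantᵗ (seq x k) (pencil p z) (λ i → seq ((f x Vector.∷ a) i) k) entries))
  where
  entries : ∀ i → eval (pencil p z i) (seq x k) ≡ seq ((f x Vector.∷ a) i) k
  entries zero    = ≡.sym (f≡p x k)
  entries (suc i) = ≡.trans (eval-constant (seq x k) (z i)) (≡.sym (a↦z i k))

det-polynomial : ∀ {n} (A : ℝ → Matrix ℝ (suc n)) (f : ℝ → ℝ) (a : Vector ℝ n) p z q →
  (∀ x → A x ≡ circ (f x Vector.∷ a)) → (∀ x k → seq (f x) k ≡ eval p (seq x k)) → (∀ i → a i ↦ z i) →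
  True (≡-dec ℤ._≟_ (detPencil p z) q) → ∀ x k → seq (det (A x)) k ≡ eval q (seq x k)
det-polynomial A f a p z q A≡circ f≡p a↦z p≡q x k = ≡.trans (det-pencil A f a p z A≡circ f≡p a↦z x k)
  (≡.cong (λ r → eval r (seq x k)) (toWitness {a? = ≡-dec ℤ._≟_ (detPencil p z) q} p≡q))

evalPoly-seq : ∀ p x k → seq (evalPoly (List.map (λ c → fromℚ (fromℤ c)) p) x) k ≡ eval p (seq x k)
evalPoly-seq []      x k = ≡.refl
evalPoly-seq (c ∷ p) x k = ≡.cong (λ r → fromℤ c ℚ.+ seq x k ℚ.* r) (evalPoly-seq p x k)

-- The coefficients of p(-x): if p = c + x r, then p(-x) = c - x r(-x). Evenness becomes an equality
-- of lists.
reflect : Polynomial → Polynomial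
reflect []      = []
reflect (c ∷ p) = c ∷ List.map (λ c → ℤ.- c) (reflect p)

eval-reflect : ∀ p x → eval (reflect p) x ≡ eval p (ℚ.- x)
eval-reflect []      x = ≡.refl
eval-reflect (c ∷ p) x = ≡.cong (fromℤ c ℚ.+_) (≡.trans
  (≡.cong (x ℚ.*_) (≡.trans (eval-neg x (reflect p)) (≡.cong (λ r → ℚ.- r) (eval-reflect p x))))
  (solve 2 (λ x r → x :* (:- r) := :- x :* r) ≡.refl x (eval p (ℚ.- x))))
  where open ℚ-Solver

isEvenPolynomial : ∀ (f : ℝ → ℝ) p → (∀ x k → seq (f x) k ≡ eval p (seq x k)) → reflect p ≡ p → IsEvenPolynomial f
isEvenPolynomial f p f≡p even =
    (List.map (λ c → fromℚ (fromℤ c)) p , λ x → ≗⇒≃ (f x) (evalPoly (List.map (λ c → fromℚ (fromℤ c)) p) x)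
      (λ k → ≡.trans (f≡p x k) (≡.sym (evalPoly-seq p x k))))
  , λ x → ≗⇒≃ (f (- x)) (f x) (λ k → begin
      seq (f (- x)) k             ≡⟨ f≡p (- x) k ⟩
      eval p (ℚ.- seq x k)        ≡⟨ eval-reflect p (seq x k) ⟨
      eval (reflect p) (seq x k)  ≡⟨ ≡.cong (λ q → eval q (seq x k)) even ⟩
      eval p (seq x k)            ≡⟨ f≡p x k ⟨
      seq (f x) k                 ∎)
  where open ≡.≡-Reasoning

sumAbs : Polynomial → ℕ
sumAbs = List.foldr (λ c s → ℤ.∣ c ∣ ℕ.+ s) 0

∣eval∣≤sumAbs : ∀ p x → ℚ.∣ x ∣ ℚ.≤ 1ℚ → ℚ.∣ eval p x ∣ ℚ.≤ fromℤ (+ sumAbs p)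
∣eval∣≤sumAbs []      x x≤1 = ℚ.≤-refl
∣eval∣≤sumAbs (c ∷ p) x x≤1 = begin
  ℚ.∣ fromℤ c ℚ.+ x ℚ.* eval p x ∣              ≤⟨ ℚ.∣p+q∣≤∣p∣+∣q∣ (fromℤ c) (x ℚ.* eval p x) ⟩
  ℚ.∣ fromℤ c ∣ ℚ.+ ℚ.∣ x ℚ.* eval p x ∣        ≡⟨ ≡.cong₂ ℚ._+_ (∣fromℤ∣ c) (ℚ.∣p*q∣≡∣p∣*∣q∣ x (eval p x)) ⟩
  fromℤ (+ ℤ.∣ c ∣) ℚ.+ ℚ.∣ x ∣ ℚ.* ℚ.∣ eval p x ∣  ≤⟨ ℚ.+-monoʳ-≤ (fromℤ (+ ℤ.∣ c ∣)) (ℚ.*-monoʳ-≤-nonNeg ℚ.∣ eval p x ∣ x≤1) ⟩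
  fromℤ (+ ℤ.∣ c ∣) ℚ.+ 1ℚ ℚ.* ℚ.∣ eval p x ∣   ≡⟨ ≡.cong (fromℤ (+ ℤ.∣ c ∣) ℚ.+_) (ℚ.*-identityˡ ℚ.∣ eval p x ∣) ⟩
  fromℤ (+ ℤ.∣ c ∣) ℚ.+ ℚ.∣ eval p x ∣          ≤⟨ ℚ.+-monoʳ-≤ (fromℤ (+ ℤ.∣ c ∣)) (∣eval∣≤sumAbs p x x≤1) ⟩
  fromℤ (+ ℤ.∣ c ∣) ℚ.+ fromℤ (+ sumAbs p)      ≡⟨ fromℤ-+ (+ ℤ.∣ c ∣) (+ sumAbs p) ⟨
  fromℤ (+ (ℤ.∣ c ∣ ℕ.+ sumAbs p))              ∎
  where
  open ℚ.≤-Reasoning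
  instance _ = ℚ.∣-∣-nonNeg (eval p x)

linear-approximation : ∀ (f ℓ : ℝ → ℝ) c d r →
  (∀ x k → seq (f x) k ≡ eval (c ∷ d ∷ r) (seq x k)) →
  (∀ x k → seq (ℓ x) k ≡ fromℤ c ℚ.+ fromℤ d ℚ.* seq x k) →
  (λ x → f x - ℓ x) ∈O (λ x → x * x)
linear-approximation f ℓ c d r f≡ ℓ≡ =
  -- The remainder is x² r(x). For |x| < 1 every power of x is bounded by 1, so C is the sum of the
  -- absolute coefficients of r and δ = 1.
  fromℕ (sumAbs r) , 1ℝ , ↦-< 0ℝ 1ℝ {+ 0} {+ 1} (↦-fromℕ 0) (↦-fromℕ 1) (ℤ.+<+ ℕ.z<s) , bound
  where
  open ℚ-Solver hiding (Polynomial)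
  bound : ∀ x → ∣ x ∣ < 1ℝ → ∣ f x - ℓ x ∣ ≤ fromℕ (sumAbs r) * ∣ x * x ∣
  bound x (ε , 0<ε , N , x<1) η 0<η = N , λ n n≥N →
    let t = seq x n
        instance _ = ℚ.∣-∣-nonNeg (t ℚ.* t)
        open ℚ.≤-Reasoning
    in begin-strict
    ℚ.∣ seq (f x) n ℚ.- seq (ℓ x) n ∣
      ≡⟨ ≡.cong₂ (λ p q → ℚ.∣ p ℚ.- q ∣) (f≡ x n) (ℓ≡ x n) ⟩
    ℚ.∣ fromℤ c ℚ.+ t ℚ.* (fromℤ d ℚ.+ t ℚ.* eval r t) ℚ.- (fromℤ c ℚ.+ fromℤ d ℚ.* t) ∣
      ≡⟨ ≡.cong ℚ.∣_∣ (solve 4 (λ c d t e → c :+ t :* (d :+ t :* e) :- (c :+ d :* t) := e :* (t :* t)) ≡.refl (fromℤ c) (fromℤ d) t (eval r t)) ⟩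
    ℚ.∣ eval r t ℚ.* (t ℚ.* t) ∣
      ≡⟨ ℚ.∣p*q∣≡∣p∣*∣q∣ (eval r t) (t ℚ.* t) ⟩
    ℚ.∣ eval r t ∣ ℚ.* ℚ.∣ t ℚ.* t ∣
      ≤⟨ ℚ.*-monoʳ-≤-nonNeg ℚ.∣ t ℚ.* t ∣ (∣eval∣≤sumAbs r t (ℚ.≤-trans (ℚ.<⇒≤ (p<p+q ℚ.∣ t ∣ 0<ε)) (x<1 n n≥N))) ⟩
    fromℤ (+ sumAbs r) ℚ.* ℚ.∣ t ℚ.* t ∣
      <⟨ p<p+q _ 0<η ⟩
    fromℤ (+ sumAbs r) ℚ.* ℚ.∣ t ℚ.* t ∣ ℚ.+ η ∎

-- The matrices of orders 9, 10 and 22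

rowA₉ : Vector ℝ 8
rowA₉ = 1ℝ Vector.∷ - 1ℝ Vector.∷ 1ℝ Vector.∷ - 1ℝ Vector.∷ - 1ℝ Vector.∷ 1ℝ Vector.∷ 1ℝ Vector.∷ 1ℝ
    Vector.∷ Vector.[]

rowA₁₀ : Vector ℝ 9
rowA₁₀ = - 1ℝ Vector.∷ 1ℝ Vector.∷ - 1ℝ Vector.∷ 1ℝ Vector.∷ 1ℝ Vector.∷ - 1ℝ Vector.∷ - 1ℝ
    Vector.∷ - 1ℝ Vector.∷ - 1ℝ Vector.∷ Vector.[]

rowB₁₀ : Vector ℝ 9
rowB₁₀ = - 1ℝ Vector.∷ 1ℝ Vector.∷ 1ℝ Vector.∷ - 1ℝ Vector.∷ - 1ℝ Vector.∷ - 1ℝ Vector.∷ - 1ℝ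
    Vector.∷ - 1ℝ Vector.∷ - 1ℝ Vector.∷ Vector.[]

rowC₁₀ : Vector ℝ 9
rowC₁₀ = - 1ℝ Vector.∷ - 1ℝ Vector.∷ 1ℝ Vector.∷ - 1ℝ Vector.∷ 1ℝ Vector.∷ 1ℝ Vector.∷ - 1ℝ
    Vector.∷ - 1ℝ Vector.∷ - 1ℝ Vector.∷ Vector.[]

rowA₂₂ : Vector ℝ 21
rowA₂₂ = - 1ℝ Vector.∷ 1ℝ Vector.∷ 1ℝ Vector.∷ - 1ℝ Vector.∷ - 1ℝ Vector.∷ - 1ℝ Vector.∷ - 1ℝ
    Vector.∷ - 1ℝ Vector.∷ - 1ℝ Vector.∷ - 1ℝ Vector.∷ 1ℝ Vector.∷ 1ℝ Vector.∷ - 1ℝ Vector.∷ 1ℝ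
    Vector.∷ - 1ℝ Vector.∷ 1ℝ Vector.∷ - 1ℝ Vector.∷ 1ℝ Vector.∷ 1ℝ Vector.∷ - 1ℝ Vector.∷ - 1ℝ
    Vector.∷ Vector.[]

rowB₁₀ᶻ : Vector ℤ 9
rowB₁₀ᶻ = -1ℤ Vector.∷ 1ℤ Vector.∷ 1ℤ Vector.∷ -1ℤ Vector.∷ -1ℤ Vector.∷ -1ℤ Vector.∷ -1ℤ
    Vector.∷ -1ℤ Vector.∷ -1ℤ Vector.∷ Vector.[]

rowC₁₀ᶻ : Vector ℤ 9
rowC₁₀ᶻ = -1ℤ Vector.∷ -1ℤ Vector.∷ 1ℤ Vector.∷ -1ℤ Vector.∷ 1ℤ Vector.∷ 1ℤ Vector.∷ -1ℤ
    Vector.∷ -1ℤ Vector.∷ -1ℤ Vector.∷ Vector.[]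

rowA₉ᶻ : Vector ℤ 8
rowA₉ᶻ = tail (Order9.a 1ℤ)

rowA₁₀ᶻ : Vector ℤ 9
rowA₁₀ᶻ = tail (Order10.a 1ℤ)

rowA₂₂ᶻ : Vector ℤ 21
rowA₂₂ᶻ = tail (Order22.a 1ℤ)

rowA₉↦ : ∀ i → rowA₉ i ↦ rowA₉ᶻ i
rowA₉↦ = ↦-entries rowA₉ rowA₉ᶻ (λ _ → tt)

rowA₁₀↦ : ∀ i → rowA₁₀ i ↦ rowA₁₀ᶻ i
rowA₁₀↦ = ↦-entries rowA₁₀ rowA₁₀ᶻ (λ _ → tt)

rowB₁₀↦ : ∀ i → rowB₁₀ i ↦ rowB₁₀ᶻ i
rowB₁₀↦ = ↦-entries rowB₁₀ rowB₁₀ᶻ (λ _ → tt)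

rowC₁₀↦ : ∀ i → rowC₁₀ i ↦ rowC₁₀ᶻ i
rowC₁₀↦ = ↦-entries rowC₁₀ rowC₁₀ᶻ (λ _ → tt)

rowA₂₂↦ : ∀ i → rowA₂₂ i ↦ rowA₂₂ᶻ i
rowA₂₂↦ = ↦-entries rowA₂₂ rowA₂₂ᶻ (λ _ → tt)

-- The full determinants as polynomials in ε, for `A₁₀` in x, with the constant term first. The two
-- leading entries are the expansions claimed, and the tail determines the constant of the error
-- term. For order 22 only the values at 0 and ±1 are claimed, and these come from evaluation modulo
-- m.
pA₉ pB₁₀ pC₁₀ pA₁₀ : Polynomial
pA₉  = + 6912 ∷ + 4608 ∷ ℤ.- + 1728 ∷ ℤ.- + 1920 ∷ + 576 ∷ + 216 ∷ ℤ.- + 72 ∷ ℤ.- + 18 ∷ + 9 ∷ ℤ.- + 1 ∷ []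
pB₁₀ = ℤ.- + 22528 ∷ ℤ.- + 2560 ∷ + 19200 ∷ ℤ.- + 5120 ∷ ℤ.- + 3840 ∷ + 2912 ∷ ℤ.- + 720 ∷ + 0 ∷ + 40 ∷ ℤ.- + 10 ∷ + 1 ∷ []
pC₁₀ = + 22528 ∷ + 7680 ∷ ℤ.- + 3840 ∷ ℤ.- + 5760 ∷ + 2240 ∷ ℤ.- + 1216 ∷ + 640 ∷ ℤ.- + 160 ∷ + 40 ∷ ℤ.- + 10 ∷ + 1 ∷ []
pA₁₀ = ℤ.- + 33489 ∷ + 0 ∷ + 13045 ∷ + 0 ∷ ℤ.- + 2170 ∷ + 0 ∷ + 90 ∷ + 0 ∷ ℤ.- + 5 ∷ + 0 ∷ + 1 ∷ []

module _ where
  open ℚ-Solver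

  1-x : ∀ x k → seq (1ℝ - x) k ≡ eval (1ℤ ∷ -1ℤ ∷ []) (seq x k)
  1-x x k = solve 1 (λ t → con ℚ.1ℚ :- t := con ℚ.1ℚ :+ t :* (con (ℚ.- ℚ.1ℚ) :+ t :* con ℚ.0ℚ)) ≡.refl (seq x k)

  -1+x : ∀ x k → seq (- 1ℝ + x) k ≡ eval (-1ℤ ∷ 1ℤ ∷ []) (seq x k)
  -1+x x k = solve 1 (λ t → con (ℚ.- ℚ.1ℚ) :+ t := con (ℚ.- ℚ.1ℚ) :+ t :* (con ℚ.1ℚ :+ t :* con ℚ.0ℚ)) ≡.refl (seq x k)

  0+x : ∀ x k → seq x k ≡ eval (+ 0 ∷ 1ℤ ∷ []) (seq x k)
  0+x x k = solve 1 (λ t → t := con ℚ.0ℚ :+ t :* (con ℚ.1ℚ :+ t :* con ℚ.0ℚ)) ≡.refl (seq x k)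

  neg-linear : ∀ c d x → ℚ.- (fromℤ c ℚ.+ fromℤ d ℚ.* x) ≡ fromℤ (ℤ.- c) ℚ.+ fromℤ (ℤ.- d) ℚ.* x
  neg-linear c d x = ≡.trans
    (solve 3 (λ c d x → :- (c :+ d :* x) := :- c :+ (:- d) :* x) ≡.refl (fromℤ c) (fromℤ d) x)
    (≡.sym (≡.cong₂ (λ c d → c ℚ.+ d ℚ.* x) (fromℤ-neg c) (fromℤ-neg d)))

det-A₉ : ∀ x k → seq (det (A₉ x)) k ≡ eval pA₉ (seq x k)
det-A₉ = det-polynomial A₉ (λ x → 1ℝ - x) rowA₉ (1ℤ ∷ -1ℤ ∷ []) rowA₉ᶻ pA₉ (λ _ → ≡.refl) 1-x rowA₉↦ tt

det-B₁₀ : ∀ x k → seq (det (B₁₀ x)) k ≡ eval pB₁₀ (seq x k)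
det-B₁₀ = det-polynomial B₁₀ (λ x → 1ℝ - x) rowB₁₀ (1ℤ ∷ -1ℤ ∷ []) rowB₁₀ᶻ pB₁₀ (λ _ → ≡.refl) 1-x rowB₁₀↦ tt

det-C₁₀ : ∀ x k → seq (det (C₁₀ x)) k ≡ eval pC₁₀ (seq x k)
det-C₁₀ = det-polynomial C₁₀ (λ x → - 1ℝ + x) rowC₁₀ (-1ℤ ∷ 1ℤ ∷ []) rowC₁₀ᶻ pC₁₀ (λ _ → ≡.refl) -1+x rowC₁₀↦ tt

det-A₁₀ : ∀ x k → seq (det (A₁₀ x)) k ≡ eval pA₁₀ (seq x k)
det-A₁₀ = det-polynomial A₁₀ (λ x → x) rowA₁₀ (+ 0 ∷ 1ℤ ∷ []) rowA₁₀ᶻ pA₁₀ (λ _ → ≡.refl) 0+x rowA₁₀↦ tt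

∷-↦ : ∀ {n} x (a : Vector ℝ n) w (z : Vector ℤ n) → x ↦ w → (∀ i → a i ↦ z i) →
      ∀ i → (x Vector.∷ a) i ↦ (w Vector.∷ z) i
∷-↦ x a w z x↦w a↦z zero    = x↦w
∷-↦ x a w z x↦w a↦z (suc i) = a↦z i

det-A₉-1 : det (A₉ 1ℝ) ↦ + 8582
det-A₉-1 = ↦-circ (A₉ 1ℝ) ((1ℝ - 1ℝ) Vector.∷ rowA₉) (Order9.a (+ 0)) ≡.refl
  (∷-↦ (1ℝ - 1ℝ) rowA₉ (+ 0) rowA₉ᶻ (λ _ → ≡.refl) rowA₉↦) Order9.det-a₀

-det-A₁₀ : ∀ x w v → x ↦ w → detℤ (circ (Order10.a w)) ≡ ℤ.- + v → - det (A₁₀ x) ↦ + v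
-det-A₁₀ x w v x↦w det≡ = ↦-neg (det (A₁₀ x)) (ℤ.- + v)
  (↦-circ (A₁₀ x) (x Vector.∷ rowA₁₀) (Order10.a w) ≡.refl (∷-↦ x rowA₁₀ w rowA₁₀ᶻ x↦w rowA₁₀↦) det≡)
  (≡.sym (ℤ.neg-involutive (+ v)))

-det-A₂₂ : ∀ x w v → x ↦ w → detℤ (circ (Order22.a w)) ≡ ℤ.- + v → - det (A₂₂ x) ↦ + v
-det-A₂₂ x w v x↦w det≡ = ↦-neg (det (A₂₂ x)) (ℤ.- + v)
  (↦-circ (A₂₂ x) (x Vector.∷ rowA₂₂) (Order22.a w) ≡.refl (∷-↦ x rowA₂₂ w rowA₂₂ᶻ x↦w rowA₂₂↦) det≡)
  (≡.sym (ℤ.neg-involutive (+ v)))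

0↦ : 0ℝ ↦ + 0
0↦ _ = ≡.refl

1↦ : 1ℝ ↦ 1ℤ
1↦ _ = ≡.refl

-1↦ : - 1ℝ ↦ -1ℤ
-1↦ _ = ≡.refl

-det-A₁₀-0 : - det (A₁₀ 0ℝ) ↦ + 33489
-det-A₁₀-0 = -det-A₁₀ 0ℝ (+ 0) 33489 0↦ Order10.det-a₀

-det-A₁₀-1 : - det (A₁₀ 1ℝ) ↦ + 22528
-det-A₁₀-1 = -det-A₁₀ 1ℝ 1ℤ 22528 1↦ Order10.det-a₁

-det-A₁₀--1 : - det (A₁₀ (- 1ℝ)) ↦ + 22528
-det-A₁₀--1 = -det-A₁₀ (- 1ℝ) -1ℤ 22528 -1↦ Order10.det-a₋₁

-det-A₂₂-0 : - det (A₂₂ 0ℝ) ↦ + 216409254831025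
-det-A₂₂-0 = -det-A₂₂ 0ℝ (+ 0) 216409254831025 0↦ Order22.det-a₀

-det-A₂₂-1 : - det (A₂₂ 1ℝ) ↦ + 215055782117376
-det-A₂₂-1 = -det-A₂₂ 1ℝ 1ℤ 215055782117376 1↦ Order22.det-a₁

-det-A₂₂--1 : - det (A₂₂ (- 1ℝ)) ↦ + 215055782117376
-det-A₂₂--1 = -det-A₂₂ (- 1ℝ) -1ℤ 215055782117376 -1↦ Order22.det-a₋₁

-- The witness in each order is the first row with its leading entry replaced by 0, the midpoint of
-- an edge of the cube. For order 9 this is the row of A(1), where 1 - ε vanishes.
largeCubeValues : ∀ n → n ∈ (9 ∷ 10 ∷ 22 ∷ []) → LargeCubeValue n
largeCubeValues _ (here ≡.refl) =
  largeCubeValue 9 Order9.D±1-9 (0ℝ Vector.∷ rowA₉) (Order9.a (+ 0)) (+ 8582) (∷-↦ 0ℝ rowA₉ (+ 0) rowA₉ᶻ 0↦ rowA₉↦)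
    (toWitness {a? = all? λ i → ℤ.∣ Order9.a (+ 0) i ∣ ℕ.≤? 1} tt) Order9.det-a₀ (toWitness {a? = 6912 ℕ.<? 8582} tt)
largeCubeValues _ (there (here ≡.refl)) =
  largeCubeValue 10 Order10.D±1-10 (0ℝ Vector.∷ rowA₁₀) (Order10.a (+ 0)) (ℤ.- + 33489) (∷-↦ 0ℝ rowA₁₀ (+ 0) rowA₁₀ᶻ 0↦ rowA₁₀↦)
    (toWitness {a? = all? λ i → ℤ.∣ Order10.a (+ 0) i ∣ ℕ.≤? 1} tt) Order10.det-a₀ (toWitness {a? = 22528 ℕ.<? 33489} tt)
largeCubeValues _ (there (there (here ≡.refl))) =
  largeCubeValue 22 Order22.D±1-22 (0ℝ Vector.∷ rowA₂₂) (Order22.a (+ 0)) (ℤ.- + 216409254831025) (∷-↦ 0ℝ rowA₂₂ (+ 0) rowA₂₂ᶻ 0↦ rowA₂₂↦)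
    (toWitness {a? = all? λ i → ℤ.∣ Order22.a (+ 0) i ∣ ℕ.≤? 1} tt) Order22.det-a₀
    (toWitness {a? = 215055782117376 ℕ.<? 216409254831025} tt)

mainTheorem3 : ( ((λ ε → det (A₉ ε) - (fromℕ 6912 + fromℕ 4608 * ε)) ∈O (λ ε → ε * ε))
    × (D±1 9 ≡ 6912)
    × (det (A₉ 1ℝ) ≃ fromℕ 8582)
    × (fromℕ 6912 < det (A₉ 1ℝ))
    )
    ×
    ( (D±1 10 ≡ 22528)
    × ((λ ε → det (B₁₀ ε) - (- (fromℕ 22528 + fromℕ 2560 * ε))) ∈O (λ ε → ε * ε))
    × ((λ ε → det (C₁₀ ε) - (fromℕ 22528 + fromℕ 7680 * ε)) ∈O (λ ε → ε * ε))
    × IsEvenPolynomial (λ x → det (A₁₀ x))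
    × (- det (A₁₀ 0ℝ) ≃ fromℕ 33489)
    × (- det (A₁₀ 1ℝ) ≃ fromℕ 22528)
    × (- det (A₁₀ (- 1ℝ)) ≃ fromℕ 22528)
    × (- det (A₁₀ 1ℝ) < - det (A₁₀ 0ℝ))
    × (- det (A₁₀ (- 1ℝ)) < - det (A₁₀ 0ℝ))
    )
    ×
    ( (- det (A₂₂ 0ℝ) ≃ fromℕ 216409254831025)
    × (- det (A₂₂ 1ℝ) ≃ fromℕ 215055782117376)
    × (- det (A₂₂ (- 1ℝ)) ≃ fromℕ 215055782117376)
    × (- det (A₂₂ 1ℝ) < - det (A₂₂ 0ℝ))
    × (- det (A₂₂ (- 1ℝ)) < - det (A₂₂ 0ℝ))
    × (D±1 22 ≡ 215055782117376)
    )
    ×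
    ( (n : ℕ) → n ∈ (9 ∷ 10 ∷ 22 ∷ []) →
    (Σ (Vector ℝ n) λ a → InCube a × (fromℕ (D±1 n) < ∣ det (circ a) ∣))
    × ((M : ℝ) → IsMaximum (CubeValue n) M → fromℕ (D±1 n) < M)
    × ((a : Vector ℝ n) → IsExtremePoint a →
    ¬ IsMaximum (CubeValue n) ∣ det (circ a) ∣)
    )
mainTheorem3 =
    ( linear-approximation (λ ε → det (A₉ ε)) (λ ε → fromℕ 6912 + fromℕ 4608 * ε) (+ 6912) (+ 4608) (List.drop 2 pA₉) det-A₉ (λ _ _ → ≡.refl)
    , Order9.D±1-9
    , ↦-≃ (det (A₉ 1ℝ)) (fromℕ 8582) {+ 8582} det-A₉-1 (↦-fromℕ 8582)
    , ↦-< (fromℕ 6912) (det (A₉ 1ℝ)) {+ 6912} {+ 8582} (↦-fromℕ 6912) det-A₉-1 (toWitness {a? = + 6912 ℤ.<? + 8582} tt)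
    )
  , ( Order10.D±1-10
    , linear-approximation (λ ε → det (B₁₀ ε)) (λ ε → - (fromℕ 22528 + fromℕ 2560 * ε)) (ℤ.- + 22528) (ℤ.- + 2560) (List.drop 2 pB₁₀) det-B₁₀
        (λ ε k → neg-linear (+ 22528) (+ 2560) (seq ε k))
    , linear-approximation (λ ε → det (C₁₀ ε)) (λ ε → fromℕ 22528 + fromℕ 7680 * ε) (+ 22528) (+ 7680) (List.drop 2 pC₁₀) det-C₁₀ (λ _ _ → ≡.refl)
    , isEvenPolynomial (λ x → det (A₁₀ x)) pA₁₀ det-A₁₀ ≡.refl
    , ↦-≃ (- det (A₁₀ 0ℝ)) (fromℕ 33489) {+ 33489} -det-A₁₀-0 (↦-fromℕ 33489)
    , ↦-≃ (- det (A₁₀ 1ℝ)) (fromℕ 22528) {+ 22528} -det-A₁₀-1 (↦-fromℕ 22528)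
    , ↦-≃ (- det (A₁₀ (- 1ℝ))) (fromℕ 22528) {+ 22528} -det-A₁₀--1 (↦-fromℕ 22528)
    , ↦-< (- det (A₁₀ 1ℝ)) (- det (A₁₀ 0ℝ)) {+ 22528} {+ 33489} -det-A₁₀-1 -det-A₁₀-0 (toWitness {a? = + 22528 ℤ.<? + 33489} tt)
    , ↦-< (- det (A₁₀ (- 1ℝ))) (- det (A₁₀ 0ℝ)) {+ 22528} {+ 33489} -det-A₁₀--1 -det-A₁₀-0 (toWitness {a? = + 22528 ℤ.<? + 33489} tt)
    )
  , ( ↦-≃ (- det (A₂₂ 0ℝ)) (fromℕ 216409254831025) {+ 216409254831025} -det-A₂₂-0 (↦-fromℕ 216409254831025)
    , ↦-≃ (- det (A₂₂ 1ℝ)) (fromℕ 215055782117376) {+ 215055782117376} -det-A₂₂-1 (↦-fromℕ 215055782117376)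
    , ↦-≃ (- det (A₂₂ (- 1ℝ))) (fromℕ 215055782117376) {+ 215055782117376} -det-A₂₂--1 (↦-fromℕ 215055782117376)
    , ↦-< (- det (A₂₂ 1ℝ)) (- det (A₂₂ 0ℝ)) {+ 215055782117376} {+ 216409254831025} -det-A₂₂-1 -det-A₂₂-0
        (toWitness {a? = + 215055782117376 ℤ.<? + 216409254831025} tt)
    , ↦-< (- det (A₂₂ (- 1ℝ))) (- det (A₂₂ 0ℝ)) {+ 215055782117376} {+ 216409254831025} -det-A₂₂--1 -det-A₂₂-0
        (toWitness {a? = + 215055782117376 ℤ.<? + 216409254831025} tt)
    , Order22.D±1-22
    )
  , largeCubeValues
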